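{- For every partition $\lambda$ with at most $n$ parts, $$u_{\lambda,(1^n)}(q)=q^{\frac{n-|\lambda|}{2}}\,X_{\lambda,(1^n)}(q).$$
   Context: Fix $n\ge1$, $(1^n)=(1,\dots,1)$, $\rho_n=(n,\dots,1)$, $|\beta|=\sum\beta_i$, $x^\beta=\prod x_i^{\beta_i}$; $S_n$ permutes coordinates, $l(\sigma)$ = number of inversions. $f_q(\beta)$ is the coefficient of $x^\beta$ in $\prod_{1\le i<j\le n}(1-qx_i/x_j)^{ -1}\prod_{1\le r<s\le n}(1-\frac{q}{x_rx_s})^{ -1}$, and $u_{\lambda,\mu}(q)=\sum_{\sigma\in S_n}(-1)^{l(\sigma)}f_q(\sigma(\lambda+\rho_n)-\mu-\rho_n)$. One dimension sum for $\mu=(1^n)$: let $\mathcal{C}_n$ be the ordered alphabet $1<2<\cdots<n<\bar n<\cdots<\bar1$, with weights $\mathrm{wt}(k)=\varepsilon_k$, $\mathrm{wt}(\bar k)=-\varepsilon_k$ ($\varepsilon_k$ the standard basis of $\mathbb{Z}^n$). Let $E_\lambda$ be the set of words $b=x_1\otimes\cdots\otimes x_n$, $x_i\in\mathcal{C}_n$, such that for every $i=1,\dots,n$ the vector $w_i=\sum_{j\le i}\mathrm{wt}(x_j)$ is a partition (weakly decreasing with nonnegative entries) and $w_n=\lambda$; these are exactly the highest weight vertices of weight $\lambda$ in the $U_q(\mathfrak{sp}_{2n})$-crystal $B(\Lambda_1)^{\otimes n}$ (Kashiwara's tensor convention). For letters $x,y$ set $H(x\otimes y)=1$ if $x\ge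 y$ and $0$ if $x<y$. Then $X_{\lambda,(1^n)}(q)=\sum_{b\in E_\lambda}q^{H(b)}$ with $H(b)=\sum_{i=1}^{n-1}(n-i)H(x_i\otimes x_{i+1})$ (this is the one dimension sum of Hatayama–Kuniba–Okado–Takagi for $C_n^{(1)}$ specialized to $\mu=(1^n)$). -}

module Defs where

open import Data.Nat.Base as ℕ using (ℕ; zero; suc; _∸_)
open import Data.Nat.Divisibility using (divides; _∣?_)
import Data.Nat.Properties as ℕ
open import Data.Integer.Base using (ℤ; +_; -[1+_]; 0ℤ; 1ℤ; -1ℤ; _+_; _-_; _*_; _^_; _≤_; _≥_)
import Data.Integer.Properties as ℤ
open import Data.Fin.Base as Fin using (Fin; toℕ)
import Data.Fin.Properties as Fin
open import Data.List.Base as List using (List; []; _∷_; _++_; length; filter; foldr; concatMap; cartesianProduct; cartesianProductWith; allFin; upTo)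
open import Data.Vec.Base as Vec using (Vec; []; _∷_; replicate; tabulate; lookup; toList; zipWith)
import Data.Vec.Properties as Vec
open import Data.Vec.Relation.Unary.All using (All; all?)
open import Data.Vec.Relation.Unary.Linked using (Linked; linked?)
open import Data.Vec.Relation.Unary.AllPairs using (allPairs?)
open import Data.Bool.Base using (if_then_else_)
open import Data.Product.Base using (_×_; _,_; uncurry)
open import Relation.Nullary.Decidable using (Dec; yes; no; does; map′; ¬?; _×-dec_)
open import Relation.Binary.Definitions using (DecidableEquality; Decidable)
open import Relation.Binary.PropositionalEquality using (_≡_)

private
  variable
    A : Set
    m n : ℕ

infixl 6 _⊕_ _⊖_
infixl 7 _·_ _*ᴸ_ _*ˢ_
infixr 7 t^_·_
infix  4 _≺_ _≺?_ _≟ᵛ_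

_⊕_ _⊖_ : Vec ℤ n → Vec ℤ n → Vec ℤ n
_⊕_ = zipWith _+_
_⊖_ = zipWith _-_

𝟘 : Vec ℤ n
𝟘 = replicate _ 0ℤ

_·_ : ℕ → Vec ℤ n → Vec ℤ n
k · β = Vec.map (+ k *_) β

ε : Fin n → Vec ℤ n
ε i = 𝟘 Vec.[ i ]≔ 1ℤ

_≟ᵛ_ : DecidableEquality (Vec ℤ n)
_≟ᵛ_ = Vec.≡-dec ℤ._≟_

∣_∣ : Vec ℤ n → ℤ
∣ β ∣ = Vec.foldr _ _+_ 0ℤ β

-- ρ = (n, n-1, …, 1); indices in Fin n start from 0.
ρ : (n : ℕ) → Vec ℤ n
ρ n = tabulate (λ i → + (n ∸ toℕ i))

1ⁿ : (n : ℕ) → Vec ℤ n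
1ⁿ n = replicate n 1ℤ

-- Partitions with at most n parts, padded with zeros to length n.
IsPartition : Vec ℤ n → Set
IsPartition β = Linked _≥_ β × All (0ℤ ≤_) β

isPartition? : (β : Vec ℤ n) → Dec (IsPartition β)
isPartition? β = linked? (λ x y → y ℤ.≤? x) β ×-dec all? (0ℤ ℤ.≤?_) β

words : List A → (m : ℕ) → List (Vec A m)
words as zero    = [] ∷ []
words as (suc m) = cartesianProductWith _∷_ as (words as m)

pairs< : (n : ℕ) → List (Fin n × Fin n)
pairs< n = filter (uncurry Fin._<?_) (cartesianProduct (allFin n) (allFin n))

-- Permutations in one-line notation (σ(1), …, σ(n)).
permutations : (n : ℕ) → List (Vec (Fin n) n)
permutations n = filter (allPairs? (λ i j → ¬? (i Fin.≟ j))) (words (allFin n) n)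

inversions : Vec (Fin n) n → ℕ
inversions {n} σ =
  length (filter (λ (i , j) → lookup σ j Fin.<? lookup σ i) (pairs< n))

-- (σ β)ᵢ = β_σ(i).  Sums over Sₙ weighted by (-1)^l(σ) do not depend on the
-- choice between σ and σ⁻¹ here, since l(σ) = l(σ⁻¹).
permute : Vec (Fin n) n → Vec ℤ n → Vec ℤ n
permute σ β = Vec.map (lookup β) σ

-- Power series in q with integer coefficients: a k is the coefficient of q^k.
QSeries : Set
QSeries = ℕ → ℤ

q^ : ℕ → QSeries
q^ d k = if does (d ℕ.≟ k) then 1ℤ else 0ℤ

scale : ℤ → QSeries → QSeries
scale c a k = c * a k

∑ : List A → (A → QSeries) → QSeries
∑ xs a k = foldr (λ x s → a x k + s) 0ℤ xs

-- A Laurent polynomial as a formal sum of terms c x^β; exponents may repeat.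
Laurent : ℕ → Set
Laurent n = List (ℤ × Vec ℤ n)

coeff : Vec ℤ n → Laurent n → ℤ
coeff β = foldr (λ (c , γ) s → (if does (γ ≟ᵛ β) then c else 0ℤ) + s) 0ℤ

_*ᴸ_ : Laurent n → Laurent n → Laurent n
_*ᴸ_ = cartesianProductWith (λ (c , β) (d , γ) → c * d , β ⊕ γ)

-- Power series in q whose coefficients are Laurent polynomials in x₁, …, xₙ.
XSeries : ℕ → Set
XSeries n = ℕ → Laurent n

1ˢ : XSeries n
1ˢ zero    = (1ℤ , 𝟘) ∷ []
1ˢ (suc _) = []

-- Cauchy product; addition of Laurent polynomials is concatenation.
_*ˢ_ : XSeries n → XSeries n → XSeries n
(F *ˢ G) k = concatMap (λ i → F i *ᴸ G (k ∸ i)) (upTo (suc k))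

∏ : List A → (A → XSeries n) → XSeries n
∏ xs F = foldr (λ x P → F x *ˢ P) 1ˢ xs

-- (1 - q x^α)⁻¹ = Σₖ q^k x^(kα)
1/1-qx^ : Vec ℤ n → XSeries n
1/1-qx^ α k = (1ℤ , k · α) ∷ []

-- ∏_{i<j} (1 - q xᵢ/xⱼ)⁻¹ · ∏_{r<s} (1 - q/(xᵣxₛ))⁻¹
generating : (n : ℕ) → XSeries n
generating n =
     ∏ (pairs< n) (λ (i , j) → 1/1-qx^ (ε i ⊖ ε j))
  *ˢ ∏ (pairs< n) (λ (r , s) → 1/1-qx^ (𝟘 ⊖ (ε r ⊕ ε s)))

-- The coefficient of x^β in the product, as a series in q (only finitely many
-- of its coefficients are nonzero).
f : Vec ℤ n → QSeries
f {n} β k = coeff β (generating n k)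

u : Vec ℤ n → Vec ℤ n → QSeries
u {n} λ′ μ = ∑ (permutations n) λ σ →
  scale (-1ℤ ^ inversions σ) (f (permute σ (λ′ ⊕ ρ n) ⊖ μ ⊖ ρ n))

-- The alphabet 1 < 2 < ⋯ < n < n̄ < ⋯ < 1̄.
data Letter (n : ℕ) : Set where
  plain bar : Fin n → Letter n

data _≺_ {n : ℕ} : Letter n → Letter n → Set where
  plain≺plain : ∀ {i j} → i Fin.< j → plain i ≺ plain j
  plain≺bar   : ∀ {i j} → plain i ≺ bar j
  bar≺bar     : ∀ {i j} → j Fin.< i → bar i ≺ bar j

_≺?_ : Decidable (_≺_ {n})
plain i ≺? plain j = map′ plain≺plain (λ { (plain≺plain p) → p }) (i Fin.<? j)
plain i ≺? bar j   = yes plain≺bar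
bar i   ≺? plain j = no λ ()
bar i   ≺? bar j   = map′ bar≺bar (λ { (bar≺bar p) → p }) (j Fin.<? i)

alphabet : (n : ℕ) → List (Letter n)
alphabet n = List.map plain (allFin n) ++ List.map bar (allFin n)

wt : Letter n → Vec ℤ n
wt (plain k) = ε k
wt (bar k)   = 𝟘 ⊖ ε k

-- prefixWeight i b = Σ_{j ≤ i} wt(xⱼ), with letters numbered from 1.
prefixWeight : ℕ → Vec (Letter n) m → Vec ℤ n
prefixWeight i b = foldr (λ x w → wt x ⊕ w) 𝟘 (List.take i (toList b))

IsHighestWeight : Vec ℤ n → Vec (Letter n) n → Set
IsHighestWeight {n} λ′ b =
  ((i : Fin n) → IsPartition (prefixWeight (suc (toℕ i)) b)) × prefixWeight n b ≡ λ′

isHighestWeight? : (λ′ : Vec ℤ n) (b : Vec (Letter n) n) → Dec (IsHighestWeight λ′ b)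
isHighestWeight? {n} λ′ b =
  Fin.all? (λ i → isPartition? (prefixWeight (suc (toℕ i)) b)) ×-dec (prefixWeight n b ≟ᵛ λ′)

E : Vec ℤ n → List (Vec (Letter n) n)
E {n} λ′ = filter (isHighestWeight? λ′) (words (alphabet n) n)

-- The order on letters is total, so x ≥ y is the failure of x < y.
H : Letter n → Letter n → ℕ
H x y = if does (x ≺? y) then 0 else 1

-- Σᵢ (m - i) H(xᵢ ⊗ xᵢ₊₁) for a word of length m: exactly m - i letters
-- follow xᵢ.
energy : Vec (Letter n) m → ℕ
energy []          = 0
energy (x ∷ [])    = 0
energy (x ∷ y ∷ b) = suc (Vec.length b) ℕ.* H x y ℕ.+ energy (y ∷ b)

-- X_{λ,(1ⁿ)}(q); here n is the length of λ.
X : Vec ℤ n → QSeries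
X λ′ = ∑ (E λ′) λ b → q^ (energy b)

-- Series in t = q^{1/2} with integer exponents: g m is the coefficient of t^m.
TSeries : Set
TSeries = ℤ → ℤ

-- a(q) ↦ a(t²)
at-t² : QSeries → TSeries
at-t² a (+ m) with 2 ∣? m
... | yes (divides k _) = a k
... | no  _             = 0ℤ
at-t² a -[1+ m ] = 0ℤ

-- Multiplication by t^d, that is by q^{d/2}.
t^_·_ : ℤ → TSeries → TSeries
(t^ d · g) m = g (m - d)

{-# OPTIONS --safe #-}
module Submission where

-- Both sides have closed forms.  Put Σₖ eₖ y^k = ∏_t (1 + q^t y), Σ_M g_M z^M =
-- ∏_{s≤t} (1 - q^(s+t) z)⁻¹ and D(λ) = det (e_{λᵢ-i+j}).  If n - |λ| = 2M, then
--   X_λ = (1-q)⋯(1-qⁿ) D(λ) g_M   and   u_λ = q^M (1-q)⋯(1-qⁿ) D(λ) g_M,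
-- and both sides vanish if n - |λ| is odd or negative.
-- For u, splitting off the variable x₁ gives a recursion on n (Jing's vertex
-- operator, in disguise), which the closed form satisfies by column operations
-- based on q^k eₖ = eₖ₊₁ - q^(k+1) eₖ₊₁ and by ∏_t (1 - q^t z) Σ g_M z^M = Σ g_M (q²z)^M.
-- For X, q^H(b) / (1-q)⋯(1-qⁿ) is the sum of q^(t₁+⋯+tₙ) over all t₁ ≤ ⋯ ≤ tₙ that
-- increase strictly where xᵢ ≥ xᵢ₊₁, so that (tᵢ , xᵢ) increases lexicographically.
-- Admitting one pair (t , x) after another, every t contributes the operator that
-- adds a vertical strip and then removes one, and each such step multiplies the
-- closed form, taken over finitely many t, by the factors of the next t.
-- All this takes place modulo q^K, so that finitely many t suffice.

open import Defs
open import Level using (0ℓ)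
open import Algebra.Bundles using (CommutativeRing; RawRing)
open import Algebra.Solver.Ring.AlmostCommutativeRing using (fromCommutativeRing; _-Raw-AlmostCommutative⟶_)
import Algebra.Properties.AbelianGroup
import Algebra.Properties.CommutativeSemiring.Exp
import Algebra.Properties.Ring
import Algebra.Properties.Semiring.Mult
import Algebra.Solver.Ring
open import Data.Bool.Base using (if_then_else_; true; false)
open import Data.Empty using (⊥-elim)
open import Data.Fin.Base as Fin using (Fin; zero; suc; toℕ; punchIn)
import Data.Fin.Properties as Fin
open import Data.Integer.Base as ℤ using (ℤ; +_; -[1+_]; 0ℤ; 1ℤ; -1ℤ)
import Data.Integer.Properties as ℤ
open import Data.Integer.Tactic.RingSolver using (solve-∀)
open import Data.List.Base as List using (List; []; _∷_; _++_; upTo; allFin; cartesianProduct; filter; foldl; length)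
open import Data.List.Membership.Propositional using (_∈_)
open import Data.List.Membership.Propositional.Properties using (∈-map⁺; ∈-++⁺ˡ; ∈-++⁺ʳ)
import Data.List.Properties as List
open import Data.List.Relation.Unary.All as ListAll using ([]; _∷_)
import Data.List.Relation.Unary.All.Properties as ListAll
open import Data.List.Relation.Unary.AllPairs as AP using ([]; _∷_)
import Data.List.Relation.Unary.AllPairs.Properties as AP
open import Data.List.Relation.Unary.Any using (here; there)
open import Data.Maybe.Base using (Maybe; just; nothing)
open import Data.Nat.Base as ℕ using (ℕ; zero; suc; z≤n; s≤s; _<ᵇ_)
open import Data.Nat.Divisibility using (divides; _∣?_)
import Data.Nat.Properties as ℕ
open import Data.Product.Base using (_×_; _,_; proj₁; proj₂; uncurry; Σ-syntax)
open import Data.Sum.Base using (_⊎_; inj₁; inj₂)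
open import Data.Vec.Base as Vec using (Vec; []; _∷_; head; tail; lookup)
import Data.Vec.Properties as Vec
open import Data.Vec.Relation.Unary.All as All using (All; []; _∷_; all?)
import Data.Vec.Relation.Unary.All.Properties as All
open import Data.Vec.Relation.Unary.AllPairs as VecAP using (AllPairs; []; _∷_; allPairs?)
import Data.Vec.Relation.Unary.AllPairs.Properties as VecAP
open import Data.Vec.Relation.Unary.Any using (Any; here; there)
open import Data.Vec.Relation.Unary.Linked using ([]; [-]; _∷_)
open import Function.Base using (_∘_)
open import Relation.Binary.Construct.Closure.ReflexiveTransitive as Star using (Star; _◅_; _◅◅_)
open import Relation.Binary.Definitions using (DecidableEquality; tri<; tri≈; tri>)
open import Relation.Binary.PropositionalEquality as ≡ using (_≡_; _≢_; _≗_)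
open import Relation.Nullary using (¬_; yes; no; does; Dec)
open import Relation.Nullary.Decidable using (_×-dec_; ¬?; map′; dec-true; dec-false)
open import Relation.Unary using (Decidable)

-- The two halves share one lemma, `raise-det`. It evaluates the sum of D over all ways of raising
-- the entries of β = λ + ρ, for weights that depend only on the total amount raised. For u such
-- sums arise from expanding the geometric factors that contain x₁. For X the raising with y = -q^t
-- is the inverse of the operator for the barred letters of time t, so that half of a round is
-- checked by undoing it. Raised vectors leave the set of vectors λ + ρ. All closed forms are
-- therefore functions of arbitrary positive integer vectors, and since they alternate, identities
-- between them need checking only at strictly decreasing ones. The hypothesis of `raise-det` is a
-- degree bound: the weights vanish once the total exceeds n(n+1)/2 + n, that is for ∣ λ ∣ > n. Both
-- closed forms meet it because their last factor is a coefficient of degree n - ∣ λ ∣ (or m - ∣ λ ∣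
-- for m ≤ n letters). This is where it matters that the number of boxes of μ = (1ⁿ) equals the
-- number of rows.

private variable
  n m : ℕ

-- Rings, finite sums and Iverson brackets

module Ring (R : CommutativeRing 0ℓ 0ℓ) where
  open CommutativeRing R public hiding (zero)
  open Algebra.Properties.Ring ring public
    using (-0#≈0#; -‿+-comm; -‿distribˡ-*; -‿distribʳ-*; -1*x≈-x; -‿involutive; x[y-z]≈xy-xz)
  open Algebra.Properties.CommutativeSemiring.Exp commutativeSemiring public
    using (_^_; ^-homo-*)
  open import Relation.Binary.Reasoning.Setoid setoid public
  private module M = Algebra.Properties.Semiring.Mult semiring

  -- Integer coefficients for the ring solver: (a , b) stands for a - b.
  module Solver where
    private
      Coeff : RawRing 0ℓ 0ℓ
      Coeff = record
        { Carrier = ℕ × ℕ ; _≈_ = _≡_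
        ; _+_ = λ (a , b) (c , d) → a ℕ.+ c , b ℕ.+ d
        ; _*_ = λ (a , b) (c , d) → a ℕ.* c ℕ.+ b ℕ.* d , a ℕ.* d ℕ.+ b ℕ.* c
        ; -_ = λ (a , b) → b , a ; 0# = 0 , 0 ; 1# = 1 , 0 }

      ⟪_⟫ : ℕ × ℕ → Carrier
      ⟪ a , b ⟫ = a M.× 1# - b M.× 1#

      interchange : ∀ a b c d → (a + b) + (c + d) ≈ (a + c) + (b + d)
      interchange a b c d = begin
        (a + b) + (c + d)  ≈⟨ +-assoc a b _ ⟩
        a + (b + (c + d))  ≈⟨ +-congˡ (trans (sym (+-assoc b c d)) (trans (+-congʳ (+-comm b c)) (+-assoc c b d))) ⟩
        a + (c + (b + d))  ≈⟨ +-assoc a c _ ⟨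
        (a + c) + (b + d)  ∎

      sub+sub : ∀ a b c d → (a + c) - (b + d) ≈ (a - b) + (c - d)
      sub+sub a b c d = trans (+-congˡ (sym (-‿+-comm b d))) (interchange a c (- b) (- d))

      +-homo′ : ∀ p r → ⟪ RawRing._+_ Coeff p r ⟫ ≈ ⟪ p ⟫ + ⟪ r ⟫
      +-homo′ (a , b) (c , d) = trans
        (+-cong (M.×-homo-+ 1# a c) (-‿cong (M.×-homo-+ 1# b d)))
        (sub+sub _ _ _ _)

      neg-homo′ : ∀ p → ⟪ RawRing.-_ Coeff p ⟫ ≈ - ⟪ p ⟫
      neg-homo′ (a , b) = begin
        B - A          ≈⟨ +-comm B (- A) ⟩
        - A + B        ≈⟨ +-congˡ (-‿involutive B) ⟨
        - A + - (- B)  ≈⟨ -‿+-comm A (- B) ⟩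
        - (A - B)      ∎
        where A = a M.× 1#
              B = b M.× 1#

      *-homo′ : ∀ p r → ⟪ RawRing._*_ Coeff p r ⟫ ≈ ⟪ p ⟫ * ⟪ r ⟫
      *-homo′ (a , b) (c , d) = begin
        (a ℕ.* c ℕ.+ b ℕ.* d) M.× 1# - (a ℕ.* d ℕ.+ b ℕ.* c) M.× 1#
          ≈⟨ +-cong (hom a c b d) (-‿cong (hom a d b c)) ⟩
        (A * C + B * D) - (A * D + B * C)    ≈⟨ sub+sub _ _ _ _ ⟩
        (A * C - A * D) + (B * D - B * C)    ≈⟨ +-cong (sym (x[y-z]≈xy-xz A C D)) (sym (x[y-z]≈xy-xz B D C)) ⟩
        A * (C - D) + B * (D - C)            ≈⟨ +-congˡ (*-congˡ (neg-homo′ (c , d))) ⟩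
        A * (C - D) + B * - (C - D)          ≈⟨ +-congˡ (trans (sym (-‿distribʳ-* B _)) (-‿distribˡ-* B _)) ⟩
        A * (C - D) + - B * (C - D)          ≈⟨ distribʳ _ A (- B) ⟨
        (A - B) * (C - D)                    ∎
        where
        A = a M.× 1#
        B = b M.× 1#
        C = c M.× 1#
        D = d M.× 1#
        hom : ∀ a c b d → (a ℕ.* c ℕ.+ b ℕ.* d) M.× 1# ≈ (a M.× 1#) * (c M.× 1#) + (b M.× 1#) * (d M.× 1#)
        hom a c b d = trans (M.×-homo-+ 1# (a ℕ.* c) (b ℕ.* d)) (+-cong (M.×1-homo-* a c) (M.×1-homo-* b d))

      -- The pairs for 0 and 1 are sent to `0#` and `1#` themselves instead of formal differences,
      -- so that `:0` and `:1` match goals that mention these constants.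
      ⟦_⟧ : ℕ × ℕ → Carrier
      ⟦ 0 , 0 ⟧ = 0#
      ⟦ 1 , 0 ⟧ = 1#
      ⟦ p ⟧     = ⟪ p ⟫

      agree : ∀ p → ⟦ p ⟧ ≈ ⟪ p ⟫
      agree (0 , 0)           = sym (trans (+-congˡ -0#≈0#) (+-identityˡ _))
      agree (0 , suc b)       = refl
      agree (1 , 0)           = sym (trans (+-cong (+-identityʳ _) -0#≈0#) (+-identityʳ _))
      agree (1 , suc b)       = refl
      agree (suc (suc a) , b) = refl

      morphism : Coeff -Raw-AlmostCommutative⟶ fromCommutativeRing R
      morphism = record
        { ⟦_⟧ = ⟦_⟧
        ; +-homo = λ p r → trans (agree (RawRing._+_ Coeff p r)) (trans (+-homo′ p r) (sym (+-cong (agree p) (agree r))))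
        ; *-homo = λ p r → trans (agree (RawRing._*_ Coeff p r)) (trans (*-homo′ p r) (sym (*-cong (agree p) (agree r))))
        ; -‿homo = λ p → trans (agree (RawRing.-_ Coeff p)) (trans (neg-homo′ p) (sym (-‿cong (agree p))))
        ; 0-homo = refl
        ; 1-homo = refl }

      -- Equality of pairs would be too fine: (a , b) and (c , d) stand for the same integer as soon
      -- as a + d = c + b.
      difference≟ : ∀ p r → Maybe (⟦ p ⟧ ≈ ⟦ r ⟧)
      difference≟ (a , b) (c , d) with a ℕ.+ d ℕ.≟ c ℕ.+ b
      ... | no _ = nothing
      ... | yes eq = just (trans (agree (a , b)) (trans (begin
        A - B              ≈⟨ trans (sym (+-identityʳ _)) (+-congˡ (sym (-‿inverseʳ D))) ⟩
        (A - B) + (D - D)  ≈⟨ interchange A (- B) D (- D) ⟩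
        (A + D) + (- B - D)  ≈⟨ +-cong eq′ (+-comm (- B) (- D)) ⟩
        (C + B) + (- D - B)  ≈⟨ interchange C B (- D) (- B) ⟩
        (C - D) + (B - B)  ≈⟨ trans (+-congˡ (-‿inverseʳ B)) (+-identityʳ _) ⟩
        C - D  ∎) (sym (agree (c , d)))))
        where
        A = a M.× 1#
        B = b M.× 1#
        C = c M.× 1#
        D = d M.× 1#
        eq′ : A + D ≈ C + B
        eq′ = trans (sym (M.×-homo-+ 1# a d)) (trans (reflexive (≡.cong (M._× 1#) eq)) (M.×-homo-+ 1# c b))

    open Algebra.Solver.Ring Coeff (fromCommutativeRing R) morphism difference≟ public
      using (solve; _:=_; _:+_; _:*_; _:-_; :-_; con)

    :0 :1 : ∀ {n} → Algebra.Solver.Ring.Polynomial Coeff (fromCommutativeRing R) morphism difference≟ n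
    :0 = con (0 , 0)
    :1 = con (1 , 0)

  open Solver public

  private variable
    A B : Set

  sum : List A → (A → Carrier) → Carrier
  sum []       h = 0#
  sum (x ∷ xs) h = h x + sum xs h

  sum-cong : ∀ (xs : List A) {h h′} → (∀ x → h x ≈ h′ x) → sum xs h ≈ sum xs h′
  sum-cong []       eq = refl
  sum-cong (x ∷ xs) eq = +-cong (eq x) (sum-cong xs eq)

  sum-zero : ∀ (xs : List A) {h} → (∀ x → h x ≈ 0#) → sum xs h ≈ 0#
  sum-zero []       eq = refl
  sum-zero (x ∷ xs) eq = trans (+-cong (eq x) (sum-zero xs eq)) (+-identityˡ 0#)

  sum-+ : ∀ (xs : List A) h h′ → sum xs (λ x → h x + h′ x) ≈ sum xs h + sum xs h′
  sum-+ []       h h′ = sym (+-identityˡ 0#)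
  sum-+ (x ∷ xs) h h′ = trans (+-congˡ (sum-+ xs h h′))
    (solve 4 (λ a b c d → (a :+ b) :+ (c :+ d) := (a :+ c) :+ (b :+ d)) refl _ _ _ _)

  sum-* : ∀ c (xs : List A) h → c * sum xs h ≈ sum xs (λ x → c * h x)
  sum-* c []       h = zeroʳ c
  sum-* c (x ∷ xs) h = trans (distribˡ _ _ _) (+-congˡ (sum-* c xs h))

  sum-neg : ∀ (xs : List A) h → - sum xs h ≈ sum xs (λ x → - h x)
  sum-neg []       h = -0#≈0#
  sum-neg (x ∷ xs) h = trans (sym (-‿+-comm _ _)) (+-congˡ (sum-neg xs h))

  sum-swap : ∀ (xs : List A) (ys : List B) (h : A → B → Carrier) →
    sum xs (λ x → sum ys (h x)) ≈ sum ys (λ y → sum xs (λ x → h x y))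
  sum-swap []       ys h = sym (sum-zero ys (λ _ → refl))
  sum-swap (x ∷ xs) ys h = trans (+-congˡ (sum-swap xs ys h)) (sym (sum-+ ys (h x) _))

  sum-++ : ∀ (xs ys : List A) h → sum (xs ++ ys) h ≈ sum xs h + sum ys h
  sum-++ []       ys h = sym (+-identityˡ _)
  sum-++ (x ∷ xs) ys h = trans (+-congˡ (sum-++ xs ys h)) (sym (+-assoc _ _ _))

  sum-map : ∀ (f : A → B) xs h → sum (List.map f xs) h ≈ sum xs (λ x → h (f x))
  sum-map f []       h = refl
  sum-map f (x ∷ xs) h = +-congˡ (sum-map f xs h)

  sum-applyUpTo : ∀ (f : ℕ → A) n h → sum (List.applyUpTo f n) h ≈ sum (upTo n) (λ i → h (f i))
  sum-applyUpTo f n h = trans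
    (reflexive (≡.cong (λ xs → sum xs h) (≡.sym (List.map-upTo f n))))
    (sum-map f (upTo n) h)

  sum-upTo-suc : ∀ n h → sum (upTo (suc n)) h ≈ h 0 + sum (upTo n) (λ i → h (suc i))
  sum-upTo-suc n h = +-congˡ (sum-applyUpTo suc n h)

  sum-upTo-cong : ∀ n {h h′} → (∀ i → i ℕ.< n → h i ≈ h′ i) → sum (upTo n) h ≈ sum (upTo n) h′
  sum-upTo-cong zero    eq = refl
  sum-upTo-cong (suc n) {h} {h′} eq = begin
    sum (upTo (suc n)) h                       ≈⟨ sum-upTo-suc n h ⟩
    h 0 + sum (upTo n) (λ i → h (suc i))       ≈⟨ +-cong (eq 0 (s≤s z≤n)) (sum-upTo-cong n λ i i<n → eq (suc i) (s≤s i<n)) ⟩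
    h′ 0 + sum (upTo n) (λ i → h′ (suc i))     ≈⟨ sum-upTo-suc n h′ ⟨
    sum (upTo (suc n)) h′                      ∎

  sum-upTo-last : ∀ n h → sum (upTo (suc n)) h ≈ sum (upTo n) h + h n
  sum-upTo-last zero    h = trans (+-identityʳ _) (sym (+-identityˡ _))
  sum-upTo-last (suc n) h = begin
    sum (upTo (suc (suc n))) h                      ≈⟨ sum-upTo-suc (suc n) h ⟩
    h 0 + sum (upTo (suc n)) (λ i → h (suc i))      ≈⟨ +-congˡ (sum-upTo-last n _) ⟩
    h 0 + (sum (upTo n) (λ i → h (suc i)) + h (suc n)) ≈⟨ +-assoc _ _ _ ⟨
    h 0 + sum (upTo n) (λ i → h (suc i)) + h (suc n)   ≈⟨ +-congʳ (sum-upTo-suc n h) ⟨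
    sum (upTo (suc n)) h + h (suc n)                ∎

  sum-upTo-extend : ∀ m n h → m ℕ.≤ n → (∀ i → m ℕ.≤ i → h i ≈ 0#) → sum (upTo n) h ≈ sum (upTo m) h
  sum-upTo-extend zero    n       h _         eq = sum-zero (upTo n) (λ i → eq i z≤n)
  sum-upTo-extend (suc m) (suc n) h (s≤s m≤n) eq = begin
    sum (upTo (suc n)) h                  ≈⟨ sum-upTo-suc n h ⟩
    h 0 + sum (upTo n) (λ i → h (suc i))  ≈⟨ +-congˡ (sum-upTo-extend m n _ m≤n λ i m≤i → eq (suc i) (s≤s m≤i)) ⟩
    h 0 + sum (upTo m) (λ i → h (suc i))  ≈⟨ sum-upTo-suc m h ⟨
    sum (upTo (suc m)) h                  ∎

  infixr 7 [_]∙_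
  [_]∙_ : ∀ {P : Set} → Dec P → Carrier → Carrier
  [ P? ]∙ a = if does P? then a else 0#

  []∙-cong : ∀ {P : Set} (P? : Dec P) {a b} → a ≈ b → [ P? ]∙ a ≈ [ P? ]∙ b
  []∙-cong P? eq with does P?
  ... | true  = eq
  ... | false = refl

  []∙-zero : ∀ {P : Set} (P? : Dec P) → [ P? ]∙ 0# ≈ 0#
  []∙-zero P? with does P?
  ... | true  = refl
  ... | false = refl

  []∙-+ : ∀ {P : Set} (P? : Dec P) a b → [ P? ]∙ (a + b) ≈ [ P? ]∙ a + [ P? ]∙ b
  []∙-+ P? a b with does P?
  ... | true  = refl
  ... | false = sym (+-identityˡ 0#)

  []∙-* : ∀ {P : Set} (P? : Dec P) c a → [ P? ]∙ (c * a) ≈ c * ([ P? ]∙ a)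
  []∙-* P? c a with does P?
  ... | true  = refl
  ... | false = sym (zeroʳ c)

  []∙-true : ∀ {P : Set} (P? : Dec P) a → P → [ P? ]∙ a ≈ a
  []∙-true P? a p rewrite dec-true P? p = refl

  []∙-false : ∀ {P : Set} (P? : Dec P) a → ¬ P → [ P? ]∙ a ≈ 0#
  []∙-false P? a ¬p rewrite dec-false P? ¬p = refl

  []∙-vanish : ∀ {P : Set} (P? : Dec P) {a} → (P → a ≈ 0#) → [ P? ]∙ a ≈ 0#
  []∙-vanish (yes p) eq = eq p
  []∙-vanish (no _)  eq = refl

  []∙-⇔ : ∀ {P Q : Set} (P? : Dec P) (Q? : Dec Q) {a} → (P → Q) → (Q → P) → [ P? ]∙ a ≈ [ Q? ]∙ a
  []∙-⇔ (yes p) Q? to from = sym ([]∙-true Q? _ (to p))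
  []∙-⇔ (no ¬p) Q? to from = sym ([]∙-false Q? _ (λ q → ¬p (from q)))

  sum-concatMap : ∀ (f : A → List B) xs h → sum (List.concatMap f xs) h ≈ sum xs (λ x → sum (f x) h)
  sum-concatMap f []       h = refl
  sum-concatMap f (x ∷ xs) h = trans (sum-++ (f x) _ h) (+-congˡ (sum-concatMap f xs h))

  sum-cartesianProductWith : ∀ {C : Set} (f : A → B → C) xs ys h →
    sum (List.cartesianProductWith f xs ys) h ≈ sum xs (λ x → sum ys (λ y → h (f x y)))
  sum-cartesianProductWith f []       ys h = refl
  sum-cartesianProductWith f (x ∷ xs) ys h = trans (sum-++ (List.map (f x) ys) _ h)
    (+-cong (sum-map (f x) ys h) (sum-cartesianProductWith f xs ys h))

  sum-filter : ∀ {P : A → Set} (P? : ∀ x → Dec (P x)) xs h → sum (List.filter P? xs) h ≈ sum xs (λ x → [ P? x ]∙ h x)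
  sum-filter P? []       h = refl
  sum-filter P? (x ∷ xs) h with does (P? x)
  ... | true  = +-congˡ (sum-filter P? xs h)
  ... | false = trans (sum-filter P? xs h) (sym (+-identityˡ _))

  -- Both sides run over the triangle i + j < n, the left one along its diagonals. This unfolds the
  -- Cauchy product `_*ˢ_`.
  sum-diagonal : ∀ n (W : ℕ → ℕ → Carrier) →
    sum (upTo n) (λ k → sum (upTo (suc k)) (λ i → W i (k ℕ.∸ i))) ≈ sum (upTo n) (λ i → sum (upTo (n ℕ.∸ i)) (W i))
  sum-diagonal zero    W = refl
  sum-diagonal (suc n) W = begin
    sum (upTo (suc n)) (λ k → sum (upTo (suc k)) (λ i → W i (k ℕ.∸ i)))
      ≈⟨ sum-cong (upTo (suc n)) (λ k → sum-upTo-suc k _) ⟩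
    sum (upTo (suc n)) (λ k → W 0 k + sum (upTo k) (λ i → W (suc i) (k ℕ.∸ suc i)))
      ≈⟨ sum-+ (upTo (suc n)) (W 0) _ ⟩
    sum (upTo (suc n)) (W 0) + sum (upTo (suc n)) (λ k → sum (upTo k) (λ i → W (suc i) (k ℕ.∸ suc i)))
      ≈⟨ +-congˡ (trans (sum-upTo-suc n _) (trans (+-identityˡ _) (sum-diagonal n (λ i → W (suc i))))) ⟩
    sum (upTo (suc n)) (W 0) + sum (upTo n) (λ i → sum (upTo (n ℕ.∸ i)) (W (suc i)))
      ≈⟨ sum-upTo-suc n _ ⟨
    sum (upTo (suc n)) (λ i → sum (upTo (suc n ℕ.∸ i)) (W i)) ∎

  []∙-sum : ∀ {P : Set} (P? : Dec P) (xs : List A) h → [ P? ]∙ sum xs h ≈ sum xs (λ x → [ P? ]∙ h x)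
  []∙-sum P? xs h with does P?
  ... | true  = refl
  ... | false = sym (sum-zero xs (λ _ → refl))

-- Truncated power series

-- The ring R[[w]]/(w^L), carried by all power series.
module Truncated (R : CommutativeRing 0ℓ 0ℓ) (L : ℕ) where
  private module R = Ring R
  open R using (_≈_; _+_; _*_; -_; 0#; 1#; refl; trans; sym; +-cong; *-cong; +-congˡ; +-congʳ; solve; _:+_; _:*_; _:=_; :0)

  Series : Set
  Series = ℕ → R.Carrier

  infix 4 _≋_
  -- As a record the relation keeps both series visible to unification, which could not recover them
  -- from a bare function type.
  record _≋_ (a b : Series) : Set where
    constructor mk≋
    field at : ∀ k → k ℕ.< L → a k ≈ b k
  open _≋_ public

  private
    infix 4 _≐_
    _≐_ : Series → Series → Set
    a ≐ b = ∀ k → a k ≈ b k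

    weaken : ∀ {a b} → a ≐ b → a ≋ b
    weaken eq = mk≋ λ k _ → eq k

  infixl 7 _⊛_
  infixl 6 _⊞_

  _⊞_ : Series → Series → Series
  (a ⊞ b) k = a k + b k

  -- The splitting a = a₀ + w (a ∘ suc) makes the Cauchy product a structural recursion. Its mirror
  -- image `⊛-suc` splits the right factor, and the two together give commutativity.
  _⊛_ : Series → Series → Series
  (a ⊛ b) zero    = a 0 * b 0
  (a ⊛ b) (suc k) = a 0 * b (suc k) + ((a ∘ suc) ⊛ b) k

  ι : R.Carrier → Series
  ι r zero    = r
  ι r (suc k) = 0#

  var : Series
  var zero          = 0#
  var (suc zero)    = 1#
  var (suc (suc k)) = 0#

  ⊛-cong-≤ : ∀ {a a′ b b′} k → (∀ j → j ℕ.≤ k → a j ≈ a′ j) → (∀ j → j ℕ.≤ k → b j ≈ b′ j) →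
    (a ⊛ b) k ≈ (a′ ⊛ b′) k
  ⊛-cong-≤ zero    p r = *-cong (p 0 z≤n) (r 0 z≤n)
  ⊛-cong-≤ (suc k) p r = +-cong (*-cong (p 0 z≤n) (r (suc k) ℕ.≤-refl))
    (⊛-cong-≤ k (λ j j≤k → p (suc j) (s≤s j≤k)) (λ j j≤k → r j (ℕ.m≤n⇒m≤1+n j≤k)))

  ⊛-congʳ : ∀ {a a′} b → a ≐ a′ → a ⊛ b ≐ a′ ⊛ b
  ⊛-congʳ b eq k = ⊛-cong-≤ k (λ j _ → eq j) (λ _ _ → refl)

  ⊛-distribʳ : ∀ c a b → (a ⊞ b) ⊛ c ≐ (a ⊛ c) ⊞ (b ⊛ c)
  ⊛-distribʳ c a b zero    = R.distribʳ _ _ _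
  ⊛-distribʳ c a b (suc k) = trans (+-congˡ (⊛-distribʳ c (a ∘ suc) (b ∘ suc) k))
    (solve 5 (λ x y z u v → (x :+ y) :* z :+ (u :+ v) := (x :* z :+ u) :+ (y :* z :+ v)) refl _ _ _ _ _)

  ⊛-zeroˡ : ∀ {a} b → (∀ k → a k ≈ 0#) → ∀ k → (a ⊛ b) k ≈ 0#
  ⊛-zeroˡ b z zero    = trans (*-cong (z 0) refl) (R.zeroˡ _)
  ⊛-zeroˡ b z (suc k) = trans (+-cong (trans (*-cong (z 0) refl) (R.zeroˡ _)) (⊛-zeroˡ b (z ∘ suc) k)) (R.+-identityˡ _)

  ι-⊛ : ∀ r b k → (ι r ⊛ b) k ≈ r * b k
  ι-⊛ r b zero    = refl
  ι-⊛ r b (suc k) = trans (+-congˡ (⊛-zeroˡ b (λ _ → refl) k)) (R.+-identityʳ _)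

  ⊛-suc : ∀ a b k → (a ⊛ b) (suc k) ≈ (a ⊛ (b ∘ suc)) k + a (suc k) * b 0
  ⊛-suc a b zero    = refl
  ⊛-suc a b (suc k) = trans (+-congˡ (⊛-suc (a ∘ suc) b k)) (sym (R.+-assoc _ _ _))

  ⊛-comm : ∀ a b → a ⊛ b ≐ b ⊛ a
  ⊛-comm a b zero    = R.*-comm _ _
  ⊛-comm a b (suc k) = begin
    a 0 * b (suc k) + ((a ∘ suc) ⊛ b) k  ≈⟨ +-congˡ (⊛-comm (a ∘ suc) b k) ⟩
    a 0 * b (suc k) + (b ⊛ (a ∘ suc)) k  ≈⟨ solve 3 (λ x y z → x :* y :+ z := z :+ y :* x) refl _ _ _ ⟩
    (b ⊛ (a ∘ suc)) k + b (suc k) * a 0  ≈⟨ ⊛-suc b a k ⟨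
    (b ⊛ a) (suc k)                      ∎
    where open R

  ⊛-assoc : ∀ a b c → (a ⊛ b) ⊛ c ≐ a ⊛ (b ⊛ c)
  ⊛-assoc a b c zero    = R.*-assoc _ _ _
  ⊛-assoc a b c (suc k) = begin
    (a 0 * b 0) * c (suc k) + (((a ⊛ b) ∘ suc) ⊛ c) k
      ≈⟨ +-congˡ (⊛-congʳ c (λ j → +-congʳ (sym (ι-⊛ (a 0) (b ∘ suc) j))) k) ⟩
    (a 0 * b 0) * c (suc k) + (((ι (a 0) ⊛ (b ∘ suc)) ⊞ ((a ∘ suc) ⊛ b)) ⊛ c) k
      ≈⟨ +-congˡ (⊛-distribʳ c _ _ k) ⟩
    (a 0 * b 0) * c (suc k) + (((ι (a 0) ⊛ (b ∘ suc)) ⊛ c) k + (((a ∘ suc) ⊛ b) ⊛ c) k)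
      ≈⟨ +-congˡ (+-cong (scaled (a 0) (b ∘ suc) k) (⊛-assoc (a ∘ suc) b c k)) ⟩
    (a 0 * b 0) * c (suc k) + (a 0 * ((b ∘ suc) ⊛ c) k + ((a ∘ suc) ⊛ (b ⊛ c)) k)
      ≈⟨ solve 5 (λ x y z u v → (x :* y) :* z :+ (x :* u :+ v) := x :* (y :* z :+ u) :+ v) refl _ _ _ _ _ ⟩
    a 0 * (b 0 * c (suc k) + ((b ∘ suc) ⊛ c) k) + ((a ∘ suc) ⊛ (b ⊛ c)) k ∎
    where
    open R
    scaled : ∀ r d k → ((ι r ⊛ d) ⊛ c) k ≈ r * (d ⊛ c) k
    scaled r d zero    = R.*-assoc _ _ _
    scaled r d (suc k) = trans
      (+-cong (R.*-assoc _ _ _) (trans (⊛-congʳ c shifted k) (scaled r (d ∘ suc) k)))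
      (sym (R.distribˡ _ _ _))
      where
      shifted : ∀ j → (ι r ⊛ d) (suc j) ≈ (ι r ⊛ (d ∘ suc)) j
      shifted j = trans (ι-⊛ r d (suc j)) (sym (ι-⊛ r (d ∘ suc) j))

  seriesRing : CommutativeRing 0ℓ 0ℓ
  seriesRing = record
    { Carrier = Series ; _≈_ = _≋_ ; _+_ = _⊞_ ; _*_ = _⊛_ ; -_ = λ a k → - a k
    ; 0# = λ _ → 0# ; 1# = ι 1#
    ; isCommutativeRing = record
      { isRing = record
        { +-isAbelianGroup = record
          { isGroup = record
            { isMonoid = record
              { isSemigroup = record
                { isMagma = record
                  { isEquivalence = record
                    { refl = weaken λ _ → refl
                    ; sym = λ p → mk≋ λ k l → sym (at p k l)
                    ; trans = λ p r → mk≋ λ k l → trans (at p k l) (at r k l) }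
                  ; ∙-cong = λ p r → mk≋ λ k l → +-cong (at p k l) (at r k l) }
                ; assoc = λ _ _ _ → weaken λ _ → R.+-assoc _ _ _ }
              ; identity = (λ _ → weaken λ _ → R.+-identityˡ _) , (λ _ → weaken λ _ → R.+-identityʳ _) }
            ; inverse = (λ _ → weaken λ _ → R.-‿inverseˡ _) , (λ _ → weaken λ _ → R.-‿inverseʳ _)
            ; ⁻¹-cong = λ p → mk≋ λ k l → R.-‿cong (at p k l) }
          ; comm = λ _ _ → weaken λ _ → R.+-comm _ _ }
        ; *-cong = λ p r → mk≋ λ k l → ⊛-cong-≤ k
            (λ j j≤k → at p j (ℕ.≤-<-trans j≤k l)) (λ j j≤k → at r j (ℕ.≤-<-trans j≤k l))
        ; *-assoc = λ a b c → weaken (⊛-assoc a b c)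
        ; *-identity = (λ a → weaken (identityˡ a))
                     , (λ a → weaken λ k → trans (⊛-comm a (ι 1#) k) (identityˡ a k))
        ; distrib = (λ a b c → weaken λ k → trans (⊛-comm a (b ⊞ c) k)
                        (trans (⊛-distribʳ a b c k) (+-cong (⊛-comm b a k) (⊛-comm c a k))))
                  , (λ a b c → weaken (⊛-distribʳ a b c)) }
      ; *-comm = λ a b → weaken (⊛-comm a b) } }
    where
    identityˡ : ∀ a → ι 1# ⊛ a ≐ a
    identityˡ a k = trans (ι-⊛ 1# a k) (R.*-identityˡ _)

  private module S = Ring seriesRing

  var-⊛-zero : ∀ a → (var ⊛ a) 0 ≈ 0#
  var-⊛-zero a = R.zeroˡ _

  var-⊛-suc : ∀ a k → (var ⊛ a) (suc k) ≈ a k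
  var-⊛-suc a k = trans (+-cong (R.zeroˡ _) (trans (⊛-congʳ a (λ { zero → refl ; (suc _) → refl }) k)
    (trans (ι-⊛ 1# a k) (R.*-identityˡ _)))) (R.+-identityˡ _)

  var^-⊛-< : ∀ i a k → k ℕ.< i → (var S.^ i ⊛ a) k ≈ 0#
  var^-⊛-< (suc i) a k k<i = trans (⊛-assoc var (var S.^ i) a k) (case k k<i)
    where
    case : ∀ k → k ℕ.< suc i → (var ⊛ (var S.^ i ⊛ a)) k ≈ 0#
    case zero    _         = var-⊛-zero (var S.^ i ⊛ a)
    case (suc k) (s≤s k<i) = trans (var-⊛-suc _ k) (var^-⊛-< i a k k<i)

  var^-⊛-+ : ∀ i a k → (var S.^ i ⊛ a) (i ℕ.+ k) ≈ a k
  var^-⊛-+ zero    a k = trans (ι-⊛ 1# a k) (R.*-identityˡ _)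
  var^-⊛-+ (suc i) a k = trans (⊛-assoc var (var S.^ i) a (suc i ℕ.+ k))
    (trans (var-⊛-suc _ (i ℕ.+ k)) (var^-⊛-+ i a k))

  var^L≋0 : var S.^ L ≋ λ _ → 0#
  var^L≋0 = mk≋ λ k k<L → trans (sym (one k)) (var^-⊛-< L (ι 1#) k k<L)
    where
    one : ∀ k → (var S.^ L ⊛ ι 1#) k ≈ (var S.^ L) k
    one k = trans (⊛-comm _ _ k) (trans (ι-⊛ 1# _ k) (R.*-identityˡ _))

  ι-cong : ∀ {x y} → x ≈ y → ι x ≋ ι y
  ι-cong eq = weaken λ { zero → eq ; (suc _) → refl }

  ι-+ : ∀ x y → ι (x + y) ≋ ι x ⊞ ι y
  ι-+ x y = weaken λ { zero → refl ; (suc _) → sym (R.+-identityˡ _) }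

  ι-- : ∀ x → ι (- x) ≋ (λ k → - ι x k)
  ι-- x = weaken λ { zero → refl ; (suc _) → sym R.-0#≈0# }

  ι-* : ∀ x y → ι (x * y) ≋ ι x ⊛ ι y
  ι-* x y = weaken λ { zero → refl ; (suc k) → sym (trans (ι-⊛ x (ι y) (suc k)) (R.zeroʳ _)) }

  ι-0 : ι 0# ≋ λ _ → 0#
  ι-0 = weaken λ { zero → refl ; (suc _) → refl }

-- Antisymmetrisation and determinants

Positive : Vec ℤ n → Set
Positive = All (0ℤ ℤ.<_)

data Swap : Vec ℤ n → Vec ℤ n → Set where
  here  : ∀ {x y} {v : Vec ℤ n} → Swap (x ∷ y ∷ v) (y ∷ x ∷ v)
  there : ∀ {z} {v w : Vec ℤ n} → Swap v w → Swap (z ∷ v) (z ∷ w)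

data Repeats : Vec ℤ n → Set where
  here  : ∀ {x} {v : Vec ℤ n} → Repeats (x ∷ x ∷ v)
  there : ∀ {z} {v : Vec ℤ n} → Repeats v → Repeats (z ∷ v)

module Alt (R : CommutativeRing 0ℓ 0ℓ) where
  open Ring R

  Fun : ℕ → Set
  Fun n = Vec ℤ n → Carrier

  -- Σᵢ (-1)ⁱ g βᵢ (β without βᵢ)
  pickSum : (ℤ → Fun n) → Fun (suc n)
  pickSum {zero}  g (x ∷ []) = g x []
  pickSum {suc n} g (x ∷ β)  = g x β - pickSum (λ z γ → g z (x ∷ γ)) β

  -- The signed sum of φ over all rearrangements of β, expanded along the entry that is put first.
  -- `Alt-permutations` later identifies the signs with those given by inversions.
  Alt : Fun n → Fun n
  Alt {zero}  φ = φ
  Alt {suc n} φ = pickSum (λ x → Alt (λ v → φ (x ∷ v)))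

  -- The closed forms are established at positive vectors and depend on the total, so the summands
  -- are compared with the knowledge that picking an entry preserves both.
  pickSum-cong-on : ∀ {g g′ : ℤ → Fun n} (β : Vec ℤ (suc n)) → Positive β →
    (∀ x γ → Positive (x ∷ γ) → x ℤ.+ ∣ γ ∣ ≡ ∣ β ∣ → g x γ ≈ g′ x γ) → pickSum g β ≈ pickSum g′ β
  pickSum-cong-on {zero}  (x ∷ []) pos eq = eq x [] pos ≡.refl
  pickSum-cong-on {suc n} (x ∷ β) (p ∷ pos) eq = +-cong (eq x β (p ∷ pos) ≡.refl)
    (-‿cong (pickSum-cong-on β pos λ { z γ (q ∷ pos′) e → eq z (x ∷ γ) (q ∷ p ∷ pos′)
      (≡.trans (exch z x ∣ γ ∣) (≡.cong (ℤ._+_ x) e)) }))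
    where
    exch : ∀ z x s → z ℤ.+ (x ℤ.+ s) ≡ x ℤ.+ (z ℤ.+ s)
    exch = solve-∀

  pickSum-cong : ∀ {g g′ : ℤ → Fun n} β → (∀ x γ → g x γ ≈ g′ x γ) → pickSum g β ≈ pickSum g′ β
  pickSum-cong {zero}  (x ∷ []) eq = eq x []
  pickSum-cong {suc n} (x ∷ β)  eq = +-cong (eq x β) (-‿cong (pickSum-cong β λ z γ → eq z (x ∷ γ)))

  pickSum-+ : ∀ (g h : ℤ → Fun n) β → pickSum (λ x γ → g x γ + h x γ) β ≈ pickSum g β + pickSum h β
  pickSum-+ {zero}  g h (x ∷ []) = refl
  pickSum-+ {suc n} g h (x ∷ β)  = trans (+-congˡ (-‿cong (pickSum-+ _ _ β)))
    (solve 4 (λ a b c d → (a :+ b) :- (c :+ d) := (a :- c) :+ (b :- d)) refl _ _ _ _)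

  pickSum-* : ∀ c (g : ℤ → Fun n) β → pickSum (λ x γ → c * g x γ) β ≈ c * pickSum g β
  pickSum-* {zero}  c g (x ∷ []) = refl
  pickSum-* {suc n} c g (x ∷ β)  = trans (+-congˡ (-‿cong (pickSum-* c _ β)))
    (solve 3 (λ c a b → c :* a :- c :* b := c :* (a :- b)) refl _ _ _)

  pickSum-zero : ∀ {g : ℤ → Fun n} β → (∀ x γ → g x γ ≈ 0#) → pickSum g β ≈ 0#
  pickSum-zero β eq = trans (pickSum-cong β (λ x γ → trans (eq x γ) (sym (zeroˡ 0#))))
    (trans (pickSum-* 0# (λ _ _ → 0#) β) (zeroˡ _))

  pickSum-neg : ∀ (g : ℤ → Fun n) β → pickSum (λ x γ → - g x γ) β ≈ - pickSum g β
  pickSum-neg g β = trans (pickSum-cong β (λ x γ → sym (-1*x≈-x _))) (trans (pickSum-* _ g β) (-1*x≈-x _))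

  pickSum-sum : ∀ {A : Set} (xs : List A) (g : A → ℤ → Fun n) β →
    pickSum (λ x γ → sum xs (λ a → g a x γ)) β ≈ sum xs (λ a → pickSum (g a) β)
  pickSum-sum []       g β = pickSum-zero β (λ _ _ → refl)
  pickSum-sum (a ∷ xs) g β = trans (pickSum-+ (g a) _ β) (+-congˡ (pickSum-sum xs g β))

  Alt-cong : ∀ {φ φ′ : Fun n} β → (∀ v → φ v ≈ φ′ v) → Alt φ β ≈ Alt φ′ β
  Alt-cong {zero}  β eq = eq β
  Alt-cong {suc n} β eq = pickSum-cong β (λ x γ → Alt-cong γ λ v → eq (x ∷ v))

  Alt-* : ∀ c (φ : Fun n) β → Alt (λ v → c * φ v) β ≈ c * Alt φ β
  Alt-* {zero}  c φ β = refl
  Alt-* {suc n} c φ β = trans (pickSum-cong β λ x γ → Alt-* c _ γ) (pickSum-* c _ β)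

  Alt-zero : ∀ {φ : Fun n} β → (∀ v → φ v ≈ 0#) → Alt φ β ≈ 0#
  Alt-zero {zero}  β eq = eq β
  Alt-zero {suc n} β eq = pickSum-zero β (λ x γ → Alt-zero γ λ v → eq (x ∷ v))

  Alt-+ : ∀ (φ ψ : Fun n) β → Alt (λ v → φ v + ψ v) β ≈ Alt φ β + Alt ψ β
  Alt-+ {zero}  φ ψ β = refl
  Alt-+ {suc n} φ ψ β = trans (pickSum-cong β λ x γ → Alt-+ _ _ γ) (pickSum-+ _ _ β)

  Alt-sum : ∀ {A : Set} (xs : List A) (φ : A → Fun n) β →
    Alt (λ v → sum xs (λ a → φ a v)) β ≈ sum xs (λ a → Alt (φ a) β)
  Alt-sum []       φ β = Alt-zero β (λ _ → refl)
  Alt-sum (a ∷ xs) φ β = trans (Alt-+ (φ a) _ β) (+-congˡ (Alt-sum xs φ β))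

  -- `repeats` is a separate field because in a ring where 2 may be a zero divisor, ψ v ≈ - ψ v does
  -- not give ψ v ≈ 0.
  record Alternating (ψ : Fun n) : Set where
    field
      swap    : ∀ {v w} → Swap v w → ψ v ≈ - ψ w
      repeats : ∀ {v} → Repeats v → ψ v ≈ 0#
  open Alternating public

  tail-alternating : ∀ {ψ : Fun (suc n)} x → Alternating ψ → Alternating (λ v → ψ (x ∷ v))
  tail-alternating x alt .swap s    = alt .swap (there s)
  tail-alternating x alt .repeats r = alt .repeats (there r)

  pickSum-alternating : ∀ {g : ℤ → Fun n} → (∀ x → Alternating (g x)) → Alternating (pickSum g)
  pickSum-alternating {zero} alt .swap (there ())
  pickSum-alternating {zero} alt .repeats (there ())
  pickSum-alternating {suc n} {g} alt .swap (there s) = trans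
    (+-cong (alt _ .swap s) (-‿cong (pickSum-alternating (λ x → tail-alternating _ (alt x)) .swap s)))
    (-‿+-comm _ _)
  pickSum-alternating {suc zero} {g} alt .swap {x ∷ y ∷ []} here =
    solve 2 (λ a b → a :- b := :- (b :- a)) refl (g x (y ∷ [])) (g y (x ∷ []))
  pickSum-alternating {suc (suc n)} {g} alt .swap {x ∷ y ∷ v} here = trans
    (+-congˡ (-‿cong (+-congˡ (-‿cong (trans
      (pickSum-cong v (λ z γ → alt z .swap here))
      (pickSum-neg (λ z γ → g z (y ∷ x ∷ γ)) v))))))
    (solve 3 (λ a b c → a :- (b :- (:- c)) := :- (b :- (a :- c))) refl (g x (y ∷ v)) (g y (x ∷ v)) _)
  pickSum-alternating {suc n} {g} alt .repeats (there r) = trans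
    (+-cong (alt _ .repeats r) (-‿cong (pickSum-alternating (λ x → tail-alternating _ (alt x)) .repeats r)))
    (-‿inverseʳ 0#)
  pickSum-alternating {suc zero} alt .repeats {x ∷ _ ∷ []} here = -‿inverseʳ _
  pickSum-alternating {suc (suc n)} {g} alt .repeats {x ∷ _ ∷ v} here = trans
    (+-congˡ (-‿cong (+-congˡ (-‿cong (pickSum-zero {g = λ z γ → g z (x ∷ x ∷ γ)} v (λ z γ → alt z .repeats here))))))
    (solve 1 (λ a → a :- (a :- :0) := :0) refl (g x (x ∷ v)))

  Alt-alternating : ∀ (φ : Fun n) → Alternating (Alt φ)
  Alt-alternating {zero}  φ .swap ()
  Alt-alternating {zero}  φ .repeats ()
  Alt-alternating {suc n} φ = pickSum-alternating (λ x → Alt-alternating _)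

  Shift : Set
  Shift = Carrier × ℤ × ℤ

  -- The finite sum Σ c · (translation by i in the parameter and by j in the
  -- coordinate), applied in every coordinate.
  Tens : List Shift → (ℤ → Fun n) → ℤ → Fun n
  Tens op φ b []      = φ b []
  Tens op φ b (x ∷ β) = sum op (λ (c , i , j) → c * Tens op (λ b′ v → φ b′ (x ℤ.+ j ∷ v)) (b ℤ.+ i) β)

  Tens-cong : ∀ op {φ φ′ : ℤ → Fun n} b β → (∀ b v → φ b v ≈ φ′ b v) → Tens op φ b β ≈ Tens op φ′ b β
  Tens-cong op b []      eq = eq b []
  Tens-cong op b (x ∷ β) eq = sum-cong op λ (c , i , j) → *-congˡ (Tens-cong op _ β λ b v → eq b _)

  Tens-+ : ∀ op (φ φ′ : ℤ → Fun n) b β →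
    Tens op (λ b v → φ b v + φ′ b v) b β ≈ Tens op φ b β + Tens op φ′ b β
  Tens-+ op φ φ′ b []      = refl
  Tens-+ op φ φ′ b (x ∷ β) = trans
    (sum-cong op λ (c , i , j) → trans (*-congˡ (Tens-+ op _ _ _ β)) (distribˡ _ _ _))
    (sum-+ op _ _)

  Tens-neg : ∀ op (φ : ℤ → Fun n) b β → Tens op (λ b v → - φ b v) b β ≈ - Tens op φ b β
  Tens-neg op φ b []      = refl
  Tens-neg op φ b (x ∷ β) = trans
    (sum-cong op λ (c , i , j) → trans (*-congˡ (Tens-neg op _ _ β)) (sym (-‿distribʳ-* _ _)))
    (sym (sum-neg op _))

  Tens-scale : ∀ op k (φ : ℤ → Fun n) b β → Tens op (λ b v → k * φ b v) b β ≈ k * Tens op φ b β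
  Tens-scale op k φ b []      = refl
  Tens-scale op k φ b (x ∷ β) = trans
    (sum-cong op λ (c , i , j) → trans (*-congˡ (Tens-scale op k _ _ β))
       (solve 3 (λ a b c → a :* (b :* c) := b :* (a :* c)) refl _ _ _))
    (sym (sum-* k op _))

  private
    Tens₁ : List Shift → (ℤ → ℤ → Fun n) → ℤ → ℤ → Fun n
    Tens₁ op g b x γ = sum op (λ (c , i , j) → c * Tens op (λ b′ → g b′ (x ℤ.+ j)) (b ℤ.+ i) γ)

  -- The operator treats all coordinates alike, so it does not matter whether an entry is moved to
  -- the front before or after it acts. `exchange` interchanges the two sums over `op`, which is
  -- possible since shifts of the parameter commute.
  Tens-pickSum : ∀ op (g : ℤ → ℤ → Fun n) b β →
    Tens op (λ b → pickSum (g b)) b β ≈ pickSum (Tens₁ op g b) β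
  Tens-pickSum {zero}  op g b (x ∷ []) = refl
  Tens-pickSum {suc n} op g b (x ∷ β) = begin
    Tens op (λ b → pickSum (g b)) b (x ∷ β)
      ≈⟨ sum-cong op (λ (c , i , j) → *-congˡ (trans (Tens-+ op _ _ _ β)
           (+-congˡ (trans (Tens-neg op _ _ β) (-‿cong (Tens-pickSum op (λ b′ z γ → g b′ z (x ℤ.+ j ∷ γ)) _ β)))))) ⟩
    sum op (λ (c , i , j) → c * (Tens op (λ b′ → g b′ (x ℤ.+ j)) (b ℤ.+ i) β
                                  - pickSum (Tens₁ op (λ b′ z γ → g b′ z (x ℤ.+ j ∷ γ)) (b ℤ.+ i)) β))
      ≈⟨ trans (sum-cong op (λ (c , i , j) → trans (x[y-z]≈xy-xz c _ _) (+-congˡ (-‿cong (sym (pickSum-* c _ β))))))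
           (trans (sum-+ op _ _) (+-congˡ (sym (sum-neg op _)))) ⟩
    Tens₁ op g b x β - sum op (λ (c , i , j) → pickSum (λ z γ → c * Tens₁ op (λ b′ z γ → g b′ z (x ℤ.+ j ∷ γ)) (b ℤ.+ i) z γ) β)
      ≈⟨ +-congˡ (-‿cong (trans (sym (pickSum-sum op _ β)) (pickSum-cong β exchange))) ⟩
    Tens₁ op g b x β - pickSum (λ z γ → Tens₁ op g b z (x ∷ γ)) β ∎
    where
    shift-comm : ∀ b i i′ → (b ℤ.+ i) ℤ.+ i′ ≡ (b ℤ.+ i′) ℤ.+ i
    shift-comm = solve-∀
    exchange : ∀ z γ →
      sum op (λ (c , i , j) → c * Tens₁ op (λ b′ z γ → g b′ z (x ℤ.+ j ∷ γ)) (b ℤ.+ i) z γ) ≈ Tens₁ op g b z (x ∷ γ)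
    exchange z γ = trans
      (sum-cong op λ (c , i , j) → sum-* c op _)
      (trans (sum-swap op op _)
      (sum-cong op λ (c′ , i′ , j′) → trans
        (sum-cong op λ (c , i , j) → trans
          (solve 3 (λ a b c → a :* (b :* c) := b :* (a :* c)) refl _ _ _)
          (*-congˡ (*-congˡ (reflexive (≡.cong (λ b → Tens op (λ b′ v → g b′ (z ℤ.+ j′) (x ℤ.+ j ∷ v)) b γ) (shift-comm b i i′))))))
        (sym (sum-* c′ op _))))

  -- Operators symmetric in the coordinates commute with antisymmetrisation. This lets an induction
  -- hypothesis about `Alt` be used underneath an operator, and lets an operator on a determinant
  -- act on the product of its columns.
  Alt-Tens : ∀ op (φ : ℤ → Fun n) b β → Alt (Tens op φ b) β ≈ Tens op (λ b → Alt (φ b)) b β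
  Alt-Tens {zero}  op φ b [] = refl
  Alt-Tens {suc n} op φ b β  = trans
    (pickSum-cong β (λ x γ → trans (Alt-sum op _ γ)
      (sum-cong op λ (c , i , j) → trans (Alt-* c _ γ) (*-congˡ (Alt-Tens op _ _ γ)))))
    (sym (Tens-pickSum op (λ b x → Alt (λ v → φ b (x ∷ v))) b β))

  Column : Set
  Column = ℤ → Carrier

  prod : Vec Column n → Fun n
  prod []       []      = 1#
  prod (c ∷ cs) (x ∷ β) = c x * prod cs β

  -- The determinant of (cⱼ(βᵢ)). Columns are functions of the row label, so that a coordinatewise
  -- operator on β becomes an operation on each column (`Tens-det`).
  det : Vec Column n → Fun n
  det cs = Alt (prod cs)

  det-∷ : ∀ c (cs : Vec Column n) β → det (c ∷ cs) β ≈ pickSum (λ x γ → c x * det cs γ) β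
  det-∷ c cs β = pickSum-cong β (λ x γ → Alt-* (c x) (prod cs) γ)

  det-cong₁ : ∀ {c c′} (cs : Vec Column n) β → (∀ x → c x ≈ c′ x) → det (c ∷ cs) β ≈ det (c′ ∷ cs) β
  det-cong₁ cs β eq = pickSum-cong β λ x γ → Alt-cong γ λ v → *-congʳ (eq x)

  det-congₛ : ∀ c {cs cs′ : Vec Column n} β → (∀ γ → det cs γ ≈ det cs′ γ) → det (c ∷ cs) β ≈ det (c ∷ cs′) β
  det-congₛ c {cs} {cs′} β eq = trans (det-∷ c cs β)
    (trans (pickSum-cong β λ x γ → *-congˡ (eq γ)) (sym (det-∷ c cs′ β)))

  det-linear₁ : ∀ k c d (cs : Vec Column n) β →
    det ((λ x → c x + k * d x) ∷ cs) β ≈ det (c ∷ cs) β + k * det (d ∷ cs) β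
  det-linear₁ k c d cs β = begin
    det ((λ x → c x + k * d x) ∷ cs) β
      ≈⟨ det-∷ (λ x → c x + k * d x) cs β ⟩
    pickSum (λ x γ → (c x + k * d x) * det cs γ) β
      ≈⟨ pickSum-cong β (λ x γ → solve 4 (λ c k d e → (c :+ k :* d) :* e := c :* e :+ k :* (d :* e)) refl _ _ _ _) ⟩
    pickSum (λ x γ → c x * det cs γ + k * (d x * det cs γ)) β
      ≈⟨ trans (pickSum-+ _ _ β) (+-congˡ (pickSum-* k _ β)) ⟩
    pickSum (λ x γ → c x * det cs γ) β + k * pickSum (λ x γ → d x * det cs γ) β
      ≈⟨ +-cong (det-∷ c cs β) (*-congˡ (det-∷ d cs β)) ⟨
    det (c ∷ cs) β + k * det (d ∷ cs) β ∎

  -- Picking x before y and y before x come with opposite signs. The recursion cancels all pairs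
  -- containing the first entry at once, without dividing by 2.
  pickSum²-symmetric : ∀ (h : ℤ → ℤ → Fun n) β → (∀ x y γ → h x y γ ≈ h y x γ) →
    pickSum (λ x → pickSum (h x)) β ≈ 0#
  pickSum²-symmetric {zero}  h (x ∷ y ∷ []) sm = trans (+-congˡ (-‿cong (sm y x []))) (-‿inverseʳ _)
  pickSum²-symmetric {suc n} h (x ∷ β) sm = begin
    pickSum (h x) β - pickSum (λ z γ → h z x γ - pickSum (λ u δ → h z u (x ∷ δ)) γ) β
      ≈⟨ +-congˡ (-‿cong (trans (pickSum-+ (λ z γ → h z x γ) (λ z γ → - pickSum (λ u δ → h z u (x ∷ δ)) γ) β)
           (+-cong (pickSum-cong β (λ z γ → sm z x γ))
             (trans (pickSum-neg (λ z γ → pickSum (λ u δ → h z u (x ∷ δ)) γ) β) (-‿cong (pickSum²-symmetric (λ z u δ → h z u (x ∷ δ)) β (λ z u δ → sm z u _))))))) ⟩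
    pickSum (h x) β - (pickSum (h x) β - 0#)
      ≈⟨ solve 1 (λ a → a :- (a :- :0) := :0) refl _ ⟩
    0# ∎

  det-repeat : ∀ c (cs : Vec Column n) β → det (c ∷ c ∷ cs) β ≈ 0#
  det-repeat c cs β = trans (det-∷ c (c ∷ cs) β)
    (trans (pickSum-cong β (λ x γ → trans (*-congˡ (det-∷ c cs γ)) (sym (pickSum-* (c x) _ γ))))
    (pickSum²-symmetric (λ x y γ → c x * (c y * det cs γ)) β
      (λ x y γ → solve 3 (λ a b d → a :* (b :* d) := b :* (a :* d)) refl _ _ _)))

  det-colˡ : ∀ k c d (cs : Vec Column n) β → det ((λ x → c x + k * d x) ∷ d ∷ cs) β ≈ det (c ∷ d ∷ cs) β
  det-colˡ k c d cs β = trans (det-linear₁ k c d (d ∷ cs) β)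
    (trans (+-congˡ (trans (*-congˡ (det-repeat d cs β)) (zeroʳ k))) (+-identityʳ _))

  det-linear₂ : ∀ k e c d (cs : Vec Column n) β →
    det (e ∷ (λ x → c x + k * d x) ∷ cs) β ≈ det (e ∷ c ∷ cs) β + k * det (e ∷ d ∷ cs) β
  det-linear₂ k e c d cs β = begin
    det (e ∷ (λ x → c x + k * d x) ∷ cs) β
      ≈⟨ trans (det-∷ e ((λ x → c x + k * d x) ∷ cs) β) (pickSum-cong β (λ x γ → trans (*-congˡ (det-linear₁ k c d cs γ))
           (solve 4 (λ e k c d → e :* (c :+ k :* d) := e :* c :+ k :* (e :* d)) refl _ _ _ _))) ⟩
    pickSum (λ x γ → e x * det (c ∷ cs) γ + k * (e x * det (d ∷ cs) γ)) β
      ≈⟨ trans (pickSum-+ _ _ β) (+-congˡ (pickSum-* k _ β)) ⟩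
    pickSum (λ x γ → e x * det (c ∷ cs) γ) β + k * pickSum (λ x γ → e x * det (d ∷ cs) γ) β
      ≈⟨ +-cong (det-∷ e (c ∷ cs) β) (*-congˡ (det-∷ e (d ∷ cs) β)) ⟨
    det (e ∷ c ∷ cs) β + k * det (e ∷ d ∷ cs) β ∎

  det-colʳ : ∀ k c d (cs : Vec Column n) β → det (d ∷ (λ x → c x + k * d x) ∷ cs) β ≈ det (d ∷ c ∷ cs) β
  det-colʳ k c d cs β = trans (det-linear₂ k d c d cs β)
    (trans (+-congˡ (trans (*-congˡ (det-repeat d cs β)) (zeroʳ k))) (+-identityʳ _))

  det-swap : ∀ c d (cs : Vec Column n) β → det (c ∷ d ∷ cs) β ≈ - det (d ∷ c ∷ cs) β
  det-swap c d cs β = begin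
    det (c ∷ d ∷ cs) β                       ≈⟨ det-colʳ 1# d c cs β ⟨
    -- Adding and subtracting the determinant with columns d and d + c completes the first term to
    -- one with the equal columns c + d and d + c.
    det (c ∷ d+c ∷ cs) β                     ≈⟨ solve 2 (λ a b → a := (a :+ :1 :* b) :- b) refl _ _ ⟩
    (det (c ∷ d+c ∷ cs) β + 1# * det (d ∷ d+c ∷ cs) β) - det (d ∷ d+c ∷ cs) β
                                             ≈⟨ +-cong (sym (det-linear₁ 1# c d (d+c ∷ cs) β)) (-‿cong flip) ⟩
    det ((λ x → c x + 1# * d x) ∷ d+c ∷ cs) β - det (d ∷ c ∷ cs) β
                                             ≈⟨ +-congʳ (trans (det-cong₁ {c = λ x → c x + 1# * d x} {c′ = d+c} (d+c ∷ cs) β (λ x → solve 2 (λ a b → a :+ :1 :* b := b :+ :1 :* a) refl (c x) (d x))) (det-repeat d+c cs β)) ⟩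
    0# - det (d ∷ c ∷ cs) β                  ≈⟨ +-identityˡ _ ⟩
    - det (d ∷ c ∷ cs) β                     ∎
    where
    d+c : Column
    d+c x = d x + 1# * c x
    flip : det (d ∷ d+c ∷ cs) β ≈ det (d ∷ c ∷ cs) β
    flip = trans (det-congₛ d {cs = d+c ∷ cs} {cs′ = (λ x → c x + 1# * d x) ∷ cs} β (λ γ → det-cong₁ {c = d+c} {c′ = λ x → c x + 1# * d x} cs γ (λ x → solve 2 (λ a b → a :+ :1 :* b := b :+ :1 :* a) refl (d x) (c x))))
      (det-colʳ 1# c d cs β)

  det-member : ∀ c (cs : Vec Column n) β → Any (λ d → ∀ x → c x ≈ d x) cs → det (c ∷ cs) β ≈ 0#
  det-member c (d ∷ cs) β (here eq)   = trans (det-cong₁ (d ∷ cs) β eq) (det-repeat d cs β)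
  det-member c (d ∷ cs) β (there mem) = trans (det-swap c d cs β) (trans
    (-‿cong (trans (det-∷ d (c ∷ cs) β) (pickSum-zero β (λ x γ → trans (*-congˡ (det-member c cs γ mem)) (zeroʳ _)))))
    -0#≈0#)

  pickSum-zero-∈ : ∀ {g : ℤ → Fun n} {x} β → (∀ z γ → z ≡ x ⊎ Any (_≡ x) γ → g z γ ≈ 0#) → Any (_≡ x) β →
    pickSum g β ≈ 0#
  pickSum-zero-∈ {zero}  (z ∷ []) eq (here e) = eq z [] (inj₁ e)
  pickSum-zero-∈ {suc n} (z ∷ β) eq (here e) = trans
    (+-cong (eq z β (inj₁ e)) (-‿cong (pickSum-zero β (λ u γ → eq u (z ∷ γ) (inj₂ (here e))))))
    (-‿inverseʳ 0#)
  pickSum-zero-∈ {suc n} {x = x} (z ∷ β) eq (there m) = trans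
    (+-cong (eq z β (inj₂ m)) (-‿cong (pickSum-zero-∈ β (λ { u γ (inj₁ e) → eq u (z ∷ γ) (inj₁ e)
                                                           ; u γ (inj₂ m′) → eq u (z ∷ γ) (inj₂ (there m′)) }) m)))
    (-‿inverseʳ 0#)

  det-zero-row : ∀ {x} (cs : Vec Column n) β → Any (_≡ x) β → All (λ c → c x ≈ 0#) cs → det cs β ≈ 0#
  det-zero-row {suc n} (c ∷ cs) β m (z ∷ zs) = trans (det-∷ c cs β) (pickSum-zero-∈ β
    (λ { y γ (inj₁ ≡.refl) → trans (*-congʳ z) (zeroˡ _)
       ; y γ (inj₂ m′) → trans (*-congˡ (det-zero-row cs γ m′ zs)) (zeroʳ _) }) m)

  apply : List Shift → Column → Column
  apply op c x = sum op (λ (k , i , j) → k * c (x ℤ.+ j))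

  Tens-prod : ∀ op (cs : Vec Column n) b β → Tens op (λ _ → prod cs) b β ≈ prod (Vec.map (apply op) cs) β
  Tens-prod op []       b []      = refl
  Tens-prod op (c ∷ cs) b (x ∷ β) = trans
    (sum-cong op λ (k , i , j) → trans (*-congˡ (trans (Tens-scale op _ _ _ β) (*-congˡ (Tens-prod op cs _ β))))
       (solve 3 (λ a b c → a :* (b :* c) := c :* (a :* b)) refl _ _ _))
    (trans (sym (sum-* _ op _)) (*-comm _ _))

  Tens-det : ∀ op (cs : Vec Column n) b β → Tens op (λ _ → det cs) b β ≈ det (Vec.map (apply op) cs) β
  Tens-det op cs b β = trans (sym (Alt-Tens op (λ _ → prod cs) b β)) (Alt-cong β (Tens-prod op cs b))

-- Sorting integer vectors by adjacent swaps

Decreasing : Vec ℤ n → Set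
Decreasing = AllPairs ℤ._>_

Swap-All : ∀ {P : ℤ → Set} {v w : Vec ℤ n} → Swap v w → All P v → All P w
Swap-All here      (p ∷ q ∷ ps) = q ∷ p ∷ ps
Swap-All (there s) (p ∷ ps)     = p ∷ Swap-All s ps

Swap-∣∣ : {v w : Vec ℤ n} → Swap v w → ∣ v ∣ ≡ ∣ w ∣
Swap-∣∣ (here {x = x} {y} {v}) = exch x y ∣ v ∣
  where
  exch : ∀ x y s → x ℤ.+ (y ℤ.+ s) ≡ y ℤ.+ (x ℤ.+ s)
  exch = solve-∀
Swap-∣∣ (there {z = z} s) = ≡.cong (ℤ._+_ z) (Swap-∣∣ s)

private
  Swaps-All : ∀ {P : ℤ → Set} {v w : Vec ℤ n} → Star Swap v w → All P v → All P w
  Swaps-All Star.ε        ps = ps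
  Swaps-All (s ◅ ss) ps = Swaps-All ss (Swap-All s ps)

  data Sorted (v : Vec ℤ n) : Set where
    repeating  : ∀ {w} → Star Swap v w → Repeats w → Sorted v
    decreasing : ∀ {w} → Star Swap v w → Decreasing w → Sorted v

  insert : ∀ x {w : Vec ℤ n} → Decreasing w → Sorted (x ∷ w)
  insert x []                = decreasing Star.ε ([] ∷ [])
  insert x {y ∷ w} (p ∷ ps) with ℤ.<-cmp y x
  ... | tri< y<x _ _ = decreasing Star.ε ((y<x ∷ All.map (λ z<y → ℤ.<-trans z<y y<x) p) ∷ p ∷ ps)
  ... | tri≈ _ ≡.refl _ = repeating Star.ε here
  ... | tri> _ _ x<y with insert x ps
  ...   | repeating ss r  = repeating (here ◅ Star.gmap (y ∷_) there ss) (there r)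
  ...   | decreasing ss d = decreasing (here ◅ Star.gmap (y ∷_) there ss) (Swaps-All ss (x<y ∷ p) ∷ d)

  sort : (v : Vec ℤ n) → Sorted v
  sort []      = decreasing Star.ε []
  sort (x ∷ v) with sort v
  ... | repeating ss r = repeating (Star.gmap (x ∷_) there ss) (there r)
  ... | decreasing ss d with insert x d
  ...   | repeating ss′ r  = repeating (Star.gmap (x ∷_) there ss ◅◅ ss′) r
  ...   | decreasing ss′ d′ = decreasing (Star.gmap (x ∷_) there ss ◅◅ ss′) d′

-- For identities between alternating functions: a swap negates both sides and a repetition kills
-- both, so strictly decreasing vectors are all that remains.
sort-induction : (P : Vec ℤ n → Set) → (∀ {v w} → Swap v w → P w → P v) →
  (∀ {v} → Repeats v → P v) → (∀ {v} → Decreasing v → P v) → ∀ v → P v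
sort-induction P swapP repeatP decP v with sort v
... | repeating ss r  = Star.fold (λ v w → P w → P v) (λ s k p → swapP s (k p)) (λ p → p) ss (repeatP r)
... | decreasing ss d = Star.fold (λ v w → P w → P v) (λ s k p → swapP s (k p)) (λ p → p) ss (decP d)

-- n(n+1)/2, the total of `ρ n`.
triangle : ℕ → ℤ
triangle zero    = 0ℤ
triangle (suc n) = + suc n ℤ.+ triangle n

private
  head-bound : ∀ s {x} {v : Vec ℤ n} → Decreasing (x ∷ v) → All (s ℤ.<_) (x ∷ v) → + suc n ℤ.+ s ℤ.≤ x
  head-bound s {v = []}    _                  (s<x ∷ _)  = ℤ.i<j⇒suc[i]≤j s<x
  head-bound {suc n} s {x} {y ∷ v} ((y<x ∷ _) ∷ d) (_ ∷ ps) = ℤ.≤-trans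
    (ℤ.≤-reflexive (eq (+ suc n) s))
    (ℤ.i<j⇒suc[i]≤j (ℤ.≤-<-trans (head-bound s d ps) y<x))
    where
    eq : ∀ n s → 1ℤ ℤ.+ n ℤ.+ s ≡ 1ℤ ℤ.+ (n ℤ.+ s)
    eq = solve-∀

-- Entrywise such a vector is at least (s + n, ..., s + 1). With s = 0 this compares β with ρ; with
-- s = 1 it says that a β without the entry 1 already exceeds the total of ρ by n.
decreasing-bound : ∀ s {v : Vec ℤ n} → Decreasing v → All (s ℤ.<_) v → + n ℤ.* s ℤ.+ triangle n ℤ.≤ ∣ v ∣
decreasing-bound s []               []           = ℤ.≤-reflexive ≡.refl
decreasing-bound {suc n} s {x ∷ v} d@(_ ∷ d′) ps@(_ ∷ ps′) = ℤ.≤-trans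
  (ℤ.≤-reflexive (eq (+ n) s (triangle n)))
  (ℤ.+-mono-≤ (head-bound s d ps) (decreasing-bound s d′ ps′))
  where
  eq : ∀ n s t → (1ℤ ℤ.+ n) ℤ.* s ℤ.+ ((1ℤ ℤ.+ n) ℤ.+ t) ≡ ((1ℤ ℤ.+ n) ℤ.+ s) ℤ.+ (n ℤ.* s ℤ.+ t)
  eq = solve-∀

positive⇒0≤∣∣ : {β : Vec ℤ n} → Positive β → 0ℤ ℤ.≤ ∣ β ∣
positive⇒0≤∣∣ []       = ℤ.≤-refl
positive⇒0≤∣∣ (p ∷ ps) = ℤ.+-mono-≤ (ℤ.<⇒≤ p) (positive⇒0≤∣∣ ps)

one-or-greater : {v : Vec ℤ n} → Positive v → Any (_≡ 1ℤ) v ⊎ All (1ℤ ℤ.<_) v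
one-or-greater []       = inj₂ []
one-or-greater {v = x ∷ v} (p ∷ ps) with ℤ.<-cmp 1ℤ x | one-or-greater ps
... | tri≈ _ ≡.refl _ | _       = inj₁ (here ≡.refl)
... | tri> _ _ x<1 | _ with () ← ℤ.<-irrefl ≡.refl (ℤ.≤-<-trans (ℤ.i<j⇒suc[i]≤j p) x<1)
... | tri< 1<x _ _ | inj₁ m = inj₁ (there m)
... | tri< 1<x _ _ | inj₂ a = inj₂ (1<x ∷ a)

-- Summing a determinant over all ways of raising its rows

module Columns (R : CommutativeRing 0ℓ 0ℓ) where
  open Ring R
  open Alt R

  -- At β = λ + ρ the entry in row i and column j is c(λᵢ - i + j), so `cols` of eₖ gives the
  -- determinant D(λ).
  cols : Column → ∀ n → Vec Column n
  cols c zero    = []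
  cols c (suc n) = (λ x → c (x ℤ.- + suc n)) ∷ cols c n

  mixed : Column → Column → ∀ n → Vec Column (suc n)
  mixed c d zero    = (λ x → d (x ℤ.- 1ℤ)) ∷ []
  mixed c d (suc n) = (λ x → c (x ℤ.- + suc (suc n))) ∷ mixed c d n

  det-mixed-cong : ∀ c {d d′} n β → (∀ x → d x ≈ d′ x) → det (mixed c d n) β ≈ det (mixed c d′ n) β
  det-mixed-cong c {d} {d′} n β eq = Alt-cong β (go n)
    where
    go : ∀ n v → prod (mixed c d n) v ≈ prod (mixed c d′ n) v
    go zero    (x ∷ []) = *-congʳ (eq _)
    go (suc n) (x ∷ v)  = *-congˡ (go n v)

  det-mixed-same : ∀ c n β → det (mixed c c n) β ≈ det (cols c (suc n)) β
  det-mixed-same c n β = Alt-cong β (go n)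
    where
    go : ∀ n v → prod (mixed c c n) v ≈ prod (cols c (suc n)) v
    go zero    (x ∷ []) = refl
    go (suc n) (x ∷ v)  = *-congˡ (go n v)

  det-mixed-+ : ∀ c d d′ n β →
    det (mixed c (λ x → d x + d′ x) n) β ≈ det (mixed c d n) β + det (mixed c d′ n) β
  det-mixed-+ c d d′ n β = trans (Alt-cong β (go n)) (Alt-+ (prod (mixed c d n)) (prod (mixed c d′ n)) β)
    where
    go : ∀ n v → prod (mixed c (λ x → d x + d′ x) n) v ≈ prod (mixed c d n) v + prod (mixed c d′ n) v
    go zero    (x ∷ []) = distribʳ _ _ _
    go (suc n) (x ∷ v)  = trans (*-congˡ (go n v)) (distribˡ _ _ _)

  det-mixed-* : ∀ c k d n β → det (mixed c (λ x → k * d x) n) β ≈ k * det (mixed c d n) β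
  det-mixed-* c k d n β = trans (Alt-cong β (go n)) (Alt-* k (prod (mixed c d n)) β)
    where
    go : ∀ n v → prod (mixed c (λ x → k * d x) n) v ≈ k * prod (mixed c d n) v
    go zero    (x ∷ []) = *-assoc _ _ _
    go (suc n) (x ∷ v)  = trans (*-congˡ (go n v)) (solve 3 (λ a b c → a :* (b :* c) := b :* (a :* c)) refl _ _ _)

  mixed-zero : ∀ c d n {x} → (∀ k → c (x ℤ.- + suc (suc k)) ≈ 0#) → d (x ℤ.- 1ℤ) ≈ 0# →
    All (λ f → f x ≈ 0#) (mixed c d n)
  mixed-zero c d zero    cz dz = dz ∷ []
  mixed-zero c d (suc n) cz dz = cz n ∷ mixed-zero c d n cz dz

module Raising (R : CommutativeRing 0ℓ 0ℓ) (L : ℕ) where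
  open Ring R
  open Alt R
  open Columns R
  open Truncated R L
  private
    module S = Ring seriesRing
    module SA = Alt seriesRing
    module SC = Columns seriesRing

  ι-pickSum : ∀ {G : ℤ → SA.Fun n} {g : ℤ → Fun n} β → (∀ x γ → G x γ ≋ ι (g x γ)) →
    SA.pickSum G β ≋ ι (pickSum g β)
  ι-pickSum {zero}  (x ∷ []) eq = eq x []
  ι-pickSum {suc n} (x ∷ β)  eq = S.trans (S.+-cong (eq x β) (S.-‿cong (ι-pickSum β (λ z γ → eq z (x ∷ γ)))))
    (S.sym (S.trans (ι-+ _ _) (S.+-congˡ (ι-- _))))

  ι-Alt : ∀ {Φ : SA.Fun n} {φ : Fun n} β → (∀ v → Φ v ≋ ι (φ v)) → SA.Alt Φ β ≋ ι (Alt φ β)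
  ι-Alt {zero}  β eq = eq β
  ι-Alt {suc n} β eq = ι-pickSum β (λ x γ → ι-Alt γ (λ v → eq (x ∷ v)))

  ι-det-cols : ∀ c n β → SA.det (SC.cols (ι ∘ c) n) β ≋ ι (det (cols c n) β)
  ι-det-cols c n β = ι-Alt β (go n)
    where
    go : ∀ n v → SA.prod (SC.cols (ι ∘ c) n) v ≋ ι (prod (cols c n) v)
    go zero    []      = S.refl
    go (suc n) (x ∷ v) = S.trans (S.*-congˡ (go n v)) (S.sym (ι-* _ _))

  -- The linear functional w^k ↦ θ k. It carries identities of series in w, obtained by column
  -- operations, over to arbitrary weights θ.
  Λ : (ℕ → Carrier) → Series → Carrier
  Λ θ a = sum (upTo L) (λ k → θ k * a k)

  Λ-cong : ∀ θ {a b} → a ≋ b → Λ θ a ≈ Λ θ b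
  Λ-cong θ eq = sum-upTo-cong L (λ k k<L → *-congˡ (at eq k k<L))

  Λ-neg : ∀ θ a → Λ θ (S.- a) ≈ - Λ θ a
  Λ-neg θ a = trans (sum-cong (upTo L) (λ k → sym (-‿distribʳ-* _ _))) (sym (sum-neg (upTo L) _))

  Λ-+ : ∀ θ a b → Λ θ (a ⊞ b) ≈ Λ θ a + Λ θ b
  Λ-+ θ a b = trans (sum-cong (upTo L) (λ k → distribˡ _ _ _)) (sum-+ (upTo L) _ _)

  Λ-zero : ∀ θ {a} → a ≋ S.0# → Λ θ a ≈ 0#
  Λ-zero θ eq = trans (Λ-cong θ eq) (sum-zero (upTo L) (λ k → zeroʳ _))

  Λ-sum : ∀ {A : Set} θ (xs : List A) h → Λ θ (S.sum xs h) ≈ sum xs (λ x → Λ θ (h x))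
  Λ-sum θ []       h = Λ-zero θ S.refl
  Λ-sum θ (x ∷ xs) h = trans (Λ-+ θ _ _) (+-congˡ (Λ-sum θ xs h))

  Vanishes : (ℕ → Carrier) → Set
  Vanishes θ = ∀ k → L ℕ.≤ k → θ k ≈ 0#

  Λ-ι : ∀ {θ} → Vanishes θ → ∀ r → Λ θ (ι r) ≈ θ 0 * r
  Λ-ι {θ} van r = go L (van 0)
    where
    go : ∀ m → (m ℕ.≤ 0 → θ 0 ≈ 0#) → sum (upTo m) (λ k → θ k * ι r k) ≈ θ 0 * r
    go zero    z = sym (trans (*-congʳ (z z≤n)) (zeroˡ r))
    go (suc m) z = trans (sum-upTo-suc m _) (trans (+-congˡ (sum-zero (upTo m) (λ k → zeroʳ _))) (+-identityʳ _))

  -- Multiplication by w^i is adjoint to translating the weights. The truncation at w^L does no harm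
  -- because θ vanishes from L on.
  Λ-var^ : ∀ i {θ} → Vanishes θ → ∀ a → Λ θ (var S.^ i ⊛ a) ≈ Λ (λ k → θ (i ℕ.+ k)) a
  Λ-var^ zero    {θ} van a = Λ-cong θ (S.*-identityˡ a)
  Λ-var^ (suc i) {θ} van a = trans (Λ-cong θ (S.*-assoc var (var S.^ i) a))
    (trans (go L (van L ℕ.≤-refl)) (Λ-var^ i (λ k L≤k → van (suc k) (ℕ.m≤n⇒m≤1+n L≤k)) a))
    where
    b = var S.^ i ⊛ a
    go : ∀ m → θ m ≈ 0# → sum (upTo m) (λ k → θ k * (var ⊛ b) k) ≈ sum (upTo m) (λ k → θ (suc k) * b k)
    go zero    z = refl
    go (suc m) z = begin
      sum (upTo (suc m)) (λ k → θ k * (var ⊛ b) k)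
        ≈⟨ sum-upTo-suc m _ ⟩
      θ 0 * (var ⊛ b) 0 + sum (upTo m) (λ k → θ (suc k) * (var ⊛ b) (suc k))
        ≈⟨ +-cong (trans (*-congˡ (var-⊛-zero b)) (zeroʳ _)) (sum-cong (upTo m) (λ k → *-congˡ (var-⊛-suc b k))) ⟩
      0# + sum (upTo m) (λ k → θ (suc k) * b k)
        ≈⟨ trans (+-comm _ _) (+-congˡ (sym (trans (*-congʳ z) (zeroˡ _)))) ⟩
      sum (upTo m) (λ k → θ (suc k) * b k) + θ (suc m) * b m
        ≈⟨ sum-upTo-last m _ ⟨
      sum (upTo (suc m)) (λ k → θ (suc k) * b k) ∎

  -- The series of (1 - y s)⁻¹ cut off at L, where s raises the coordinate by 1 and lowers the
  -- parameter by δ. For u it expands (1 - q x₁/xⱼ)⁻¹ with δ = 1 and (1 - q/(x₁xⱼ))⁻¹ with δ = -1,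
  -- the parameter being the exponent of x₁ still to be produced. For X the parameter is the number
  -- of letters.
  raise : Carrier → ℤ → List Shift
  raise y δ = List.map (λ i → (y ^ i , ℤ.- (δ ℤ.* + i) , + i)) (upTo L)

  private
    raiseS : List SA.Shift
    raiseS = List.map (λ i → (var S.^ i , 0ℤ , + i)) (upTo L)

    weight : Carrier → ℤ → (ℤ → ℤ → Carrier) → ℤ → ℤ → ℕ → Carrier
    weight y δ χ b d k = y ^ k * χ (b ℤ.- δ ℤ.* + k) (d ℤ.+ + k)

    -- The weight sees only how far the vector has been raised in total. The sum over all raisings
    -- is thus one functional of a single series, in which w marks the total raise.
    Tens-Λ : ∀ y δ (φ : Fun n) χ b b₀ β → (∀ k → L ℕ.≤ k → χ (b ℤ.- δ ℤ.* + k) (∣ β ∣ ℤ.+ + k) ≈ 0#) →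
      Tens (raise y δ) (λ b v → φ v * χ b ∣ v ∣) b β ≈ Λ (weight y δ χ b ∣ β ∣) (SA.Tens raiseS (λ _ v → ι (φ v)) b₀ β)
    Tens-Λ y δ φ χ b b₀ [] van = sym (trans
      (Λ-ι (λ k L≤k → trans (*-congˡ (van k L≤k)) (zeroʳ _)) (φ []))
      (trans (*-comm _ _) (*-congˡ (trans (*-identityˡ _) (reflexive (≡.cong₂ χ (eq b δ) ≡.refl))))))
      where
      eq : ∀ b δ → b ℤ.- δ ℤ.* 0ℤ ≡ b
      eq = solve-∀
    Tens-Λ y δ φ χ b b₀ (x ∷ β) van = begin
      Tens (raise y δ) (λ b v → φ v * χ b ∣ v ∣) b (x ∷ β)
        ≈⟨ sum-map _ (upTo L) _ ⟩
      sum (upTo L) (λ i → y ^ i * Tens (raise y δ) (λ b v → φ (x ℤ.+ + i ∷ v) * χ b ((x ℤ.+ + i) ℤ.+ ∣ v ∣)) (b ℤ.- δ ℤ.* + i) β)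
        ≈⟨ sum-cong (upTo L) (λ i → trans
             (*-congˡ (Tens-Λ y δ (λ v → φ (x ℤ.+ + i ∷ v)) (λ b d → χ b ((x ℤ.+ + i) ℤ.+ d)) _ (b₀ ℤ.+ 0ℤ) β
                (λ k L≤k → trans (reflexive (≡.cong₂ χ (eq₁ b δ (+ i) (+ k)) (eq₂ x (+ i) ∣ β ∣ (+ k)))) (van (i ℕ.+ k) (ℕ.m≤n⇒m≤o+n i L≤k)))))
             (trans (sum-* _ (upTo L) _) (sum-cong (upTo L) (λ k → trans (sym (*-assoc _ _ _)) (*-congʳ
               (trans (sym (*-assoc _ _ _)) (*-cong (sym (^-homo-* y i k)) (reflexive (≡.cong₂ χ (eq₁ b δ (+ i) (+ k)) (eq₂ x (+ i) ∣ β ∣ (+ k)))))))))) ) ⟩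
      sum (upTo L) (λ i → Λ (λ k → θ (i ℕ.+ k)) (T i))
        ≈⟨ sum-cong (upTo L) (λ i → sym (Λ-var^ i (λ k L≤k → trans (*-congˡ (van k L≤k)) (zeroʳ _)) (T i))) ⟩
      sum (upTo L) (λ i → Λ θ (var S.^ i ⊛ T i))
        ≈⟨ Λ-sum θ (upTo L) _ ⟨
      Λ θ (S.sum (upTo L) (λ i → var S.^ i ⊛ T i))
        ≈⟨ Λ-cong θ (S.sum-map _ (upTo L) _) ⟨
      Λ θ (SA.Tens raiseS (λ _ v → ι (φ v)) b₀ (x ∷ β)) ∎
      where
      θ = weight y δ χ b ∣ x ∷ β ∣
      T : ℕ → Series
      T i = SA.Tens raiseS (λ _ v → ι (φ (x ℤ.+ + i ∷ v))) (b₀ ℤ.+ 0ℤ) β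
      eq₁ : ∀ b δ i k → (b ℤ.- δ ℤ.* i) ℤ.- δ ℤ.* k ≡ b ℤ.- δ ℤ.* (i ℤ.+ k)
      eq₁ = solve-∀
      eq₂ : ∀ x i s k → (x ℤ.+ i) ℤ.+ (s ℤ.+ k) ≡ (x ℤ.+ s) ℤ.+ (i ℤ.+ k)
      eq₂ = solve-∀

  expand : ∀ m (a : ℕ → Carrier) k → k ℕ.< m → m ℕ.≤ L → S.sum (upTo m) (λ i → var S.^ i ⊛ ι (a i)) k ≈ a k
  expand (suc m) a k k<m m<L = trans (at (S.trans (S.sum-upTo-suc m _)
    (S.+-cong (S.*-identityˡ _) (S.trans (S.sum-cong (upTo m) (λ i → S.*-assoc var (var S.^ i) _))
      (S.sym (S.sum-* var (upTo m) (λ i → var S.^ i ⊛ ι (a (suc i)))))))) k (ℕ.<-≤-trans k<m m<L))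
    (coefficient k k<m)
    where
    s = S.sum (upTo m) (λ i → var S.^ i ⊛ ι (a (suc i)))
    coefficient : ∀ k → k ℕ.< suc m → (ι (a 0) ⊞ var ⊛ s) k ≈ a k
    coefficient zero    _         = trans (+-congˡ (var-⊛-zero s)) (+-identityʳ _)
    coefficient (suc k) (s≤s k<m) = trans (+-identityˡ _)
      (trans (var-⊛-suc s k) (expand m (a ∘ suc) k k<m (ℕ.<⇒≤ m<L)))

  module _ (e : ℤ → Carrier) (e-neg : ∀ k → e -[1+ k ] ≈ 0#) (e-0 : e 0ℤ ≈ 1#) where
    private
      -- The column e summed over all raisings of its row, as `apply-raise` shows.
      ê : ℤ → Series
      ê x k = e (x ℤ.+ + k)

      ê-step : ∀ x → ê x ≋ ι (e x) ⊞ var ⊛ ê (x ℤ.+ 1ℤ)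
      ê-step x = mk≋ λ
        { zero    _ → sym (trans (+-congˡ (var-⊛-zero (ê (x ℤ.+ 1ℤ)))) (trans (+-identityʳ _) (reflexive (≡.cong e (≡.sym (ℤ.+-identityʳ x))))))
        ; (suc k) _ → sym (trans (+-identityˡ _) (trans (var-⊛-suc (ê (x ℤ.+ 1ℤ)) k) (reflexive (≡.cong e (eq x (+ k)))))) }
        where
        eq : ∀ x k → (x ℤ.+ 1ℤ) ℤ.+ k ≡ x ℤ.+ (1ℤ ℤ.+ k)
        eq = solve-∀

      apply-raise : ∀ o x → SA.apply raiseS (λ x → ι (e (x ℤ.- o))) x ≋ ê (x ℤ.- o)
      apply-raise o x = S.trans (S.sum-map _ (upTo L) _)
        (mk≋ λ k k<L → trans (expand L (λ i → e ((x ℤ.+ + i) ℤ.- o)) k k<L ℕ.≤-refl) (reflexive (≡.cong e (eq x (+ k) o))))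
        where
        eq : ∀ x k o → (x ℤ.+ k) ℤ.- o ≡ (x ℤ.- o) ℤ.+ k
        eq = solve-∀

      det-ê : ∀ n b₀ β → SA.Tens raiseS (λ _ v → ι (det (cols e n) v)) b₀ β ≋ SA.det (SC.cols ê n) β
      det-ê n b₀ β = S.trans (SA.Tens-cong raiseS b₀ β (λ _ v → S.sym (ι-det-cols e n v)))
        (S.trans (SA.Tens-det raiseS (SC.cols (ι ∘ e) n) b₀ β) (SA.Alt-cong β (go n)))
        where
        go : ∀ n v → SA.prod (Vec.map (SA.apply raiseS) (SC.cols (ι ∘ e) n)) v ≋ SA.prod (SC.cols ê n) v
        go zero    []      = S.refl
        go (suc n) (x ∷ v) = S.*-cong (apply-raise (+ suc n) x) (go n v)

      -- By `ê-step`, subtracting w times the next column turns ê into e. The last column has no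
      -- next one and stays.
      det-ê-mixed : ∀ n β → SA.det (SC.cols ê (suc n)) β ≋ SA.det (SC.mixed (ι ∘ e) ê n) β
      det-ê-mixed zero    β = S.refl
      det-ê-mixed (suc n) β = S.trans
        (SA.det-cong₁ (SC.cols ê (suc n)) β (λ x → S.trans (ê-step (x ℤ.- + suc (suc n)))
           (S.+-congˡ (S.*-congˡ (S.reflexive (≡.cong ê (eq x (+ n))))))))
        (S.trans (SA.det-colˡ var (λ x → ι (e (x ℤ.- + suc (suc n)))) (λ x → ê (x ℤ.- + suc n)) (SC.cols ê n) β)
          (SA.det-congₛ (λ x → ι (e (x ℤ.- + suc (suc n)))) {cs = SC.cols ê (suc n)} {cs′ = SC.mixed (ι ∘ e) ê n} β (det-ê-mixed n)))
        where
        eq : ∀ x n → (x ℤ.- (1ℤ ℤ.+ (1ℤ ℤ.+ n))) ℤ.+ 1ℤ ≡ x ℤ.- (1ℤ ℤ.+ n)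
        eq = solve-∀

      -- Column operations replace all columns of det (ê (βᵢ - j)) but the last by
      -- those of det (e (βᵢ - j)).  What is then left of the last column vanishes at 0,
      -- which settles β with an entry 1, and is divisible by w, which settles the
      -- other β because the degree leaves no room for a positive power of w.
      remainder : ℤ → Series
      remainder x = ê x ⊞ (S.- ê 0ℤ) ⊛ ι (e x)

      det-remainder : ∀ n β → SA.det (SC.cols ê (suc n)) β ≋
        SA.det (SC.mixed (ι ∘ e) remainder n) β ⊞ ê 0ℤ ⊛ ι (det (cols e (suc n)) β)
      det-remainder n β = S.trans (det-ê-mixed n β) (S.sym (S.trans
        (S.+-congʳ (S.trans (SC.det-mixed-+ (ι ∘ e) ê (λ x → (S.- ê 0ℤ) ⊛ ι (e x)) n β)
          (S.+-congˡ (S.trans (SC.det-mixed-* (ι ∘ e) (S.- ê 0ℤ) (ι ∘ e) n β)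
            (S.*-congˡ (S.trans (SC.det-mixed-same (ι ∘ e) n β) (ι-det-cols e (suc n) β)))))))
        (S.solve 3 (λ a b c → (a S.:+ (S.:- b) S.:* c) S.:+ b S.:* c S.:= a) S.refl
          (SA.det (SC.mixed (ι ∘ e) ê n) β) (ê 0ℤ) (ι (det (cols e (suc n)) β)))))

      -- In terms of β = λ + ρ the threshold is ∣ λ ∣ = n. The weights met later vanish beyond it
      -- because they contain `double` at a negative argument.
      Supported : ∀ n → ℤ → (ℕ → Carrier) → Set
      Supported n d θ = ∀ k → triangle n ℤ.+ + n ℤ.< d ℤ.+ + k → θ k ≈ 0#

      remainder-0 : ∀ x → remainder x 0 ≈ 0#
      remainder-0 x = trans (+-cong (reflexive (≡.cong e (ℤ.+-identityʳ x)))
        (trans (*-congʳ (-‿cong e-0)) (-1*x≈-x _))) (-‿inverseʳ (e x))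

      remainder-var : ∀ x → remainder x ≋ var ⊛ (remainder x ∘ suc)
      remainder-var x = mk≋ λ
        { zero    _ → trans (remainder-0 x) (sym (var-⊛-zero (remainder x ∘ suc)))
        ; (suc k) _ → sym (var-⊛-suc (remainder x ∘ suc) k) }

      remainder-at-0 : remainder 0ℤ ≋ S.0#
      remainder-at-0 = S.trans (S.+-congˡ (S.trans (S.*-congˡ (ι-cong e-0)) (S.*-identityʳ _))) (S.-‿inverseʳ _)

      Λ-remainder : ∀ n {θ} β → Positive β → Decreasing β → Supported (suc n) ∣ β ∣ θ →
        Λ θ (SA.det (SC.mixed (ι ∘ e) remainder n) β) ≈ 0#
      Λ-remainder n {θ} β pos dec sup with one-or-greater pos
      ... | inj₁ m = Λ-zero θ (SA.det-zero-row (SC.mixed (ι ∘ e) remainder n) β m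
              (SC.mixed-zero (ι ∘ e) remainder n (λ k → S.trans (ι-cong (e-neg _)) ι-0) remainder-at-0))
      ... | inj₂ big = trans (Λ-cong θ (S.trans (SC.det-mixed-cong (ι ∘ e) n β remainder-var)
              (SC.det-mixed-* (ι ∘ e) var (λ x → remainder x ∘ suc) n β)))
            (sum-zero (upTo L) λ
              { zero    → trans (*-congˡ (var-⊛-zero (SA.det (SC.mixed (ι ∘ e) (λ x → remainder x ∘ suc) n) β))) (zeroʳ _)
              ; (suc k) → trans (*-congʳ (sup (suc k) (ℤ.<-≤-trans
                  (ℤ.≤-<-trans (ℤ.≤-trans (ℤ.≤-reflexive (eq (triangle (suc n)) (+ suc n))) (decreasing-bound 1ℤ dec big))
                    (ℤ.≤-<-trans (ℤ.≤-reflexive (≡.sym (ℤ.+-identityʳ ∣ β ∣))) (ℤ.+-monoʳ-< ∣ β ∣ (ℤ.+<+ (s≤s z≤n))))) ℤ.≤-refl))) (zeroˡ _) })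
        where
        eq : ∀ t n → t ℤ.+ n ≡ n ℤ.* 1ℤ ℤ.+ t
        eq = solve-∀

      Λ-det : ∀ n θ β → Positive β → Supported n ∣ β ∣ θ →
        Λ θ (SA.det (SC.cols ê n) β) ≈ det (cols e n) β * sum (upTo L) (λ k → θ k * e (+ k))
      Λ-det n θ = sort-induction
        (λ β → Positive β → Supported n ∣ β ∣ θ →
          Λ θ (SA.det (SC.cols ê n) β) ≈ det (cols e n) β * sum (upTo L) (λ k → θ k * e (+ k)))
        (λ {v} {w} s P pos sup → begin
          Λ θ (SA.det (SC.cols ê n) v)      ≈⟨ Λ-cong θ (SA.swap (SA.Alt-alternating (SA.prod (SC.cols ê n))) s) ⟩
          Λ θ (S.- SA.det (SC.cols ê n) w)  ≈⟨ Λ-neg θ _ ⟩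
          - Λ θ (SA.det (SC.cols ê n) w)    ≈⟨ -‿cong (P (Swap-All s pos) (≡.subst (λ d → Supported n d θ) (Swap-∣∣ s) sup)) ⟩
          - (det (cols e n) w * _)          ≈⟨ -‿distribˡ-* _ _ ⟩
          - det (cols e n) w * _            ≈⟨ *-congʳ (swap (Alt-alternating (prod (cols e n))) s) ⟨
          det (cols e n) v * _              ∎)
        (λ r pos sup → trans (Λ-zero θ (SA.repeats (SA.Alt-alternating (SA.prod (SC.cols ê n))) r))
          (sym (trans (*-congʳ (repeats (Alt-alternating (prod (cols e n))) r)) (zeroˡ _))))
        (λ {v} dec pos sup → decreasingCase n v dec pos sup)
        where
        decreasingCase : ∀ n β → Decreasing β → Positive β → Supported n ∣ β ∣ θ →
          Λ θ (SA.det (SC.cols ê n) β) ≈ det (cols e n) β * sum (upTo L) (λ k → θ k * e (+ k))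
        decreasingCase zero [] dec pos sup = trans
          (sum-cong (upTo L) λ { zero → *-congˡ (sym e-0) ; (suc k) → trans (zeroʳ _) (sym (trans (*-congʳ (sup (suc k) (ℤ.+<+ (s≤s z≤n)))) (zeroˡ _))) })
          (sym (*-identityˡ _))
        decreasingCase (suc n) β dec pos sup = begin
          Λ θ (SA.det (SC.cols ê (suc n)) β)
            ≈⟨ Λ-cong θ (det-remainder n β) ⟩
          Λ θ (SA.det (SC.mixed (ι ∘ e) remainder n) β ⊞ ê 0ℤ ⊛ ι D)
            ≈⟨ Λ-+ θ _ _ ⟩
          Λ θ (SA.det (SC.mixed (ι ∘ e) remainder n) β) + Λ θ (ê 0ℤ ⊛ ι D)
            ≈⟨ +-cong (Λ-remainder n β pos dec sup) (Λ-cong θ (S.*-comm (ê 0ℤ) (ι D))) ⟩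
          0# + Λ θ (ι D ⊛ ê 0ℤ)
            ≈⟨ +-identityˡ _ ⟩
          Λ θ (ι D ⊛ ê 0ℤ)
            ≈⟨ sum-cong (upTo L) (λ k → trans (*-congˡ (ι-⊛ D (ê 0ℤ) k)) (trans
                 (solve 3 (λ a b c → a :* (b :* c) := b :* (a :* c)) refl _ _ _)
                 (*-congˡ (*-congˡ (reflexive (≡.cong e (ℤ.+-identityˡ (+ k)))))))) ⟩
          sum (upTo L) (λ k → D * (θ k * e (+ k)))
            ≈⟨ sum-* D (upTo L) _ ⟨
          D * sum (upTo L) (λ k → θ k * e (+ k)) ∎
          where D = det (cols e (suc n)) β

    -- The column operations leave the determinant times ê 0 = Σ eₖ w^k: all raisings together act
    -- as multiplication by this series. The bound on L guarantees that the raisings cut off by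
    -- `raise` had weight 0.
    raise-det : ∀ y δ (χ : ℤ → ℤ → Carrier) b (β : Vec ℤ n) → Positive β → triangle n ℤ.+ + n ℤ.< + L →
      (∀ k → triangle n ℤ.+ + n ℤ.< ∣ β ∣ ℤ.+ + k → χ (b ℤ.- δ ℤ.* + k) (∣ β ∣ ℤ.+ + k) ≈ 0#) →
      Tens (raise y δ) (λ b v → det (cols e n) v * χ b ∣ v ∣) b β ≈
        det (cols e n) β * sum (upTo L) (λ k → (y ^ k * χ (b ℤ.- δ ℤ.* + k) (∣ β ∣ ℤ.+ + k)) * e (+ k))
    raise-det {n} y δ χ b β pos big sup = trans
      (Tens-Λ y δ (det (cols e n)) χ b 0ℤ β (λ k L≤k → sup k (ℤ.<-≤-trans big
        (ℤ.≤-trans (ℤ.+≤+ L≤k) (ℤ.≤-trans (ℤ.≤-reflexive (≡.sym (ℤ.+-identityˡ (+ k)))) (ℤ.+-monoˡ-≤ (+ k) (positive⇒0≤∣∣ pos)))))))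
      (trans (Λ-cong _ (det-ê n 0ℤ β))
        (Λ-det n (weight y δ χ b ∣ β ∣) β pos (λ k lt → trans (*-congˡ (sup k lt)) (zeroʳ _))))

-- Elementary symmetric polynomials and pair products of 1, q, …, q^(T-1)

Nilpotent : (R : CommutativeRing 0ℓ 0ℓ) → CommutativeRing.Carrier R → ℕ → Set
Nilpotent R q K = q ^ K ≈ 0#
  where open Ring R

module Euler (R : CommutativeRing 0ℓ 0ℓ) (q : CommutativeRing.Carrier R) where
  open Ring R
  open Truncated R 0 using (Series; _⊛_; ι; ⊛-suc; ⊛-comm; ⊛-assoc; ⊛-cong-≤; ⊛-congʳ; ι-⊛)

  infix 4 _≐_
  _≐_ : Series → Series → Set
  a ≐ b = ∀ k → a k ≈ b k

  -- eₖ(1, q, …, q^(T-1))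
  elementary : ℕ → Series
  elementary T       zero    = 1#
  elementary zero    (suc k) = 0#
  elementary (suc T) (suc k) = elementary T (suc k) + q ^ T * elementary T k

  e qe : ℕ → ℤ → Carrier
  e T (+ k)    = elementary T k
  e T -[1+ k ] = 0#
  qe T (+ k)    = q ^ k * elementary T k
  qe T -[1+ k ] = 0#

  e-suc : ∀ T x → e (suc T) x ≈ e T x + q ^ T * e T (x ℤ.- 1ℤ)
  e-suc T (+ zero)  = sym (trans (+-congˡ (zeroʳ _)) (+-identityʳ _))
  e-suc T (+ suc k) = refl
  e-suc T -[1+ k ]  = sym (trans (+-congˡ (zeroʳ _)) (+-identityʳ _))

  -- E(y)(1 + q^T y) = (1 + y)E(qy) for E(y) = ∏_{t<T} (1 + q^t y).
  elementary-q : ∀ T k → elementary T (suc k) + q ^ T * elementary T k ≈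
    q ^ suc k * elementary T (suc k) + q ^ k * elementary T k
  elementary-q zero zero    = trans (+-identityˡ _) (trans (sym (+-identityˡ _)) (+-congʳ (sym (zeroʳ _))))
  elementary-q zero (suc k) = trans (+-congˡ (zeroʳ _)) (+-cong (sym (zeroʳ _)) (sym (zeroʳ _)))
  elementary-q (suc T) zero = trans (+-congʳ (elementary-q T 0))
    (solve 3 (λ a t x → ((x :* :1) :* a :+ :1 :* :1) :+ (x :* t) :* :1 := (x :* :1) :* (a :+ t :* :1) :+ :1 :* :1) refl (elementary T 1) (q ^ T) q)
  elementary-q (suc T) (suc k) = begin
    (a + t * b) + (q * t) * (b + t * c)
      ≈⟨ +-cong (elementary-q T (suc k)) (*-congˡ (elementary-q T k)) ⟩
    (q * (q * s) * a + (q * s) * b) + (q * t) * ((q * s) * b + s * c)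
      ≈⟨ solve 6 (λ x s t a b c → ((x :* (x :* s)) :* a :+ (x :* s) :* b) :+ (x :* t) :* ((x :* s) :* b :+ s :* c)
           := (x :* (x :* s)) :* (a :+ t :* b) :+ (x :* s) :* (b :+ t :* c)) refl q s t a b c ⟩
    (q * (q * s)) * (a + t * b) + (q * s) * (b + t * c) ∎
    where
    a = elementary T (suc (suc k))
    b = elementary T (suc k)
    c = elementary T k
    s = q ^ k
    t = q ^ T

  -- With q^T ≈ 0 the relation `elementary-q` loses a term and becomes E(y) = (1 + y) E(qy), the
  -- functional equation for infinitely many t.
  e-q : ∀ T → q ^ T ≈ 0# → ∀ x → qe T x ≈ e T (1ℤ ℤ.+ x) - qe T (1ℤ ℤ.+ x)
  e-q T z (+ k) = begin
    s * b                        ≈⟨ solve 2 (λ u v → u := (v :+ u) :- v) refl _ _ ⟩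
    ((q * s) * a + s * b) - (q * s) * a  ≈⟨ +-congʳ (elementary-q T k) ⟨
    (a + q ^ T * b) - (q * s) * a  ≈⟨ +-congʳ (trans (+-congˡ (trans (*-congʳ z) (zeroˡ _))) (+-identityʳ _)) ⟩
    a - (q * s) * a              ∎
    where
    a = elementary T (suc k)
    b = elementary T k
    s = q ^ k
  e-q T z -[1+ zero ]  = sym (trans (+-congˡ (-‿cong (*-identityʳ _))) (-‿inverseʳ _))
  e-q T z -[1+ suc k ] = sym (-‿inverseʳ _)

  qe-big : ∀ K T k → q ^ K ≈ 0# → K ℕ.≤ k → qe T (+ k) ≈ 0#
  qe-big K T k z K≤k = trans (*-congʳ (trans (reflexive (≡.cong (q ^_) (≡.sym (ℕ.m+[n∸m]≡n K≤k))))
    (trans (^-homo-* q K _) (trans (*-congʳ z) (zeroˡ _))))) (zeroˡ _)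

  -- double g d is the coefficient of x^d in Σ g_M x^(2M).
  double : Series → ℤ → Carrier
  double g (+ 0)             = g 0
  double g (+ 1)             = 0#
  double g (+ suc (suc d))   = double (g ∘ suc) (+ d)
  double g -[1+ d ]          = 0#

  double-cong : ∀ {g h} d → g ≐ h → double g d ≈ double h d
  double-cong (+ 0)           eq = eq 0
  double-cong (+ 1)           eq = refl
  double-cong (+ suc (suc d)) eq = double-cong (+ d) (eq ∘ suc)
  double-cong -[1+ d ]        eq = refl

  double-+ : ∀ g h d → double (λ k → g k + h k) d ≈ double g d + double h d
  double-+ g h (+ 0)           = refl
  double-+ g h (+ 1)           = sym (+-identityˡ _)
  double-+ g h (+ suc (suc d)) = double-+ (g ∘ suc) (h ∘ suc) (+ d)
  double-+ g h -[1+ d ]        = sym (+-identityˡ _)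

  double-* : ∀ c g d → double (λ k → c * g k) d ≈ c * double g d
  double-* c g (+ 0)           = refl
  double-* c g (+ 1)           = sym (zeroʳ c)
  double-* c g (+ suc (suc d)) = double-* c (g ∘ suc) (+ d)
  double-* c g -[1+ d ]        = sym (zeroʳ c)

  double-neg : ∀ g {z} → z ℤ.< 0ℤ → double g z ≈ 0#
  double-neg g { -[1+ _ ]} _           = refl
  double-neg g {+ _}       (ℤ.+<+ ())

  -- A product of two series in x². Since d < L, the terms from L on would sit at d - 2k < 0 and
  -- vanish.
  double-convolution : ∀ E a d L → d ℕ.< L →
    sum (upTo L) (λ k → E k * double a (+ d ℤ.- (+ k ℤ.+ + k))) ≈ double (E ⊛ a) (+ d)
  double-convolution E a d (suc L) d<L = trans (sum-upTo-suc L _) (go d d<L)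
    where
    step : ∀ d k → (+ 2 ℤ.+ d) ℤ.- ((1ℤ ℤ.+ k) ℤ.+ (1ℤ ℤ.+ k)) ≡ d ℤ.- (k ℤ.+ k)
    step = solve-∀
    neg : ∀ d k → d ℕ.< 2 → + d ℤ.- (+ suc k ℤ.+ + suc k) ℤ.< 0ℤ
    neg 0             k _                     = ℤ.-<+
    neg 1             k _                     = ℤ.≤-<-trans (ℤ.≤-reflexive (odd (+ k))) (ℤ.neg-mono-< (ℤ.+<+ (s≤s z≤n)))
      where
      odd : ∀ k → 1ℤ ℤ.- ((1ℤ ℤ.+ k) ℤ.+ (1ℤ ℤ.+ k)) ≡ ℤ.- (1ℤ ℤ.+ (k ℤ.+ k))
      odd = solve-∀
    neg (suc (suc d)) k (s≤s (s≤s ()))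
    go : ∀ d → d ℕ.< suc L → E 0 * double a (+ d ℤ.- (+ 0 ℤ.+ + 0)) +
      sum (upTo L) (λ k → E (suc k) * double a (+ d ℤ.- (+ suc k ℤ.+ + suc k))) ≈ double (E ⊛ a) (+ d)
    go 0 _ = trans (+-congˡ (sum-zero (upTo L) λ k → trans (*-congˡ (double-neg a (neg 0 k (s≤s z≤n)))) (zeroʳ _))) (+-identityʳ _)
    go 1 _ = trans (+-cong (zeroʳ _) (sum-zero (upTo L) λ k → trans (*-congˡ (double-neg a (neg 1 k (s≤s (s≤s z≤n))))) (zeroʳ _))) (+-identityʳ _)
    go (suc (suc d)) (s≤s d<L) = begin
      E 0 * double a (+ suc (suc d) ℤ.- (+ 0 ℤ.+ + 0)) + sum (upTo L) (λ k → E (suc k) * double a (+ suc (suc d) ℤ.- (+ suc k ℤ.+ + suc k)))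
        ≈⟨ +-cong (*-congˡ (reflexive (≡.cong (double a) (ℤ.+-identityʳ (+ suc (suc d))))))
             (trans (sum-cong (upTo L) (λ k → *-congˡ (reflexive (≡.cong (double a) (step (+ d) (+ k))))))
               (double-convolution (E ∘ suc) a d L (ℕ.≤-trans (s≤s (ℕ.n≤1+n d)) d<L))) ⟩
      E 0 * double (a ∘ suc) (+ d) + double ((E ∘ suc) ⊛ a) (+ d)
        ≈⟨ +-congʳ (double-* (E 0) (a ∘ suc) (+ d)) ⟨
      double (λ k → E 0 * a (suc k)) (+ d) + double ((E ∘ suc) ⊛ a) (+ d)
        ≈⟨ double-+ _ _ (+ d) ⟨
      double (E ⊛ a) (+ suc (suc d)) ∎

  linear : Carrier → Series
  linear c zero          = 1#
  linear c (suc zero)    = - c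
  linear c (suc (suc k)) = 0#

  linear-⊛-suc : ∀ c a k → (linear c ⊛ a) (suc k) ≈ a (suc k) - c * a k
  linear-⊛-suc c a k = +-cong (*-identityˡ _) (trans (⊛-congʳ a (λ { zero → refl ; (suc _) → refl }) k)
    (trans (ι-⊛ (- c) a k) (sym (-‿distribˡ-* c (a k)))))

  -- The quotient a / (1 - c z), coefficient by coefficient.
  divide : Carrier → Series → Series
  divide c a zero    = a 0
  divide c a (suc k) = a (suc k) + c * divide c a k

  linear-divide : ∀ c a → linear c ⊛ divide c a ≐ a
  linear-divide c a zero    = *-identityˡ _
  linear-divide c a (suc k) = trans (linear-⊛-suc c (divide c a) k)
    (solve 2 (λ x y → (x :+ y) :- y := x) refl _ _)

  divide-cong : ∀ {c c′ a a′} → c ≈ c′ → a ≐ a′ → divide c a ≐ divide c′ a′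
  divide-cong eq eqa zero    = eqa 0
  divide-cong eq eqa (suc k) = +-cong (eqa (suc k)) (*-cong eq (divide-cong eq eqa k))

  divide-0 : ∀ {c} a → c ≈ 0# → divide c a ≐ a
  divide-0 a z zero    = refl
  divide-0 a z (suc k) = trans (+-congˡ (trans (*-congʳ z) (zeroˡ _))) (+-identityʳ _)

  ⊛-linear-comb : ∀ a b c d k → (a ⊛ (λ j → b j + c * d j)) k ≈ (a ⊛ b) k + c * (a ⊛ d) k
  ⊛-linear-comb a b c d zero    = solve 4 (λ a b c d → a :* (b :+ c :* d) := a :* b :+ c :* (a :* d)) refl _ _ _ _
  ⊛-linear-comb a b c d (suc k) = trans (+-congˡ (⊛-linear-comb (a ∘ suc) b c d k))
    (solve 6 (λ a b c d x y → a :* (b :+ c :* d) :+ (x :+ c :* y) := (a :* b :+ x) :+ c :* (a :* d :+ y)) refl _ _ _ _ _ _)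

  divide-⊛ : ∀ c a b → a ⊛ divide c b ≐ divide c (a ⊛ b)
  divide-⊛ c a b zero    = refl
  divide-⊛ c a b (suc k) = begin
    (a ⊛ divide c b) (suc k)
      ≈⟨ ⊛-suc a (divide c b) k ⟩
    (a ⊛ (λ j → b (suc j) + c * divide c b j)) k + a (suc k) * b 0
      ≈⟨ +-congʳ (⊛-linear-comb a (b ∘ suc) c (divide c b) k) ⟩
    ((a ⊛ (b ∘ suc)) k + c * (a ⊛ divide c b) k) + a (suc k) * b 0
      ≈⟨ solve 3 (λ x y z → (x :+ y) :+ z := (x :+ z) :+ y) refl _ _ _ ⟩
    ((a ⊛ (b ∘ suc)) k + a (suc k) * b 0) + c * (a ⊛ divide c b) k
      ≈⟨ +-cong (sym (⊛-suc a b k)) (*-congˡ (divide-⊛ c a b k)) ⟩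
    (a ⊛ b) (suc k) + c * divide c (a ⊛ b) k ∎

  divideAll : (ℕ → Carrier) → ℕ → Series → Series
  divideAll c zero    a = a
  divideAll c (suc j) a = divide (c j) (divideAll c j a)

  divideAll-cong : ∀ {c c′} j {a a′} → (∀ i → c i ≈ c′ i) → a ≐ a′ → divideAll c j a ≐ divideAll c′ j a′
  divideAll-cong zero    eq eqa = eqa
  divideAll-cong (suc j) eq eqa = divide-cong (eq j) (divideAll-cong j eq eqa)

  divideAll-⊛ : ∀ c j a b → a ⊛ divideAll c j b ≐ divideAll c j (a ⊛ b)
  divideAll-⊛ c zero    a b k = refl
  divideAll-⊛ c (suc j) a b k = trans (divide-⊛ (c j) a (divideAll c j b) k) (divide-cong refl (divideAll-⊛ c j a b) k)

  divideAll-first : ∀ c j a → divideAll c (suc j) a ≐ divideAll (c ∘ suc) j (divide (c 0) a)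
  divideAll-first c zero    a k = refl
  divideAll-first c (suc j) a   = divide-cong refl (divideAll-first c j a)

  divideAll-0 : ∀ c j a → (∀ i → c i ≈ 0#) → divideAll c j a ≐ a
  divideAll-0 c zero    a z k = refl
  divideAll-0 c (suc j) a z k = trans (divide-0 _ (z j) k) (divideAll-0 c j a z k)

  -- 1 / ∏_{s≤t<T} (1 - q^(s+t) z)
  pairProduct : ℕ → Series
  pairProduct zero    = ι 1#
  pairProduct (suc T) = divideAll (λ t → q ^ (T ℕ.+ t)) (suc T) (pairProduct T)

  pochhammer : ℕ → Carrier
  pochhammer zero    = 1#
  pochhammer (suc n) = pochhammer n * (1# - q ^ suc n)

  -- ∏_{t<T} (1 - y q^t z)
  signed : Carrier → ℕ → Series
  signed y T k = (- y) ^ k * elementary T k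

  signed-suc : ∀ y T → signed y (suc T) ≐ linear (y * q ^ T) ⊛ signed y T
  signed-suc y T zero    = sym (*-identityˡ _)
  signed-suc y T (suc k) = sym (trans (linear-⊛-suc (y * q ^ T) (signed y T) k)
    (solve 5 (λ y t p a b → (((:- y) :* p) :* a) :- (y :* t) :* (p :* b) := ((:- y) :* p) :* (a :+ t :* b)) refl
      y (q ^ T) ((- y) ^ k) (elementary T (suc k)) (elementary T k)))

  signed-divideAll : ∀ y c T a → (∀ t → c t ≈ y * q ^ t) → signed y T ⊛ divideAll c T a ≐ a
  signed-divideAll y c zero    a eq k = trans (⊛-congʳ a (λ { zero → *-identityˡ _ ; (suc k) → zeroʳ _ }) k)
    (trans (ι-⊛ 1# a k) (*-identityˡ _))
  signed-divideAll y c (suc T) a eq k = begin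
    (signed y (suc T) ⊛ divide (c T) d) k            ≈⟨ ⊛-congʳ _ (signed-suc y T) k ⟩
    ((linear (y * q ^ T) ⊛ signed y T) ⊛ divide (c T) d) k ≈⟨ ⊛-congʳ _ (⊛-comm (linear (y * q ^ T)) (signed y T)) k ⟩
    ((signed y T ⊛ linear (y * q ^ T)) ⊛ divide (c T) d) k ≈⟨ ⊛-assoc (signed y T) (linear (y * q ^ T)) _ k ⟩
    (signed y T ⊛ (linear (y * q ^ T) ⊛ divide (c T) d)) k ≈⟨ ⊛-cong-≤ k (λ _ _ → refl) (λ j _ → trans
                                                                 (⊛-cong-≤ j (λ _ _ → refl) (λ i _ → divide-cong (eq T) (λ _ → refl) i))
                                                                 (linear-divide (y * q ^ T) d j)) ⟩
    (signed y T ⊛ d) k                               ≈⟨ signed-divideAll y c T a eq k ⟩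
    a k                                              ∎
    where d = divideAll c T a

  -- The factors 1 - q^(T+t) z with t ≤ T are those by which `pairProduct` grows from T to T + 1.
  signed-pairProduct : ∀ T → signed (q ^ T) (suc T) ⊛ pairProduct (suc T) ≐ pairProduct T
  signed-pairProduct T = signed-divideAll (q ^ T) _ (suc T) (pairProduct T) (λ t → ^-homo-* q T t)

  dilate : Series → Series
  dilate a k = q ^ (k ℕ.+ k) * a k

  dilate-divide : ∀ {c c′} a → c′ ≈ q * (q * c) → dilate (divide c a) ≐ divide c′ (dilate a)
  dilate-divide a eq zero    = refl
  dilate-divide {c} {c′} a eq (suc k) = begin
    q ^ (suc k ℕ.+ suc k) * (a (suc k) + c * divide c a k)
      ≈⟨ trans (distribˡ _ _ _) (+-congˡ (*-congʳ (reflexive (≡.cong (λ j → q * q ^ j) (ℕ.+-suc k k))))) ⟩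
    dilate a (suc k) + (q * (q * q ^ (k ℕ.+ k))) * (c * divide c a k)
      ≈⟨ +-congˡ (solve 4 (λ x p c d → (x :* (x :* p)) :* (c :* d) := (x :* (x :* c)) :* (p :* d)) refl _ _ _ _) ⟩
    dilate a (suc k) + (q * (q * c)) * (q ^ (k ℕ.+ k) * divide c a k)
      ≈⟨ +-congˡ (*-cong (sym eq) (dilate-divide a eq k)) ⟩
    dilate a (suc k) + c′ * divide c′ (dilate a) k ∎

  dilate-divideAll : ∀ {c c′} j a → (∀ i → c′ i ≈ q * (q * c i)) → dilate (divideAll c j a) ≐ divideAll c′ j (dilate a)
  dilate-divideAll zero    a eq k = refl
  dilate-divideAll (suc j) a eq k = trans (dilate-divide _ (eq j) k) (divide-cong refl (dilate-divideAll j a eq) k)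

  -- The numerator cancels the factors of the pairs (0 , t) with t ≤ T. The pairs that are left, 1 ≤
  -- s ≤ t ≤ T, are the pairs below T with both indices raised by one, which replaces z by q² z.
  signed-dilate : ∀ T → signed 1# (suc T) ⊛ pairProduct (suc T) ≐ dilate (pairProduct T)
  signed-dilate zero k = trans (signed-pairProduct 0 k) (one k)
    where
    one : ι 1# ≐ dilate (ι 1#)
    one zero    = sym (*-identityˡ _)
    one (suc k) = sym (zeroʳ _)
  signed-dilate (suc T) k = begin
    (signed 1# (suc (suc T)) ⊛ divideAll c (suc (suc T)) g) k
      ≈⟨ ⊛-cong-≤ k (λ j _ → trans (signed-suc 1# (suc T) j) (⊛-comm (linear (1# * q ^ suc T)) _ j)) (λ j _ → divideAll-first c (suc T) g j) ⟩
    ((signed 1# (suc T) ⊛ linear (1# * q ^ suc T)) ⊛ divideAll (c ∘ suc) (suc T) (divide (c 0) g)) k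
      ≈⟨ ⊛-assoc (signed 1# (suc T)) (linear (1# * q ^ suc T)) _ k ⟩
    (signed 1# (suc T) ⊛ (linear (1# * q ^ suc T) ⊛ divideAll (c ∘ suc) (suc T) (divide (c 0) g))) k
      ≈⟨ ⊛-cong-≤ k (λ _ _ → refl) (λ j _ → trans (divideAll-⊛ (c ∘ suc) (suc T) _ _ j)
           (divideAll-cong (suc T) (λ _ → refl) cancel j)) ⟩
    (signed 1# (suc T) ⊛ divideAll (c ∘ suc) (suc T) g) k
      ≈⟨ divideAll-⊛ (c ∘ suc) (suc T) (signed 1# (suc T)) g k ⟩
    divideAll (c ∘ suc) (suc T) (signed 1# (suc T) ⊛ g) k
      ≈⟨ divideAll-cong (suc T) (λ _ → refl) (signed-dilate T) k ⟩
    divideAll (c ∘ suc) (suc T) (dilate (pairProduct T)) k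
      ≈⟨ dilate-divideAll (suc T) (pairProduct T) (λ i → reflexive (≡.cong (q ^_) (≡.cong suc (ℕ.+-suc T i)))) k ⟨
    dilate g k ∎
    where
    c = λ t → q ^ (suc T ℕ.+ t)
    g = pairProduct (suc T)
    cancel : linear (1# * q ^ suc T) ⊛ divide (c 0) g ≐ g
    cancel j = trans (⊛-cong-≤ j (λ _ _ → refl) (λ i _ → divide-cong
        (trans (reflexive (≡.cong (q ^_) (ℕ.+-identityʳ (suc T)))) (sym (*-identityˡ _))) (λ _ → refl) i))
      (linear-divide (1# * q ^ suc T) g j)

  ^-big : ∀ {K} → q ^ K ≈ 0# → ∀ j → q ^ (K ℕ.+ j) ≈ 0#
  ^-big {K} z j = trans (^-homo-* q K j) (trans (*-congʳ z) (zeroˡ _))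

  -- The pairs containing K have factors 1 - q^(K+s) z ≈ 1, so K and K + 1 give the same product and
  -- the identity becomes the one for infinitely many t.
  signed-dilate-stable : ∀ K → q ^ K ≈ 0# → signed 1# (suc K) ⊛ pairProduct (suc K) ≐ dilate (pairProduct (suc K))
  signed-dilate-stable K z k = trans (signed-dilate K k)
    (*-congˡ (sym (divideAll-0 _ (suc K) (pairProduct K) (^-big {K} z) k)))

  divideAll-at-0 : ∀ c j a → divideAll c j a 0 ≡ a 0
  divideAll-at-0 c zero    a = ≡.refl
  divideAll-at-0 c (suc j) a = divideAll-at-0 c j a

  pairProduct-at-0 : ∀ T → pairProduct T 0 ≡ 1#
  pairProduct-at-0 zero    = ≡.refl
  pairProduct-at-0 (suc T) = ≡.trans (divideAll-at-0 _ (suc T) (pairProduct T)) (pairProduct-at-0 T)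

  -- The substitution of q z for z. It accounts for the factor q^M by which the closed forms of u
  -- and X differ.
  twist : Series → Series
  twist a k = q ^ k * a k

  twist-⊛ : ∀ a b → twist a ⊛ twist b ≐ twist (a ⊛ b)
  twist-⊛ a b zero    = solve 2 (λ a b → (:1 :* a) :* (:1 :* b) := :1 :* (a :* b)) refl _ _
  twist-⊛ a b (suc k) = begin
    (1# * a 0) * (q ^ suc k * b (suc k)) + ((twist a ∘ suc) ⊛ twist b) k
      ≈⟨ +-congˡ (trans (⊛-congʳ (twist b) (λ j → trans (*-assoc q _ _) (sym (+-identityˡ _))) k)
           (trans (⊛-comm _ (twist b) k) (trans (⊛-linear-comb (twist b) (λ _ → 0#) q (twist (a ∘ suc)) k)
             (+-cong (trans (⊛-comm (twist b) _ k) (⊛-0 (twist b) k)) (*-congˡ (trans (⊛-comm (twist b) _ k) (twist-⊛ (a ∘ suc) b k))))))) ⟩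
    (1# * a 0) * (q ^ suc k * b (suc k)) + (0# + q * (q ^ k * ((a ∘ suc) ⊛ b) k))
      ≈⟨ solve 5 (λ x p a b c → (:1 :* a) :* ((x :* p) :* b) :+ (:0 :+ x :* (p :* c)) := (x :* p) :* (a :* b :+ c)) refl q (q ^ k) _ _ _ ⟩
    q ^ suc k * (a ⊛ b) (suc k) ∎
    where
    ⊛-0 : ∀ b k → ((λ _ → 0#) ⊛ b) k ≈ 0#
    ⊛-0 b zero    = zeroˡ _
    ⊛-0 b (suc k) = trans (+-cong (zeroˡ _) (⊛-0 b k)) (+-identityˡ _)

  -- The argument d of `double` is twice the index k, so the factor q^(2k) of `dilate` equals q^d.
  double-dilate : ∀ m h d → q ^ m * double (dilate h) (+ d) ≈ q ^ (m ℕ.+ d) * double h (+ d)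
  double-dilate m h 0 = *-cong (reflexive (≡.cong (q ^_) (≡.sym (ℕ.+-identityʳ m)))) (*-identityˡ _)
  double-dilate m h 1 = trans (zeroʳ _) (sym (zeroʳ _))
  double-dilate m h (suc (suc d)) = begin
    q ^ m * double (dilate h ∘ suc) (+ d)
      ≈⟨ *-congˡ (trans (double-cong (+ d) (λ k → trans
           (*-congʳ (reflexive (≡.cong (λ j → q * q ^ j) (ℕ.+-suc k k))))
           (solve 3 (λ x p h → (x :* (x :* p)) :* h := (x :* x) :* (p :* h)) refl q (q ^ (k ℕ.+ k)) (h (suc k)))))
           (double-* (q * q) (dilate (h ∘ suc)) (+ d))) ⟩
    q ^ m * ((q * q) * double (dilate (h ∘ suc)) (+ d))
      ≈⟨ solve 3 (λ p x y → p :* (x :* y) := x :* (p :* y)) refl _ _ _ ⟩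
    (q * q) * (q ^ m * double (dilate (h ∘ suc)) (+ d))
      ≈⟨ *-congˡ (double-dilate m (h ∘ suc) d) ⟩
    (q * q) * (q ^ (m ℕ.+ d) * double (h ∘ suc) (+ d))
      ≈⟨ solve 3 (λ x p y → (x :* x) :* (p :* y) := (x :* (x :* p)) :* y) refl q _ _ ⟩
    q ^ suc (suc (m ℕ.+ d)) * double (h ∘ suc) (+ d)
      ≈⟨ *-congʳ (reflexive (≡.cong (q ^_) (≡.sym (≡.trans (ℕ.+-suc m (suc d)) (≡.cong suc (ℕ.+-suc m d)))))) ⟩
    q ^ (m ℕ.+ suc (suc d)) * double (h ∘ suc) (+ d) ∎

-- The closed form of u, by induction on the number of variables

-- β ↦ β - (1ⁿ) - ρₙ
unshift : Vec ℤ n → Vec ℤ n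
unshift []              = []
unshift {suc n} (x ∷ v) = x ℤ.- + suc (suc n) ∷ unshift v

module Jing (R : CommutativeRing 0ℓ 0ℓ) (q : CommutativeRing.Carrier R) (K : ℕ) (L : ℕ)
  (q^K≈0 : Nilpotent R q K) (K≤L : K ℕ.≤ L) where
  open Ring R
  open Alt R
  open Columns R
  open Raising R L
  open Euler R q

  -- One more than K, because `signed-dilate-stable` compares the products for K and K + 1.
  T : ℕ
  T = suc K

  q^T≈0 : q ^ T ≈ 0#
  q^T≈0 = trans (*-congˡ q^K≈0) (zeroʳ q)

  eT qeT : ℤ → Carrier
  eT  = e T
  qeT = qe T

  D : Fun n
  D {n} = det (cols eT n)

  raise-eT : ∀ y δ (χ : ℤ → ℤ → Carrier) b (β : Vec ℤ n) → Positive β → triangle n ℤ.+ + n ℤ.< + L →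
    (∀ k → triangle n ℤ.+ + n ℤ.< ∣ β ∣ ℤ.+ + k → χ (b ℤ.- δ ℤ.* + k) (∣ β ∣ ℤ.+ + k) ≈ 0#) →
    Tens (raise y δ) (λ b v → D v * χ b ∣ v ∣) b β ≈
      D β * sum (upTo L) (λ k → (y ^ k * χ (b ℤ.- δ ℤ.* + k) (∣ β ∣ ℤ.+ + k)) * eT (+ k))
  raise-eT = raise-det eT (λ _ → refl) refl

  δ₀ : ℤ → Carrier
  δ₀ (+ 0)     = 1#
  δ₀ (+ suc _) = 0#
  δ₀ -[1+ _ ]  = 0#

  -- The coefficient of x^β in the generating function, one variable at a time.
  F : ∀ n → Fun n
  F zero    []      = 1#
  F (suc n) (b ∷ v) = Tens (raise q 1ℤ) (Tens (raise q -1ℤ) (λ b v → δ₀ b * F n v)) b v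

  U : ∀ n → Fun n
  U n = Alt (λ v → F n (unshift v))

  g : ℕ → Carrier
  g = pairProduct T

  -- At β = λ + ρ the argument of `double` is n - ∣ λ ∣.
  closedU : ∀ n → Fun n
  closedU n β = D β * (pochhammer n * double (twist g) (+ n ℤ.+ triangle n ℤ.- ∣ β ∣))

  Tens-unshift : ∀ op (φ : ℤ → Fun n) b v → Tens op φ b (unshift v) ≈ Tens op (λ b v → φ b (unshift v)) b v
  Tens-unshift op φ b []      = refl
  Tens-unshift {suc n} op φ b (x ∷ v) = sum-cong op λ (c , i , j) → *-congˡ (trans
    (Tens-unshift op _ _ v)
    (Tens-cong op _ v λ b w → reflexive (≡.cong (λ z → φ b (z ∷ unshift w)) (eq x j (+ suc (suc n))))))
    where
    eq : ∀ x j o → (x ℤ.- o) ℤ.+ j ≡ (x ℤ.+ j) ℤ.- o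
    eq = solve-∀

  raise-cong : ∀ y δ {φ φ′ : ℤ → Fun n} b β → Positive β → (∀ b v → Positive v → φ b v ≈ φ′ b v) →
    Tens (raise y δ) φ b β ≈ Tens (raise y δ) φ′ b β
  raise-cong y δ b []      _          eq = eq b [] []
  raise-cong y δ b (x ∷ β) (p ∷ pos) eq = trans (sum-map _ (upTo L) _) (trans
    (sum-cong (upTo L) λ i → *-congˡ (raise-cong y δ _ β pos λ b v pos′ → eq b _ (ℤ.<-≤-trans p (x≤x+i x i) ∷ pos′)))
    (sym (sum-map _ (upTo L) _)))
    where
    x≤x+i : ∀ x i → x ℤ.≤ x ℤ.+ + i
    x≤x+i x i = ℤ.i≤i+j x (+ i)

  -- By `relation`, a column of e's is the sum of the qe columns at its own place and one place to
  -- the left. Column operations therefore spread qe from the first column to all the others.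
  det-qe-first : ∀ n β →
    det ((λ x → qeT (x ℤ.- + suc n)) ∷ cols eT n) β ≈ det (cols qeT (suc n)) β
  det-qe-first zero    β = refl
  det-qe-first (suc n) β = trans
    (det-congₛ (λ x → qeT (x ℤ.- + suc (suc n))) {cs = cols eT (suc n)} {cs′ = (λ x → qeT (x ℤ.- + suc n) + 1# * qeT (x ℤ.- + suc (suc n))) ∷ cols eT n} β
      (λ γ → det-cong₁ (cols eT n) γ (λ x → sym (relation x))))
    (trans (det-colʳ 1# (λ x → qeT (x ℤ.- + suc n)) (λ x → qeT (x ℤ.- + suc (suc n))) (cols eT n) β)
      (det-congₛ (λ x → qeT (x ℤ.- + suc (suc n))) {cs = (λ x → qeT (x ℤ.- + suc n)) ∷ cols eT n} {cs′ = cols qeT (suc n)} β (det-qe-first n)))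
    where
    eq : ∀ x n → 1ℤ ℤ.+ (x ℤ.- (1ℤ ℤ.+ (1ℤ ℤ.+ n))) ≡ x ℤ.- (1ℤ ℤ.+ n)
    eq = solve-∀
    relation : ∀ x → qeT (x ℤ.- + suc n) + 1# * qeT (x ℤ.- + suc (suc n)) ≈ eT (x ℤ.- + suc n)
    relation x = begin
      qeT y + 1# * qeT (x ℤ.- + suc (suc n))
        ≈⟨ +-congˡ (*-congˡ (trans (e-q T q^T≈0 (x ℤ.- + suc (suc n))) (reflexive (≡.cong (λ y → eT y - qeT y) (eq x (+ n)))))) ⟩
      qeT y + 1# * (eT y - qeT y)
        ≈⟨ solve 2 (λ a b → a :+ :1 :* (b :- a) := b) refl _ _ ⟩
      eT y ∎
      where y = x ℤ.- + suc n

  -- Either all arguments of the columns are nonnegative and the powers of q combine to q^m, where m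
  -- is the excess of the total over that of ρ, or one argument is negative and kills both products.
  Dilated : ∀ n → Vec ℤ n → Set
  Dilated n v = (Σ[ m ∈ ℕ ] ∣ v ∣ ≡ triangle n ℤ.+ + m × prod (cols qeT n) v ≈ q ^ m * prod (cols eT n) v)
    ⊎ (prod (cols qeT n) v ≈ 0# × prod (cols eT n) v ≈ 0#)

  prod-qe : ∀ n v → Dilated n v
  prod-qe zero    [] = inj₁ (0 , ≡.refl , sym (*-identityˡ _))
  prod-qe (suc n) (x ∷ v) = go (x ℤ.- + suc n) ≡.refl (prod-qe n v)
    where
    total : ∀ {k m} → x ℤ.- + suc n ≡ + k → ∣ v ∣ ≡ triangle n ℤ.+ + m → x ℤ.+ ∣ v ∣ ≡ triangle (suc n) ℤ.+ + (k ℕ.+ m)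
    total {k} {m} e₁ e₂ = ≡.trans (≡.cong (ℤ._+_ x) e₂) (≡.trans (split x (+ suc n) (triangle n) (+ m))
      (≡.cong (λ y → triangle (suc n) ℤ.+ (y ℤ.+ + m)) e₁))
      where
      split : ∀ x o t m → x ℤ.+ (t ℤ.+ m) ≡ (o ℤ.+ t) ℤ.+ ((x ℤ.- o) ℤ.+ m)
      split = solve-∀
    go : ∀ k → x ℤ.- + suc n ≡ k → Dilated n v → Dilated (suc n) (x ∷ v)
    go -[1+ k ] eq _ = inj₂ ( trans (*-congʳ (reflexive (≡.cong qeT eq))) (zeroˡ _)
                            , trans (*-congʳ (reflexive (≡.cong eT eq))) (zeroˡ _) )
    go (+ k) eq (inj₂ (z₁ , z₂)) = inj₂ (trans (*-congˡ z₁) (zeroʳ _) , trans (*-congˡ z₂) (zeroʳ _))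
    go (+ k) eq (inj₁ (m , tot , pr)) = inj₁ (k ℕ.+ m , total eq tot , (begin
      qeT (x ℤ.- + suc n) * prod (cols qeT n) v
        ≈⟨ *-cong (reflexive (≡.cong qeT eq)) pr ⟩
      (q ^ k * eT (+ k)) * (q ^ m * prod (cols eT n) v)
        ≈⟨ solve 4 (λ a b c d → (a :* b) :* (c :* d) := (a :* c) :* (b :* d)) refl _ _ _ _ ⟩
      (q ^ k * q ^ m) * (eT (+ k) * prod (cols eT n) v)
        ≈⟨ *-cong (sym (^-homo-* q k m)) (*-congʳ (reflexive (≡.cong eT (≡.sym eq)))) ⟩
      q ^ (k ℕ.+ m) * (eT (x ℤ.- + suc n) * prod (cols eT n) v) ∎))

  Alt-cong-on : ∀ {φ φ′ : Fun n} β → Positive β → (∀ v → Positive v → ∣ v ∣ ≡ ∣ β ∣ → φ v ≈ φ′ v) → Alt φ β ≈ Alt φ′ β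
  Alt-cong-on {zero}  []  pos eq = eq [] [] ≡.refl
  Alt-cong-on {suc n} β pos eq = pickSum-cong-on β pos λ { x γ (p ∷ pos′) e → Alt-cong-on γ pos′
    λ v posv ev → eq (x ∷ v) (p ∷ posv) (≡.trans (≡.cong (ℤ._+_ x) ev) e) }

  -- All rearrangements of β have the same total, so they share the exponent m, and q^m leaves the
  -- determinant.
  det-qe : ∀ n β m → Positive β → ∣ β ∣ ≡ triangle n ℤ.+ + m → det (cols qeT n) β ≈ q ^ m * D β
  det-qe n β m pos tot = trans (Alt-cong-on β pos same) (Alt-* (q ^ m) (prod (cols eT n)) β)
    where
    same : ∀ v → Positive v → ∣ v ∣ ≡ ∣ β ∣ → prod (cols qeT n) v ≈ q ^ m * prod (cols eT n) v
    same v _ ev with prod-qe n v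
    ... | inj₂ (z₁ , z₂) = trans z₁ (sym (trans (*-congˡ z₂) (zeroʳ _)))
    ... | inj₁ (m′ , tot′ , pr) = trans pr (*-congʳ (reflexive (≡.cong (q ^_)
            (ℤ.+-injective (∙-cancelˡ (triangle n) (+ m′) (+ m) (≡.trans (≡.sym tot′) (≡.trans ev tot)))))))
      where open import Algebra.Properties.AbelianGroup ℤ.+-0-abelianGroup using (∙-cancelˡ)

  -- Since q^k eₖ = eₖ₊₁ - q^(k+1) eₖ₊₁, the column Q n l is the next column of D up
  -- to Q n (l + 1).
  Q : ℕ → ℕ → Column
  Q n l x = qeT ((x ℤ.- + suc (suc n)) ℤ.+ + l)

  det-Q-step : ∀ n l β → det (Q n l ∷ cols eT n) β ≈
    det ((λ x → eT ((x ℤ.- + suc (suc n)) ℤ.+ + suc l)) ∷ cols eT n) β - det (Q n (suc l) ∷ cols eT n) β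
  det-Q-step n l β = trans
    (det-cong₁ (cols eT n) β (λ x → trans (e-q T q^T≈0 ((x ℤ.- + suc (suc n)) ℤ.+ + l)) (trans
      (reflexive (≡.cong (λ y → eT y - qeT y) (eq (x ℤ.- + suc (suc n)) (+ l)))) (+-congˡ (sym (-1*x≈-x _))))))
    (trans (det-linear₁ (- 1#) (λ x → eT ((x ℤ.- + suc (suc n)) ℤ.+ + suc l)) (Q n (suc l)) (cols eT n) β) (+-congˡ (-1*x≈-x _)))
    where
    eq : ∀ x l → 1ℤ ℤ.+ (x ℤ.+ l) ≡ x ℤ.+ (1ℤ ℤ.+ l)
    eq = solve-∀

  cols-member : ∀ (c : Column) n j → 1 ℕ.≤ j → j ℕ.≤ n → ∀ (d : Column) → (∀ x → d x ≈ c (x ℤ.- + j)) → Any (λ f → ∀ x → d x ≈ f x) (cols c n)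
  cols-member c zero    (suc j) _   ()
  cols-member c (suc n) j 1≤j j≤n d eq with ℕ.m≤n⇒m<n∨m≡n j≤n
  ... | inj₂ ≡.refl    = here eq
  ... | inj₁ (s≤s j≤n′) = there (cols-member c n j 1≤j j≤n′ d eq)

  -- Passing from one l to the next changes the sign: within this range the e column produced by
  -- `det-Q-step` repeats one of `cols eT n`. The chain starts at `det-qe-first`.
  det-Q : ∀ n l β → l ℕ.≤ n → det (Q n (suc l) ∷ cols eT n) β ≈ (- 1#) ^ l * det (cols qeT (suc n)) β
  det-Q n zero β _ = trans (det-cong₁ (cols eT n) β (λ x → reflexive (≡.cong qeT (eq x (+ n)))))
    (trans (det-qe-first n β) (sym (*-identityˡ _)))
    where
    eq : ∀ x n → (x ℤ.- (1ℤ ℤ.+ (1ℤ ℤ.+ n))) ℤ.+ 1ℤ ≡ x ℤ.- (1ℤ ℤ.+ n)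
    eq = solve-∀
  det-Q (suc n) (suc l) β (s≤s l≤n) = begin
    det (Q (suc n) (2 ℕ.+ l) ∷ cols eT (suc n)) β
      ≈⟨ solve 2 (λ a b → b := :- ((a :- b) :- a)) refl S (det (Q (suc n) (2 ℕ.+ l) ∷ cols eT (suc n)) β) ⟩
    - ((S - det (Q (suc n) (2 ℕ.+ l) ∷ cols eT (suc n)) β) - S)
      ≈⟨ -‿cong (+-cong (sym (det-Q-step (suc n) (suc l) β)) (-‿cong member)) ⟩
    - (det (Q (suc n) (suc l) ∷ cols eT (suc n)) β - 0#)
      ≈⟨ -‿cong (+-congʳ (det-Q (suc n) l β (ℕ.m≤n⇒m≤1+n l≤n))) ⟩
    - ((- 1#) ^ l * det (cols qeT (2 ℕ.+ n)) β - 0#)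
      ≈⟨ solve 2 (λ p x → :- (p :* x :- :0) := ((:- :1) :* p) :* x) refl _ _ ⟩
    (- 1#) ^ suc l * det (cols qeT (2 ℕ.+ n)) β ∎
    where
    c : Column
    c x = eT ((x ℤ.- + suc (suc (suc n))) ℤ.+ + suc (suc l))
    S = det (c ∷ cols eT (suc n)) β
    j = suc n ℕ.∸ l
    offset : + suc (suc (suc n)) ≡ + j ℤ.+ + suc (suc l)
    offset = ≡.cong +_ (≡.sym (≡.trans (ℕ.+-suc j (suc l)) (≡.cong suc (≡.trans (ℕ.+-suc j l) (≡.cong suc (ℕ.m∸n+n≡m (ℕ.m≤n⇒m≤1+n l≤n)))))))
    eq : ∀ x j l → (x ℤ.- (j ℤ.+ l)) ℤ.+ l ≡ x ℤ.- j
    eq = solve-∀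
    member : S ≈ 0#
    member = det-member c (cols eT (suc n)) β (cols-member eT (suc n) j
      (ℕ.m<n⇒0<n∸m (s≤s l≤n)) (ℕ.m∸n≤m (suc n) l) c
      (λ x → reflexive (≡.cong eT (≡.trans (≡.cong (λ o → (x ℤ.- o) ℤ.+ + suc (suc l)) offset) (eq x (+ j) (+ suc (suc l)))))))

  -- Here the e column is no repetition: it is the first column that `cols eT n` lacks to become the
  -- matrix of D in size n + 1.
  det-Q-zero : ∀ n β → det (Q n 0 ∷ cols eT n) β ≈ D β - det (cols qeT (suc n)) β
  det-Q-zero n β = trans (det-Q-step n 0 β) (+-cong
    (det-cong₁ (cols eT n) β (λ x → reflexive (≡.cong eT (eq x (+ n)))))
    (-‿cong (trans (det-Q n 0 β z≤n) (*-identityˡ _))))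
    where
    eq : ∀ x n → (x ℤ.- (1ℤ ℤ.+ (1ℤ ℤ.+ n))) ℤ.+ 1ℤ ≡ x ℤ.- (1ℤ ℤ.+ n)
    eq = solve-∀

i<j⇒i-j<0 : ∀ {i j} → i ℤ.< j → i ℤ.- j ℤ.< 0ℤ
i<j⇒i-j<0 {i} {j} i<j = ℤ.<-≤-trans (ℤ.+-monoˡ-< (ℤ.- j) i<j) (ℤ.≤-reflexive (ℤ.+-inverseʳ j))

-- The recursion for u in the number of variables and its solution

module JingMain (R : CommutativeRing 0ℓ 0ℓ) (q : CommutativeRing.Carrier R) (K : ℕ) (L : ℕ)
  (q^K≈0 : Nilpotent R q K) (K≤L : K ℕ.≤ L) where
  open Ring R
  open Alt R
  open Columns R
  open Raising R L
  open Euler R q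
  open Truncated R 0 using (_⊛_)
  open Jing R q K L q^K≈0 K≤L

  sum-δ₀-< : ∀ m j (f : ℕ → Carrier) → j ℕ.< m → sum (upTo m) (λ k → δ₀ (+ j ℤ.- + k) * f k) ≈ f j
  sum-δ₀-< (suc m) zero    f _ = trans (sum-upTo-suc m _) (trans
    (+-cong (*-identityˡ _) (sum-zero (upTo m) (λ k → zeroˡ _))) (+-identityʳ _))
  sum-δ₀-< (suc m) (suc j) f (s≤s j<m) = trans (sum-upTo-suc m _) (trans
    (+-cong (zeroˡ _) (trans (sum-cong (upTo m) (λ k → *-congʳ (reflexive (≡.cong δ₀ (eq (+ j) (+ k))))))
      (sum-δ₀-< m j (f ∘ suc) j<m))) (+-identityˡ _))
    where
    eq : ∀ j k → (1ℤ ℤ.+ j) ℤ.- (1ℤ ℤ.+ k) ≡ j ℤ.- k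
    eq = solve-∀

  sum-δ₀-≥ : ∀ m j (f : ℕ → Carrier) → m ℕ.≤ j → sum (upTo m) (λ k → δ₀ (+ j ℤ.- + k) * f k) ≈ 0#
  sum-δ₀-≥ zero    j       f _         = refl
  sum-δ₀-≥ (suc m) (suc j) f (s≤s m≤j) = trans (sum-upTo-suc m _) (trans
    (+-cong (zeroˡ _) (trans (sum-cong (upTo m) (λ k → *-congʳ (reflexive (≡.cong δ₀ (eq (+ j) (+ k))))))
      (sum-δ₀-≥ m j (f ∘ suc) m≤j))) (+-identityˡ _))
    where
    eq : ∀ j k → (1ℤ ℤ.+ j) ℤ.- (1ℤ ℤ.+ k) ≡ j ℤ.- k
    eq = solve-∀

  -- Either k = m occurs in the sum or `qeT m` is 0: for m < 0 by definition, for m ≥ L ≥ K because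
  -- q^m vanishes.
  sum-δ₀-qe : ∀ m (h : ℤ → Carrier) → sum (upTo L) (λ k → δ₀ (m ℤ.- + k) * (qeT (+ k) * h (+ k))) ≈ qeT m * h m
  sum-δ₀-qe -[1+ j ] h = trans (sum-zero (upTo L) λ { zero → zeroˡ _ ; (suc k) → zeroˡ _ }) (sym (zeroˡ _))
  sum-δ₀-qe (+ j)    h with j ℕ.<? L
  ... | yes j<L = sum-δ₀-< L j (λ k → qeT (+ k) * h (+ k)) j<L
  ... | no  j≮L = trans (sum-δ₀-≥ L j _ (ℕ.≮⇒≥ j≮L))
                    (sym (trans (*-congʳ (qe-big K T j q^K≈0 (ℕ.≤-trans K≤L (ℕ.≮⇒≥ j≮L)))) (zeroˡ _)))

  -- χ₀ is the closed form in n variables without its determinant, together with the condition that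
  -- the exponent of x₁ is used up. χ₁ is what the inner raising, from the factors (1 - q/(x₁xⱼ))⁻¹,
  -- makes of χ₀.
  χ₀ χ₁ : ℕ → ℤ → ℤ → Carrier
  χ₀ n b d = δ₀ b * (pochhammer n * double (twist g) (+ n ℤ.+ triangle n ℤ.- d))
  χ₁ n b d = sum (upTo L) (λ l → (q ^ l * χ₀ n (b ℤ.- -1ℤ ℤ.* + l) (d ℤ.+ + l)) * eT (+ l))

  χ₀-support : ∀ n b d → triangle n ℤ.+ + n ℤ.< d → χ₀ n b d ≈ 0#
  χ₀-support n b d lt = trans (*-congˡ (trans (*-congˡ (double-neg (twist g)
    (i<j⇒i-j<0 (ℤ.≤-<-trans (ℤ.≤-reflexive (ℤ.+-comm (+ n) (triangle n))) lt)))) (zeroʳ _))) (zeroʳ _)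

  χ₁-support : ∀ n b d → triangle n ℤ.+ + n ℤ.< d → χ₁ n b d ≈ 0#
  χ₁-support n b d lt = sum-zero (upTo L) λ l → trans (*-congʳ (trans (*-congˡ
    (χ₀-support n (b ℤ.- -1ℤ ℤ.* + l) (d ℤ.+ + l) (ℤ.<-≤-trans lt (ℤ.i≤i+j d (+ l))))) (zeroʳ _))) (zeroˡ _)

  -- The operators that split off x₁ are symmetric in the other variables, so antisymmetrisation
  -- passes through them to the induction hypothesis. `raise-eT` then evaluates the two raisings
  -- from the inside out.
  peel : ∀ n → triangle n ℤ.+ + n ℤ.< + L → (∀ v → Positive v → U n v ≈ closedU n v) →
    ∀ b γ → Positive γ → Alt (λ v → F (suc n) (b ∷ unshift v)) γ ≈
      D γ * sum (upTo L) (λ k → (q ^ k * χ₁ n (b ℤ.- 1ℤ ℤ.* + k) (∣ γ ∣ ℤ.+ + k)) * eT (+ k))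
  peel n small IH b γ pos = begin
    Alt (λ v → Tens ↑ (Tens ↓ Ψ) b (unshift v)) γ
      ≈⟨ Alt-cong γ (λ v → trans (Tens-unshift ↑ (Tens ↓ Ψ) b v) (Tens-cong ↑ b v (λ b v → Tens-unshift ↓ Ψ b v))) ⟩
    Alt (Tens ↑ (Tens ↓ Ψ′) b) γ
      ≈⟨ trans (Alt-Tens ↑ (Tens ↓ Ψ′) b γ) (Tens-cong ↑ b γ (λ b v → trans (Alt-Tens ↓ Ψ′ b v)
           (Tens-cong ↓ b v (λ b v → Alt-* (δ₀ b) _ v)))) ⟩
    Tens ↑ (Tens ↓ (λ b v → δ₀ b * U n v)) b γ
      ≈⟨ raise-cong q 1ℤ b γ pos (λ b v pos → trans (raise-cong q -1ℤ b v pos (λ b v pos → trans (*-congˡ (IH v pos))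
             (solve 3 (λ a b c → a :* (b :* c) := b :* (a :* c)) refl (δ₀ b) (D v) _)))
           (raise-eT q -1ℤ (χ₀ n) b v pos small (λ k lt → χ₀-support n (b ℤ.- -1ℤ ℤ.* + k) _ lt))) ⟩
    Tens ↑ (λ b v → D v * χ₁ n b ∣ v ∣) b γ
      ≈⟨ raise-eT q 1ℤ (χ₁ n) b γ pos small (λ k lt → χ₁-support n (b ℤ.- 1ℤ ℤ.* + k) _ lt) ⟩
    D γ * sum (upTo L) (λ k → (q ^ k * χ₁ n (b ℤ.- 1ℤ ℤ.* + k) (∣ γ ∣ ℤ.+ + k)) * eT (+ k)) ∎
    where
    ↑ = raise q 1ℤ
    ↓ = raise q -1ℤ
    Ψ Ψ′ : ℤ → Fun n
    Ψ b v  = δ₀ b * F n v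
    Ψ′ b v = δ₀ b * F n (unshift v)

  excess : ∀ n → ℤ → ℤ
  excess n s = + n ℤ.+ triangle n ℤ.- s

  A : ℤ → ℕ → Carrier
  A z l = (q ^ l * eT (+ l)) * double (twist g) (z ℤ.- (+ l ℤ.+ + l))

  -- Using up the exponent of x₁ forces k = x - (n + 2) + l, which turns the factor q^k eₖ of the
  -- outer raising into the column `Q n l`.
  collapse : ∀ n x s → sum (upTo L) (λ k → (q ^ k * χ₁ n ((x ℤ.- + suc (suc n)) ℤ.- 1ℤ ℤ.* + k) (s ℤ.+ + k)) * eT (+ k)) ≈
    sum (upTo L) (λ l → Q n l x * (pochhammer n * A (excess (suc n) (x ℤ.+ s)) l))
  collapse n x s = begin
    sum (upTo L) (λ k → (q ^ k * χ₁ n (b ℤ.- 1ℤ ℤ.* + k) (s ℤ.+ + k)) * eT (+ k))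
      ≈⟨ sum-cong (upTo L) (λ k → trans (solve 3 (λ a b c → (a :* b) :* c := (a :* c) :* b) refl _ _ _) (sum-* _ (upTo L) _)) ⟩
    sum (upTo L) (λ k → sum (upTo L) (λ l → (q ^ k * eT (+ k)) * ((q ^ l * χ₀ n ((b ℤ.- 1ℤ ℤ.* + k) ℤ.- -1ℤ ℤ.* + l) ((s ℤ.+ + k) ℤ.+ + l)) * eT (+ l))))
      ≈⟨ sum-swap (upTo L) (upTo L) _ ⟩
    sum (upTo L) (λ l → sum (upTo L) (λ k → (q ^ k * eT (+ k)) * ((q ^ l * χ₀ n ((b ℤ.- 1ℤ ℤ.* + k) ℤ.- -1ℤ ℤ.* + l) ((s ℤ.+ + k) ℤ.+ + l)) * eT (+ l))))
      ≈⟨ sum-cong (upTo L) (λ l → trans (sum-cong (upTo L) (λ k → trans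
           (*-congˡ (*-congʳ (*-congˡ (*-congʳ (reflexive (≡.cong δ₀ (eq₁ b (+ k) (+ l))))))))
           (solve 6 (λ k l δ p d e → k :* ((l :* (δ :* (p :* d))) :* e) := δ :* (k :* (p :* ((l :* e) :* d)))) refl
             (q ^ k * eT (+ k)) (q ^ l) (δ₀ ((b ℤ.+ + l) ℤ.- + k)) (pochhammer n) _ (eT (+ l)))))
           (sum-δ₀-qe (b ℤ.+ + l) (h l))) ⟩
    sum (upTo L) (λ l → qeT (b ℤ.+ + l) * h l (b ℤ.+ + l))
      ≈⟨ sum-cong (upTo L) (λ l → *-congˡ (*-congˡ (*-congˡ (reflexive (≡.cong (double (twist g)) (eq₂ (+ n) (triangle n) s x (+ l))))))) ⟩
    sum (upTo L) (λ l → Q n l x * (pochhammer n * A (excess (suc n) (x ℤ.+ s)) l)) ∎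
    where
    b = x ℤ.- + suc (suc n)
    h : ℕ → ℤ → Carrier
    h l k = pochhammer n * ((q ^ l * eT (+ l)) * double (twist g) (+ n ℤ.+ triangle n ℤ.- ((s ℤ.+ k) ℤ.+ + l)))
    eq₁ : ∀ b k l → (b ℤ.- 1ℤ ℤ.* k) ℤ.- -1ℤ ℤ.* l ≡ (b ℤ.+ l) ℤ.- k
    eq₁ = solve-∀
    eq₂ : ∀ n t s x l → n ℤ.+ t ℤ.- ((s ℤ.+ ((x ℤ.- (1ℤ ℤ.+ (1ℤ ℤ.+ n))) ℤ.+ l)) ℤ.+ l) ≡
      (1ℤ ℤ.+ n) ℤ.+ ((1ℤ ℤ.+ n) ℤ.+ t) ℤ.- (x ℤ.+ s) ℤ.- (l ℤ.+ l)
    eq₂ = solve-∀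

  -- The weights depend on the picked entry x and the rest γ only through x + ∣ γ ∣ = ∣ β ∣. What
  -- remains of the sum over x is the expansion of a determinant along its first column.
  U-suc : ∀ n → triangle n ℤ.+ + n ℤ.< + L → (∀ v → Positive v → U n v ≈ closedU n v) → ∀ β → Positive β →
    U (suc n) β ≈ sum (upTo L) (λ l → (pochhammer n * A (excess (suc n) ∣ β ∣) l) * det (Q n l ∷ cols eT n) β)
  U-suc n small IH β pos = begin
    U (suc n) β
      ≈⟨ pickSum-cong-on β pos step ⟩
    pickSum (λ x γ → sum (upTo L) (λ l → B l * (Q n l x * D γ))) β
      ≈⟨ pickSum-sum (upTo L) (λ l x γ → B l * (Q n l x * D γ)) β ⟩
    sum (upTo L) (λ l → pickSum (λ x γ → B l * (Q n l x * D γ)) β)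
      ≈⟨ sum-cong (upTo L) (λ l → trans (pickSum-* (B l) (λ x γ → Q n l x * D γ) β) (*-congˡ (sym (det-∷ (Q n l) (cols eT n) β)))) ⟩
    sum (upTo L) (λ l → B l * det (Q n l ∷ cols eT n) β) ∎
    where
    B : ℕ → Carrier
    B l = pochhammer n * A (excess (suc n) ∣ β ∣) l
    step : ∀ x γ → Positive (x ∷ γ) → x ℤ.+ ∣ γ ∣ ≡ ∣ β ∣ →
      Alt (λ v → F (suc n) (unshift (x ∷ v))) γ ≈ sum (upTo L) (λ l → B l * (Q n l x * D γ))
    step x γ (_ ∷ posγ) tot = trans (peel n small IH (x ℤ.- + suc (suc n)) γ posγ)
      (trans (*-congˡ (collapse n x ∣ γ ∣))
      (trans (sum-* (D γ) (upTo L) _)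
      (sum-cong (upTo L) (λ l → trans
        (solve 3 (λ d q b → d :* (q :* b) := b :* (q :* d)) refl (D γ) (Q n l x) _)
        (*-congʳ (*-congˡ (reflexive (≡.cong (λ s → A (excess (suc n) s) l) tot))))))))

  module Evaluate (n : ℕ) (β : Vec ℤ (suc n)) (d m : ℕ) (pos : Positive β) (d≤1+n : d ℕ.≤ suc n) (m+d≡1+n : m ℕ.+ d ≡ suc n)
    (tot : ∣ β ∣ ≡ triangle (suc n) ℤ.+ + m) (d<L : d ℕ.< L) where
    P = det (cols qeT (suc n)) β
    S : ℕ → Carrier
    S = twist (signed 1# T)
    dbl : ℕ → Carrier
    dbl l = double (twist g) (+ d ℤ.- (+ l ℤ.+ + l))

    -- The determinants are D - P for l = 0 and P up to sign for the other relevant l. This is the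
    -- lone D; the multiples of P, including the one at l = 0, form a convolution.
    first : ℕ → Carrier
    first zero    = double (twist g) (+ d) * D β
    first (suc l) = 0#

    dbl-big : ∀ l → suc n ℕ.< suc l → dbl (suc l) ≈ 0#
    dbl-big l lt = double-neg (twist g) (i<j⇒i-j<0 (ℤ.+<+ (ℕ.≤-<-trans d≤1+n (ℕ.<-≤-trans lt (ℕ.m≤m+n (suc l) (suc l))))))

    term : ∀ l → A (+ d) l * det (Q n l ∷ cols eT n) β ≈ first l + (- P) * (S l * dbl l)
    term zero = trans (*-congˡ (det-Q-zero n β)) (trans
      (solve 3 (λ x D P → ((:1 :* :1) :* x) :* (D :- P) := x :* D :+ (:- P) :* ((:1 :* (:1 :* :1)) :* x)) refl (dbl 0) (D β) P)
      (+-congʳ (*-congʳ (reflexive (≡.cong (double (twist g)) (ℤ.+-identityʳ (+ d)))))))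
    term (suc l) with l ℕ.≤? n
    ... | yes l≤n = trans (*-congˡ (det-Q n l β l≤n))
      (solve 5 (λ q e x s P → ((q :* e) :* x) :* (s :* P) := :0 :+ (:- P) :* ((q :* (((:- :1) :* s) :* e)) :* x)) refl
        (q ^ suc l) (eT (+ suc l)) (dbl (suc l)) ((- 1#) ^ l) P)
    ... | no  l≰n = trans (*-congʳ (trans (*-congˡ (dbl-big l (s≤s (ℕ.≰⇒> l≰n)))) (zeroʳ _))) (trans (zeroˡ _)
      (sym (trans (+-identityˡ _) (trans (*-congˡ (trans (*-congˡ (dbl-big l (s≤s (ℕ.≰⇒> l≰n)))) (zeroʳ _))) (zeroʳ _)))))

    sum-first : ∀ k → 0 ℕ.< k → sum (upTo k) first ≈ first 0
    sum-first (suc k) _ = trans (sum-upTo-suc k first) (trans (+-congˡ (sum-zero (upTo k) (λ _ → refl))) (+-identityʳ _))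

    convolution : sum (upTo L) (λ l → S l * dbl l) ≈ double (dilate (twist g)) (+ d)
    convolution = trans (double-convolution S (twist g) d L d<L) (double-cong (+ d) λ k → begin
      (S ⊛ twist g) k                        ≈⟨ twist-⊛ (signed 1# T) g k ⟩
      twist (signed 1# T ⊛ g) k              ≈⟨ *-congˡ (signed-dilate-stable K q^K≈0 k) ⟩
      q ^ k * (q ^ (k ℕ.+ k) * g k)          ≈⟨ solve 3 (λ a b c → a :* (b :* c) := b :* (a :* c)) refl _ _ _ ⟩
      dilate (twist g) k                     ∎)

    evaluate : sum (upTo L) (λ l → (pochhammer n * A (+ d) l) * det (Q n l ∷ cols eT n) β) ≈
      D β * (pochhammer (suc n) * double (twist g) (+ d))
    evaluate = begin
      sum (upTo L) (λ l → (pochhammer n * A (+ d) l) * det (Q n l ∷ cols eT n) β)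
        ≈⟨ trans (sum-cong (upTo L) (λ l → *-assoc _ _ _)) (sym (sum-* (pochhammer n) (upTo L) _)) ⟩
      pochhammer n * sum (upTo L) (λ l → A (+ d) l * det (Q n l ∷ cols eT n) β)
        ≈⟨ *-congˡ (trans (sum-cong (upTo L) term) (trans (sum-+ (upTo L) first _)
             (+-cong (sum-first L (ℕ.≤-<-trans z≤n d<L)) (trans (sym (sum-* (- P) (upTo L) _)) (*-congˡ convolution))))) ⟩
      pochhammer n * (x * D β + (- P) * double (dilate (twist g)) (+ d))
        -- P contributes q^m and the dilation q^d. As m + d = n + 1, this produces the new factor 1
        -- - q^(n+1) of `pochhammer`.
        ≈⟨ *-congˡ (+-congˡ (trans (*-congʳ (-‿cong (det-qe (suc n) β m pos tot)))
             (trans (solve 3 (λ a b c → (:- (a :* b)) :* c := (:- b) :* (a :* c)) refl (q ^ m) (D β) _)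
               (*-congˡ (trans (double-dilate m (twist g) d) (*-congʳ (reflexive (≡.cong (q ^_) m+d≡1+n)))))))) ⟩
      pochhammer n * (x * D β + (- D β) * (q ^ suc n * x))
        ≈⟨ solve 4 (λ p x D s → p :* (x :* D :+ (:- D) :* (s :* x)) := D :* ((p :* (:1 :- s)) :* x)) refl (pochhammer n) x (D β) (q ^ suc n) ⟩
      D β * (pochhammer (suc n) * x) ∎
      where x = double (twist g) (+ d)

  -- With β = λ + ρ, both sides vanish if ∣ λ ∣ > n + 1. Otherwise d = n + 1 - ∣ λ ∣ is natural, and
  -- `decreasing-bound` yields d ≤ n + 1, so that ∣ λ ∣ is natural too.
  U-suc-closed : ∀ n β → Positive β → Decreasing β → triangle (suc n) ℤ.+ + suc n ℤ.< + L →
    sum (upTo L) (λ l → (pochhammer n * A (excess (suc n) ∣ β ∣) l) * det (Q n l ∷ cols eT n) β) ≈ closedU (suc n) β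
  U-suc-closed n β pos dec small = go (excess (suc n) ∣ β ∣) ≡.refl
    where
    go : ∀ z → excess (suc n) ∣ β ∣ ≡ z →
      sum (upTo L) (λ l → (pochhammer n * A (excess (suc n) ∣ β ∣) l) * det (Q n l ∷ cols eT n) β) ≈ closedU (suc n) β
    go -[1+ k ] eq = trans
      (sum-zero (upTo L) (λ l → trans (*-congʳ (trans (*-congˡ (trans (*-congˡ
        (double-neg (twist g) (ℤ.≤-<-trans (ℤ.i-j≤i (excess (suc n) ∣ β ∣) (+ l ℤ.+ + l)) (≡.subst (ℤ._< 0ℤ) (≡.sym eq) ℤ.-<+)))) (zeroʳ _))) (zeroʳ _))) (zeroˡ _)))
      (sym (trans (*-congˡ (trans (*-congˡ (double-neg (twist g) (≡.subst (ℤ._< 0ℤ) (≡.sym eq) ℤ.-<+))) (zeroʳ _))) (zeroʳ _)))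
    go (+ d) eq = ≡.subst (λ z → sum (upTo L) (λ l → (pochhammer n * A z l) * det (Q n l ∷ cols eT n) β) ≈ D β * (pochhammer (suc n) * double (twist g) z)) (≡.sym eq)
      (Evaluate.evaluate n β d gap pos d≤1+n (ℕ.m∸n+n≡m d≤1+n) tot d<L)
      where
      gap = suc n ℕ.∸ d
      d≤1+n : d ℕ.≤ suc n
      d≤1+n = ℤ.drop‿+≤+ (≡.subst (ℤ._≤ + suc n) eq (ℤ.≤-trans
        (ℤ.+-monoʳ-≤ (+ suc n ℤ.+ triangle (suc n)) (ℤ.neg-mono-≤ (decreasing-bound 0ℤ dec pos)))
        (ℤ.≤-reflexive (cancel (+ suc n) (triangle (suc n))))))
        where
        cancel : ∀ n t → n ℤ.+ t ℤ.- (n ℤ.* 0ℤ ℤ.+ t) ≡ n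
        cancel = solve-∀
      tot : ∣ β ∣ ≡ triangle (suc n) ℤ.+ + gap
      tot = ≡.trans (rearrange (+ suc n) (triangle (suc n)) ∣ β ∣) (≡.cong (ℤ._+_ (triangle (suc n)))
        (≡.trans (≡.cong (λ z → + suc n ℤ.- z) eq) (≡.trans (ℤ.m-n≡m⊖n (suc n) d) (ℤ.⊖-≥ d≤1+n))))
        where
        rearrange : ∀ n t s → s ≡ t ℤ.+ (n ℤ.- (n ℤ.+ t ℤ.- s))
        rearrange = solve-∀
      d<L : d ℕ.< L
      d<L = ℕ.≤-<-trans d≤1+n (ℤ.drop‿+<+ (ℤ.≤-<-trans (ℤ.≤-trans (ℤ.≤-reflexive (≡.sym (ℤ.+-identityˡ (+ suc n))))
        (ℤ.+-monoˡ-≤ (+ suc n) (triangle-nonneg (suc n)))) small))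
        where
        triangle-nonneg : ∀ n → 0ℤ ℤ.≤ triangle n
        triangle-nonneg zero    = ℤ.≤-refl
        triangle-nonneg (suc n) = ℤ.+-mono-≤ {0ℤ} (ℤ.+≤+ z≤n) (triangle-nonneg n)

  triangle-mono : ∀ n → triangle n ℤ.+ + n ℤ.≤ triangle (suc n) ℤ.+ + suc n
  triangle-mono n = ℤ.+-mono-≤ (ℤ.≤-trans (ℤ.≤-reflexive (≡.sym (ℤ.+-identityˡ (triangle n))))
    (ℤ.+-monoˡ-≤ (triangle n) {0ℤ} {+ suc n} (ℤ.+≤+ z≤n))) (ℤ.+≤+ (ℕ.n≤1+n n))

  closedU-swap : ∀ {v w : Vec ℤ n} → Swap v w → closedU n v ≈ - closedU n w
  closedU-swap {n} {v} {w} s = trans (*-cong (swap (Alt-alternating (prod (cols eT n))) s)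
    (*-congˡ (reflexive (≡.cong (λ t → double (twist g) (+ n ℤ.+ triangle n ℤ.- t)) (Swap-∣∣ s)))))
    (sym (-‿distribˡ-* _ _))

  U≈closedU : ∀ n → triangle n ℤ.+ + n ℤ.< + L → ∀ β → Positive β → U n β ≈ closedU n β
  U≈closedU zero small [] pos = sym (trans (*-identityˡ _) (trans (*-identityˡ _) (trans (*-identityˡ _) (reflexive (pairProduct-at-0 T)))))
  U≈closedU (suc n) small = sort-induction (λ β → Positive β → U (suc n) β ≈ closedU (suc n) β)
    (λ s P pos → trans (swap U-alternating s) (trans (-‿cong (P (Swap-All s pos))) (sym (closedU-swap s))))
    (λ r pos → trans (repeats U-alternating r) (sym (trans (*-congʳ (repeats (Alt-alternating (prod (cols eT (suc n)))) r)) (zeroˡ _))))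
    (λ {β} dec pos → trans (U-suc n small′ (U≈closedU n small′) β pos) (U-suc-closed n β pos dec small))
    where
    small′ = ℤ.≤-<-trans (triangle-mono n) small
    U-alternating = Alt-alternating (λ v → F (suc n) (unshift v))

-- Paths of partitions

bump : Fin n → ℤ → Vec ℤ n → Vec ℤ n
bump zero    d (x ∷ v) = x ℤ.+ d ∷ v
bump (suc r) d (x ∷ v) = x ∷ bump r d v

move unmove : Letter n → Vec ℤ n → Vec ℤ n
move (plain r)   = bump r 1ℤ
move (bar r)     = bump r -1ℤ
unmove (plain r) = bump r -1ℤ
unmove (bar r)   = bump r 1ℤ

bump-inverse : ∀ r d (v : Vec ℤ n) → bump r d (bump r (ℤ.- d) v) ≡ v
bump-inverse zero    d (x ∷ v) = ≡.cong (_∷ v) (eq x d)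
  where
  eq : ∀ x d → (x ℤ.+ ℤ.- d) ℤ.+ d ≡ x
  eq = solve-∀
bump-inverse (suc r) d (x ∷ v) = ≡.cong (x ∷_) (bump-inverse r d v)

move-unmove : ∀ x (v : Vec ℤ n) → move x (unmove x v) ≡ v
move-unmove (plain r) v = bump-inverse r 1ℤ v
move-unmove (bar r)   v = bump-inverse r -1ℤ v

unmove-move : ∀ x (v : Vec ℤ n) → unmove x (move x v) ≡ v
unmove-move (plain r) v = bump-inverse r -1ℤ v
unmove-move (bar r)   v = bump-inverse r 1ℤ v

bump-⊕ : ∀ r d (v w : Vec ℤ n) → bump r d v ⊕ w ≡ bump r d (v ⊕ w)
bump-⊕ zero    d (x ∷ v) (y ∷ w) = ≡.cong (_∷ (v ⊕ w)) (eq x y d)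
  where
  eq : ∀ x y d → (x ℤ.+ d) ℤ.+ y ≡ (x ℤ.+ y) ℤ.+ d
  eq = solve-∀
bump-⊕ (suc r) d (x ∷ v) (y ∷ w) = ≡.cong (x ℤ.+ y ∷_) (bump-⊕ r d v w)

-- Where β = λ + ρ fails to be strictly decreasing and positive after its r-th
-- entry has been lowered (Clash⁻) or raised (Clash⁺).
data Clash⁻ : Fin n → Vec ℤ n → Set where
  last  : Clash⁻ zero (0ℤ ∷ [])
  here  : ∀ {x} {v : Vec ℤ n} → Clash⁻ zero (x ∷ x ∷ v)
  there : ∀ {r z} {v : Vec ℤ n} → Clash⁻ r v → Clash⁻ (suc r) (z ∷ v)

data Clash⁺ : Fin n → Vec ℤ n → Set where
  here  : ∀ {x} {v : Vec ℤ n} → Clash⁺ (suc zero) (x ∷ x ∷ v)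
  there : ∀ {r z} {v : Vec ℤ n} → Clash⁺ r v → Clash⁺ (suc r) (z ∷ v)

Clash⁻-bump : ∀ {r s} d {v : Vec ℤ n} → r Fin.< s → Clash⁻ s v → Clash⁻ s (bump r d v)
Clash⁻-bump {r = zero}  d _         (there c) = there c
Clash⁻-bump {r = suc r} d (s≤s r<s) (there c) = there (Clash⁻-bump d r<s c)

-- Here the clash involves the entries s - 1 and s and survives changes at r > s, which suits the
-- order n̄ < ⋯ < 1̄.
Clash⁺-bump : ∀ {r s} d {v : Vec ℤ n} → s Fin.< r → Clash⁺ s v → Clash⁺ s (bump r d v)
Clash⁺-bump {r = suc zero}    d (s≤s ()) here
Clash⁺-bump {r = suc (suc r)} d _         here      = here
Clash⁺-bump {r = suc r}       d (s≤s s<r) (there c) = there (Clash⁺-bump d s<r c)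

partition-∷ : ∀ {x y} {v : Vec ℤ n} → y ℤ.≤ x → IsPartition (y ∷ v) → IsPartition (x ∷ y ∷ v)
partition-∷ y≤x (l , p ∷ ps) = y≤x ∷ l , ℤ.≤-trans p y≤x ∷ p ∷ ps

partition-tail : ∀ {x} {v : Vec ℤ n} → IsPartition (x ∷ v) → IsPartition v
partition-tail ([-]   , _ ∷ ps) = [] , ps
partition-tail (_ ∷ l , _ ∷ ps) = l , ps

-- After adding ρ, failing to be a partition becomes two equal neighbours or a last entry 0, and
-- these are zeros of the determinant.
lower : ∀ r (v : Vec ℤ n) → IsPartition v → IsPartition (bump r -1ℤ v) ⊎ Clash⁻ r (bump r -1ℤ v ⊕ ρ n)
lower zero (+ zero  ∷ []) part = inj₂ last
lower zero (+ suc x ∷ []) part = inj₁ ([-] , ℤ.+≤+ z≤n ∷ [])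
lower {suc (suc n)} zero (x ∷ y ∷ v) ((y≤x ∷ l) , (p ∷ ps)) with ℤ._≟_ y x
... | yes ≡.refl = inj₂ (≡.subst (λ z → Clash⁻ zero (z ∷ (y ℤ.+ + suc n) ∷ v ⊕ ρ n)) (eq y (+ n)) here)
  where
  eq : ∀ y n → y ℤ.+ (1ℤ ℤ.+ n) ≡ (y ℤ.+ -1ℤ) ℤ.+ (1ℤ ℤ.+ (1ℤ ℤ.+ n))
  eq = solve-∀
... | no y≢x = inj₁ (partition-∷ (ℤ.≤-trans (ℤ.i<j⇒i≤pred[j] (ℤ.≤∧≢⇒< y≤x y≢x)) (ℤ.≤-reflexive (ℤ.+-comm -1ℤ x))) (l , ps))
lower (suc r) (x ∷ v) part with lower r v (partition-tail part)
... | inj₂ c = inj₂ (there c)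
lower (suc zero) (x ∷ y ∷ v) ((y≤x ∷ _) , _) | inj₁ part′ = inj₁ (partition-∷ (ℤ.≤-trans (ℤ.i-j≤i y 1ℤ) y≤x) part′)
lower (suc (suc r)) (x ∷ y ∷ v) ((y≤x ∷ _) , _) | inj₁ part′ = inj₁ (partition-∷ y≤x part′)

heighten : ∀ r (v : Vec ℤ n) → IsPartition v → IsPartition (bump r 1ℤ v) ⊎ Clash⁺ r (bump r 1ℤ v ⊕ ρ n)
heighten zero (x ∷ []) (_ , p ∷ []) = inj₁ ([-] , ℤ.≤-trans p (ℤ.i≤i+j x 1ℤ) ∷ [])
heighten zero (x ∷ y ∷ v) ((y≤x ∷ l) , (p ∷ ps)) = inj₁ (partition-∷ (ℤ.≤-trans y≤x (ℤ.i≤i+j x 1ℤ)) (l , ps))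
heighten {suc (suc n)} (suc zero) (x ∷ y ∷ v) part@((y≤x ∷ _) , _) with heighten zero (y ∷ v) (partition-tail part)
... | inj₂ ()
... | inj₁ part′ with ℤ._≟_ y x
...   | yes ≡.refl = inj₂ (≡.subst (λ z → Clash⁺ (suc zero) (y ℤ.+ + suc (suc n) ∷ z ∷ v ⊕ ρ n)) (eq y (+ n)) here)
  where
  eq : ∀ y n → y ℤ.+ (1ℤ ℤ.+ (1ℤ ℤ.+ n)) ≡ (y ℤ.+ 1ℤ) ℤ.+ (1ℤ ℤ.+ n)
  eq = solve-∀
...   | no y≢x = inj₁ (partition-∷ (ℤ.≤-trans (ℤ.≤-reflexive (ℤ.+-comm y 1ℤ)) (ℤ.i<j⇒suc[i]≤j (ℤ.≤∧≢⇒< y≤x y≢x))) part′)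
heighten (suc (suc r)) (x ∷ y ∷ v) part@((y≤x ∷ _) , _) with heighten (suc r) (y ∷ v) (partition-tail part)
... | inj₂ c     = inj₂ (there c)
... | inj₁ part′ = inj₁ (partition-∷ y≤x part′)

partition-𝟘 : ∀ n → IsPartition (𝟘 {n})
partition-𝟘 zero          = [] , []
partition-𝟘 (suc zero)    = [-] , ℤ.≤-refl ∷ []
partition-𝟘 (suc (suc n)) = partition-∷ ℤ.≤-refl (partition-𝟘 (suc n))

partition⇒positive : (v : Vec ℤ n) → IsPartition v → Positive (v ⊕ ρ n)
partition⇒positive []      _             = []
partition⇒positive (x ∷ v) part@(_ , p ∷ _) = ℤ.+-mono-≤-< p (ℤ.+<+ (s≤s z≤n)) ∷ partition⇒positive v (partition-tail part)

ups downs : ∀ n → List (Fin n)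
ups zero      = []
ups (suc n)   = zero ∷ List.map suc (ups n)
downs zero    = []
downs (suc n) = List.map suc (downs n) ++ zero ∷ []

ups-increasing : ∀ n → AP.AllPairs Fin._<_ (ups n)
ups-increasing zero    = []
ups-increasing (suc n) = ListAll.map⁺ (ListAll.universal (λ _ → s≤s z≤n) (ups n)) ∷ AP.map⁺ (AP.map s≤s (ups-increasing n))

downs-decreasing : ∀ n → AP.AllPairs Fin._>_ (downs n)
downs-decreasing zero    = []
downs-decreasing (suc n) = AP.++⁺ (AP.map⁺ (AP.map s≤s (downs-decreasing n))) ([] ∷ [])
  (ListAll.map⁺ (ListAll.universal (λ _ → s≤s z≤n ∷ []) (downs n)))

-- Path counts and the admission of one more step

module Paths (R : CommutativeRing 0ℓ 0ℓ) (n : ℕ) where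
  open Ring R
  open Alt R

  -- For `run` the arguments are the number of letters still to be used and the partition reached so
  -- far; for a closed form they are the number of letters and β = λ + ρ.
  State : Set
  State = ℤ → Vec ℤ n → Carrier

  Step : Set
  Step = Carrier × Letter n

  -- A path may use the letter x at this step, at the price of the weight y.
  perform : Step → State → State
  perform (y , x) h j κ = h j κ + [ isPartition? (move x κ) ]∙ (y * h (j ℤ.- 1ℤ) (move x κ))

  run : List Step → State → State
  run []      h = h
  run (z ∷ Z) h = perform z (run Z h)

  run-++ : ∀ Z z h → run (Z ++ z ∷ []) h ≡ run Z (perform z h)
  run-++ []      z h = ≡.refl
  run-++ (z′ ∷ Z) z h = ≡.cong (perform z′) (run-++ Z z h)

  run-cong : ∀ Z {h h′} → (∀ j κ → h j κ ≈ h′ j κ) → ∀ j κ → run Z h j κ ≈ run Z h′ j κ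
  run-cong []            eq j κ = eq j κ
  run-cong ((y , x) ∷ Z) eq j κ = +-cong (run-cong Z eq j κ)
    ([]∙-cong (isPartition? (move x κ)) (*-congˡ (run-cong Z eq _ _)))

  run-+ : ∀ Z h h′ j κ → run Z (λ j κ → h j κ + h′ j κ) j κ ≈ run Z h j κ + run Z h′ j κ
  run-+ []            h h′ j κ = refl
  run-+ ((y , x) ∷ Z) h h′ j κ = trans
    (+-cong (run-+ Z h h′ j κ) (trans ([]∙-cong P? (trans (*-congˡ (run-+ Z h h′ _ _)) (distribˡ _ _ _))) ([]∙-+ P? _ _)))
    (solve 4 (λ a b c d → (a :+ b) :+ (c :+ d) := (a :+ c) :+ (b :+ d)) refl _ _ _ _)
    where P? = isPartition? (move x κ)

  run-* : ∀ Z c h j κ → run Z (λ j κ → c * h j κ) j κ ≈ c * run Z h j κ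
  run-* []            c h j κ = refl
  run-* ((y , x) ∷ Z) c h j κ = trans
    (+-cong (run-* Z c h j κ) (trans ([]∙-cong P? (trans (*-congˡ (run-* Z c h _ _))
      (solve 3 (λ a b c → a :* (b :* c) := b :* (a :* c)) refl _ _ _))) ([]∙-* P? c _)))
    (sym (distribˡ _ _ _))
    where P? = isPartition? (move x κ)

  run-translate : ∀ Z h j κ → run Z (λ j → h (j ℤ.- 1ℤ)) j κ ≈ run Z h (j ℤ.- 1ℤ) κ
  run-translate []            h j κ = refl
  run-translate ((y , x) ∷ Z) h j κ = +-cong (run-translate Z h j κ)
    ([]∙-cong (isPartition? (move x κ)) (*-congˡ (run-translate Z h _ _)))

  point : Vec ℤ n → State
  point lam j κ = [ j ℤ.≟ 0ℤ ]∙ ([ κ ≟ᵛ lam ]∙ 1#)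

  paths : List Step → State
  paths Z m lam = run Z (point lam) m 𝟘

  paths-nonpartition : ∀ Z m lam → ¬ IsPartition lam → paths Z m lam ≈ 0#
  paths-nonpartition Z m lam ¬p = go Z m 𝟘 (partition-𝟘 n)
    where
    go : ∀ Z j κ → IsPartition κ → run Z (point lam) j κ ≈ 0#
    go [] j κ p = trans ([]∙-cong (j ℤ.≟ 0ℤ) ([]∙-false (κ ≟ᵛ lam) 1# (λ { ≡.refl → ¬p p }))) ([]∙-zero (j ℤ.≟ 0ℤ))
    go ((y , x) ∷ Z) j κ p = trans (+-cong (go Z j κ p) second) (+-identityˡ _)
      where
      second : [ isPartition? (move x κ) ]∙ (y * run Z (point lam) (j ℤ.- 1ℤ) (move x κ)) ≈ 0#
      second = []∙-vanish (isPartition? (move x κ)) (λ p′ → trans (*-congˡ (go Z _ _ p′)) (zeroʳ y))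

  paths-snoc : ∀ Z y x m lam → IsPartition lam →
    paths (Z ++ (y , x) ∷ []) m lam ≈ paths Z m lam + y * paths Z (m ℤ.- 1ℤ) (unmove x lam)
  paths-snoc Z y x m lam part = begin
    run (Z ++ (y , x) ∷ []) (point lam) m 𝟘
      ≡⟨ ≡.cong (λ h → h m 𝟘) (run-++ Z (y , x) (point lam)) ⟩
    run Z (perform (y , x) (point lam)) m 𝟘
      ≈⟨ run-cong Z (λ j κ → +-congˡ (transfer j κ)) m 𝟘 ⟩
    run Z (λ j κ → point lam j κ + y * point (unmove x lam) (j ℤ.- 1ℤ) κ) m 𝟘
      ≈⟨ trans (run-+ Z (point lam) _ m 𝟘) (+-congˡ (trans (run-* Z y _ m 𝟘) (*-congˡ (run-translate Z (point (unmove x lam)) m 𝟘)))) ⟩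
    paths Z m lam + y * paths Z (m ℤ.- 1ℤ) (unmove x lam) ∎
    where
    transfer : ∀ j κ → [ isPartition? (move x κ) ]∙ (y * point lam (j ℤ.- 1ℤ) (move x κ)) ≈ y * point (unmove x lam) (j ℤ.- 1ℤ) κ
    transfer j κ with move x κ ≟ᵛ lam
    ... | yes ≡.refl = trans ([]∙-true (isPartition? (move x κ)) _ part) (*-congˡ ([]∙-cong ((j ℤ.- 1ℤ) ℤ.≟ 0ℤ)
            (sym ([]∙-true (κ ≟ᵛ unmove x (move x κ)) 1# (≡.sym (unmove-move x κ))))))
    ... | no ne = trans ([]∙-cong (isPartition? (move x κ)) (trans (*-congˡ ([]∙-zero ((j ℤ.- 1ℤ) ℤ.≟ 0ℤ))) (zeroʳ y)))
            (trans ([]∙-zero (isPartition? (move x κ))) (sym (trans (*-congˡ (trans ([]∙-cong ((j ℤ.- 1ℤ) ℤ.≟ 0ℤ)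
              ([]∙-false (κ ≟ᵛ unmove x lam) 1# (λ { ≡.refl → ne (move-unmove x lam) }))) ([]∙-zero ((j ℤ.- 1ℤ) ℤ.≟ 0ℤ)))) (zeroʳ y))))

  -- Φ, a function of λ + ρ, agrees with the path count on partitions.
  Represents : List Step → State → Set
  Represents Z Φ = ∀ m lam → m ℤ.≤ + n → IsPartition lam → paths Z m lam ≈ Φ m (lam ⊕ ρ n)

  -- `paths-snoc` read as an operator on functions of β. It does not test for partitions; on a
  -- vector that clashes, Φ has to be 0 by itself.
  stepAt : Carrier → ℤ → State → Fin n → State
  stepAt y d Φ r m β = Φ m β + y * Φ (m ℤ.- 1ℤ) (bump r d β)

  m-1≤ : ∀ {m} → m ℤ.≤ + n → m ℤ.- 1ℤ ℤ.≤ + n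
  m-1≤ {m} m≤n = ℤ.≤-trans (ℤ.i-j≤i m 1ℤ) m≤n

  -- A common treatment of the unbarred letters (d = -1) and the barred ones (d = 1). The relation
  -- `_◁_` is an order of the rows in which a step leaves the clashes of all later rows intact.
  module Sweep (letter : Fin n → Letter n) (d : ℤ) (unmove-letter : ∀ r v → unmove (letter r) v ≡ bump r d v)
    (Clash : Fin n → Vec ℤ n → Set)
    (clash : ∀ r v → IsPartition v → IsPartition (bump r d v) ⊎ Clash r (bump r d v ⊕ ρ n))
    (_◁_ : Fin n → Fin n → Set) (clash-bump : ∀ {r s v} → r ◁ s → Clash s v → Clash s (bump r d v)) where

    Avoids : State → Fin n → Set
    Avoids Φ r = ∀ m β → Clash r β → Φ m β ≈ 0#

    represents-step : ∀ Z Φ y r → Represents Z Φ → Avoids Φ r → Represents (Z ++ (y , letter r) ∷ []) (stepAt y d Φ r)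
    represents-step Z Φ y r rep av m lam m≤n part = trans (paths-snoc Z y (letter r) m lam part)
      (+-cong (rep m lam m≤n part) (*-congˡ (trans (reflexive (≡.cong (paths Z (m ℤ.- 1ℤ)) (unmove-letter r lam))) second)))
      where
      second : paths Z (m ℤ.- 1ℤ) (bump r d lam) ≈ Φ (m ℤ.- 1ℤ) (bump r d (lam ⊕ ρ n))
      second with isPartition? (bump r d lam) | clash r lam part
      ... | yes part′ | _ = trans (rep _ _ (m-1≤ m≤n) part′) (reflexive (≡.cong (Φ (m ℤ.- 1ℤ)) (bump-⊕ r d lam (ρ n))))
      ... | no ¬part | inj₁ part′ = ⊥-elim (¬part part′)
      ... | no ¬part | inj₂ c = trans (paths-nonpartition Z _ _ ¬part)
              (sym (trans (reflexive (≡.cong (Φ (m ℤ.- 1ℤ)) (≡.sym (bump-⊕ r d lam (ρ n))))) (av _ _ c)))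

    -- A step at r keeps the function zero on the clashes of the later rows, since by `clash-bump`
    -- both of its terms are evaluated at clashing vectors.
    represents-sweep : ∀ Z Φ y rs → AP.AllPairs _◁_ rs → Represents Z Φ → ListAll.All (Avoids Φ) rs →
      Represents (Z ++ List.map (λ r → y , letter r) rs) (foldl (stepAt y d) Φ rs)
    represents-sweep Z Φ y [] _ rep _ = ≡.subst (λ Z → Represents Z Φ) (≡.sym (List.++-identityʳ Z)) rep
    represents-sweep Z Φ y (r ∷ rs) (p ∷ ps) rep (av ∷ avs) = ≡.subst (λ Z → Represents Z (foldl (stepAt y d) (stepAt y d Φ r) rs)) (List.++-assoc Z _ _)
      (represents-sweep (Z ++ (y , letter r) ∷ []) (stepAt y d Φ r) y rs ps (represents-step Z Φ y r rep av)
        (ListAll.zipWith (λ { {s} (r◁s , av′) m β c → trans (+-cong (av′ m β c) (trans (*-congˡ (av′ _ _ (clash-bump r◁s c))) (zeroʳ y))) (+-identityˡ _) }) (p , avs)))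

-- Sweeps over all rows as product operators

module SweepTens (R : CommutativeRing 0ℓ 0ℓ) where
  open Ring R
  open Alt R

  private
    module P n = Paths R n

  -- 1 + y s, where s uses one letter and moves the coordinate by d. Over all coordinates this is a
  -- sum over vertical strips, as no row changes by more than one box.
  binary : Carrier → ℤ → List Shift
  binary y d = (1# , 0ℤ , 0ℤ) ∷ (y , -1ℤ , d) ∷ []

  Tens-binary : ∀ y d (φ : ℤ → Fun (suc n)) b x β → Tens (binary y d) φ b (x ∷ β) ≈
    Tens (binary y d) (λ b v → φ b (x ∷ v)) b β + y * Tens (binary y d) (λ b v → φ b (x ℤ.+ d ∷ v)) (b ℤ.- 1ℤ) β
  Tens-binary y d φ b x β = +-cong
    (trans (*-identityˡ _) (reflexive (≡.cong₂ (λ b x → Tens (binary y d) (λ b v → φ b (x ∷ v)) b β) (ℤ.+-identityʳ b) (ℤ.+-identityʳ x))))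
    (+-identityʳ _)

  Tens-translate : ∀ op t (φ : ℤ → Fun n) b β → Tens op (λ b → φ (b ℤ.- t)) b β ≈ Tens op φ (b ℤ.- t) β
  Tens-translate op t φ b []      = refl
  Tens-translate op t φ b (x ∷ β) = sum-cong op λ (c , i , j) → *-congˡ (trans
    (Tens-translate op t (λ b v → φ b (x ℤ.+ j ∷ v)) (b ℤ.+ i) β)
    (reflexive (≡.cong (λ b → Tens op (λ b v → φ b (x ℤ.+ j ∷ v)) b β) (eq b i t))))
    where
    eq : ∀ b i t → (b ℤ.+ i) ℤ.- t ≡ (b ℤ.- t) ℤ.+ i
    eq = solve-∀

  sweep-suc : ∀ y d (Φ : ℤ → Fun (suc n)) rs m x β →
    foldl (P.stepAt (suc n) y d) Φ (List.map suc rs) m (x ∷ β) ≡ foldl (P.stepAt n y d) (λ m v → Φ m (x ∷ v)) rs m β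
  sweep-suc y d Φ []       m x β = ≡.refl
  sweep-suc y d Φ (r ∷ rs) m x β = sweep-suc y d (P.stepAt _ y d Φ (suc r)) rs m x β

  -- Without a test for partitions, steps in different rows commute. Sweeps in either order are the
  -- same product over the coordinates.
  sweep-ups : ∀ y d (Φ : ℤ → Fun n) m β → foldl (P.stepAt n y d) Φ (ups n) m β ≈ Tens (binary y d) Φ m β
  sweep-ups {zero}  y d Φ m []      = refl
  sweep-ups {suc n} y d Φ m (x ∷ β) = begin
    foldl (P.stepAt (suc n) y d) (P.stepAt (suc n) y d Φ zero) (List.map suc (ups n)) m (x ∷ β)
      ≡⟨ sweep-suc y d (P.stepAt (suc n) y d Φ zero) (ups n) m x β ⟩
    foldl (P.stepAt n y d) (λ m v → Φ m (x ∷ v) + y * Φ (m ℤ.- 1ℤ) (x ℤ.+ d ∷ v)) (ups n) m β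
      ≈⟨ sweep-ups y d (λ m v → Φ m (x ∷ v) + y * Φ (m ℤ.- 1ℤ) (x ℤ.+ d ∷ v)) m β ⟩
    Tens (binary y d) (λ m v → Φ m (x ∷ v) + y * Φ (m ℤ.- 1ℤ) (x ℤ.+ d ∷ v)) m β
      ≈⟨ trans (Tens-+ (binary y d) (λ m v → Φ m (x ∷ v)) (λ m v → y * Φ (m ℤ.- 1ℤ) (x ℤ.+ d ∷ v)) m β)
           (+-congˡ (trans (Tens-scale (binary y d) y (λ m v → Φ (m ℤ.- 1ℤ) (x ℤ.+ d ∷ v)) m β)
             (*-congˡ (Tens-translate (binary y d) 1ℤ (λ m v → Φ m (x ℤ.+ d ∷ v)) m β)))) ⟩
    Tens (binary y d) (λ b v → Φ b (x ∷ v)) m β + y * Tens (binary y d) (λ b v → Φ b (x ℤ.+ d ∷ v)) (m ℤ.- 1ℤ) β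
      ≈⟨ Tens-binary y d Φ m x β ⟨
    Tens (binary y d) Φ m (x ∷ β) ∎

  sweep-downs : ∀ y d (Φ : ℤ → Fun n) m β → foldl (P.stepAt n y d) Φ (downs n) m β ≈ Tens (binary y d) Φ m β
  sweep-downs {zero}  y d Φ m []      = refl
  sweep-downs {suc n} y d Φ m (x ∷ β) = begin
    foldl (P.stepAt (suc n) y d) Φ (List.map suc (downs n) ++ zero ∷ []) m (x ∷ β)
      ≡⟨ ≡.cong (λ Ψ → Ψ m (x ∷ β)) (List.foldl-++ (P.stepAt (suc n) y d) Φ (List.map suc (downs n)) (zero ∷ [])) ⟩
    Φ′ m (x ∷ β) + y * Φ′ (m ℤ.- 1ℤ) (x ℤ.+ d ∷ β)
      ≈⟨ +-cong (sweep-tail m x) (*-congˡ (sweep-tail (m ℤ.- 1ℤ) (x ℤ.+ d))) ⟩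
    Tens (binary y d) (λ b v → Φ b (x ∷ v)) m β + y * Tens (binary y d) (λ b v → Φ b (x ℤ.+ d ∷ v)) (m ℤ.- 1ℤ) β
      ≈⟨ Tens-binary y d Φ m x β ⟨
    Tens (binary y d) Φ m (x ∷ β) ∎
    where
    Φ′ = foldl (P.stepAt (suc n) y d) Φ (List.map suc (downs n))
    sweep-tail : ∀ m x → Φ′ m (x ∷ β) ≈ Tens (binary y d) (λ b v → Φ b (x ∷ v)) m β
    sweep-tail m x = trans (reflexive (sweep-suc y d Φ (downs n) m x β)) (sweep-downs y d (λ b v → Φ b (x ∷ v)) m β)

-- The closed form of the path count

Clash⁻-degenerate : ∀ {r} {v : Vec ℤ n} → Clash⁻ r v → Repeats v ⊎ Any (_≡ 0ℤ) v
Clash⁻-degenerate last = inj₂ (here ≡.refl)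
Clash⁻-degenerate here = inj₁ here
Clash⁻-degenerate (there c) with Clash⁻-degenerate c
... | inj₁ r = inj₁ (there r)
... | inj₂ z = inj₂ (there z)

Clash⁺-repeats : ∀ {r} {v : Vec ℤ n} → Clash⁺ r v → Repeats v
Clash⁺-repeats here      = here
Clash⁺-repeats (there c) = there (Clash⁺-repeats c)

∣𝟘⊕ρ∣ : ∀ n → ∣ 𝟘 ⊕ ρ n ∣ ≡ triangle n
∣𝟘⊕ρ∣ zero    = ≡.refl
∣𝟘⊕ρ∣ (suc n) = ≡.cong₂ ℤ._+_ (ℤ.+-identityˡ (+ suc n)) (∣𝟘⊕ρ∣ n)

partition-0∷ : (v : Vec ℤ n) → IsPartition (0ℤ ∷ v) → 𝟘 ≡ 0ℤ ∷ v
partition-0∷ []      _ = ≡.refl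
partition-0∷ (y ∷ v) part@((y≤0 ∷ _) , (_ ∷ 0≤y ∷ _)) with ℤ.≤-antisym y≤0 0≤y
... | ≡.refl = ≡.cong (0ℤ ∷_) (partition-0∷ v (partition-tail part))

module Inverse (R : CommutativeRing 0ℓ 0ℓ) (L : ℕ) where
  open Ring R
  open Alt R
  open Raising R L
  open SweepTens R

  Tens-sum : ∀ {Y : Set} op (xs : List Y) (φ : Y → ℤ → Fun n) b β →
    Tens op (λ b v → sum xs (λ a → φ a b v)) b β ≈ sum xs (λ a → Tens op (φ a) b β)
  Tens-sum op []       φ b β = trans (Tens-cong op b β (λ _ _ → sym (zeroˡ 0#)))
    (trans (Tens-scale op 0# (λ _ _ → 0#) b β) (zeroˡ _))
  Tens-sum op (a ∷ xs) φ b β = trans (Tens-+ op (φ a) _ b β) (+-congˡ (Tens-sum op xs φ b β))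

  -- In each coordinate (1 + y s) Σ (-y s)^i telescopes to 1 - (-y s)^L. The last term is evaluated
  -- at totals of at least L, where φ vanishes.
  binary-raise : ∀ (N : ℤ) y (φ : ℤ → Fun n) → (∀ b v → b ℤ.≤ N → Positive v → + L ℤ.≤ ∣ v ∣ → φ b v ≈ 0#) →
    ∀ b β → b ℤ.≤ N → Positive β → Tens (binary y 1ℤ) (Tens (raise (- y) 1ℤ) φ) b β ≈ φ b β
  binary-raise {zero}  N y φ van b []      b≤N pos = refl
  binary-raise {suc n} N y φ van b (x ∷ β) b≤N (p ∷ pos) = begin
    Tens (binary y 1ℤ) (Tens S φ) b (x ∷ β)
      ≈⟨ Tens-binary y 1ℤ (Tens S φ) b x β ⟩
    Tens (binary y 1ℤ) (λ b v → Tens S φ b (x ∷ v)) b β + y * Tens (binary y 1ℤ) (λ b v → Tens S φ b (x ℤ.+ 1ℤ ∷ v)) (b ℤ.- 1ℤ) β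
      ≈⟨ +-cong (half x b p b≤N) (*-congˡ (half (x ℤ.+ 1ℤ) (b ℤ.- 1ℤ) (ℤ.<-≤-trans p (ℤ.i≤i+j x 1ℤ)) (ℤ.≤-trans (ℤ.i-j≤i b 1ℤ) b≤N))) ⟩
    sum (upTo L) a + y * sum (upTo L) (λ i → (- y) ^ i * φ ((b ℤ.- 1ℤ) ℤ.- 1ℤ ℤ.* + i) ((x ℤ.+ 1ℤ) ℤ.+ + i ∷ β))
      ≈⟨ +-congˡ (trans (sum-* y (upTo L) _) (sum-cong (upTo L) (λ i → trans
           (solve 3 (λ y p f → y :* (p :* f) := :- (((:- y) :* p) :* f)) refl y ((- y) ^ i) _)
           (-‿cong (*-congˡ (reflexive (≡.cong₂ (λ b x → φ b (x ∷ β)) (eq₁ b (+ i)) (eq₂ x (+ i))))))))) ⟩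
    sum (upTo L) a + sum (upTo L) (λ i → - a (suc i))
      ≈⟨ +-congˡ (sum-neg (upTo L) (a ∘ suc)) ⟨
    sum (upTo L) a - sum (upTo L) (a ∘ suc)
      ≈⟨ solve 4 (λ s t u v → s :- t := (s :+ v) :- (u :+ t) :+ (u :- v)) refl (sum (upTo L) a) (sum (upTo L) (a ∘ suc)) (a 0) (a L) ⟩
    (sum (upTo L) a + a L) - (a 0 + sum (upTo L) (a ∘ suc)) + (a 0 - a L)
      ≈⟨ +-congʳ (trans (+-cong (sym (sum-upTo-last L a)) (-‿cong (sym (sum-upTo-suc L a)))) (-‿inverseʳ _)) ⟩
    0# + (a 0 - a L)
      ≈⟨ trans (+-identityˡ _) (+-cong (*-identityˡ _) (-‿cong a-L)) ⟩
    φ (b ℤ.- 1ℤ ℤ.* + 0) (x ℤ.+ + 0 ∷ β) - 0#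
      ≈⟨ trans (+-congˡ -0#≈0#) (trans (+-identityʳ _) (reflexive (≡.cong₂ (λ b x → φ b (x ∷ β)) (ℤ.+-identityʳ b) (ℤ.+-identityʳ x)))) ⟩
    φ b (x ∷ β) ∎
    where
    S = raise (- y) 1ℤ
    a : ℕ → Carrier
    a i = (- y) ^ i * φ (b ℤ.- 1ℤ ℤ.* + i) (x ℤ.+ + i ∷ β)
    eq₁ : ∀ b i → (b ℤ.- 1ℤ) ℤ.- 1ℤ ℤ.* i ≡ b ℤ.- 1ℤ ℤ.* (1ℤ ℤ.+ i)
    eq₁ = solve-∀
    eq₂ : ∀ x i → (x ℤ.+ 1ℤ) ℤ.+ i ≡ x ℤ.+ (1ℤ ℤ.+ i)
    eq₂ = solve-∀
    lowered : ∀ {b} i → b ℤ.≤ N → b ℤ.- 1ℤ ℤ.* + i ℤ.≤ N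
    lowered {b} i b≤N = ℤ.≤-trans (ℤ.≤-reflexive (≡.cong (ℤ._-_ b) (ℤ.*-identityˡ (+ i)))) (ℤ.≤-trans (ℤ.i-j≤i b (+ i)) b≤N)
    raised : ∀ {x} i → 0ℤ ℤ.< x → 0ℤ ℤ.< x ℤ.+ + i
    raised {x} i p = ℤ.<-≤-trans p (ℤ.i≤i+j x (+ i))
    a-L : a L ≈ 0#
    a-L = trans (*-congˡ (van _ _ (lowered L b≤N) (raised L p ∷ pos) (ℤ.≤-trans (ℤ.≤-reflexive (≡.sym (ℤ.+-identityʳ (+ L))))
      (ℤ.+-mono-≤ (ℤ.≤-trans (ℤ.≤-reflexive (≡.sym (ℤ.+-identityˡ (+ L)))) (ℤ.+-monoˡ-≤ (+ L) (ℤ.<⇒≤ p))) (positive⇒0≤∣∣ pos))))) (zeroʳ _)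
    half : ∀ x b → 0ℤ ℤ.< x → b ℤ.≤ N → Tens (binary y 1ℤ) (λ b v → Tens S φ b (x ∷ v)) b β ≈
      sum (upTo L) (λ i → (- y) ^ i * φ (b ℤ.- 1ℤ ℤ.* + i) (x ℤ.+ + i ∷ β))
    half x b p b≤N = begin
      Tens (binary y 1ℤ) (λ b v → Tens S φ b (x ∷ v)) b β
        ≈⟨ Tens-cong (binary y 1ℤ) b β (λ b v → sum-map _ (upTo L) _) ⟩
      Tens (binary y 1ℤ) (λ b v → sum (upTo L) (λ i → (- y) ^ i * Tens S (φ′ i) (b ℤ.- 1ℤ ℤ.* + i) v)) b β
        ≈⟨ Tens-sum (binary y 1ℤ) (upTo L) (λ i b v → (- y) ^ i * Tens S (φ′ i) (b ℤ.- 1ℤ ℤ.* + i) v) b β ⟩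
      sum (upTo L) (λ i → Tens (binary y 1ℤ) (λ b v → (- y) ^ i * Tens S (φ′ i) (b ℤ.- 1ℤ ℤ.* + i) v) b β)
        ≈⟨ sum-cong (upTo L) (λ i → trans (Tens-scale (binary y 1ℤ) ((- y) ^ i) (λ b → Tens S (φ′ i) (b ℤ.- 1ℤ ℤ.* + i)) b β)
             (*-congˡ (trans (Tens-translate (binary y 1ℤ) (1ℤ ℤ.* + i) (Tens S (φ′ i)) b β)
               (binary-raise N y (φ′ i) (λ b v b≤N pos le → van b _ b≤N (raised i p ∷ pos) (ℤ.≤-trans le
                 (ℤ.≤-trans (ℤ.≤-reflexive (≡.sym (ℤ.+-identityˡ ∣ v ∣))) (ℤ.+-monoˡ-≤ ∣ v ∣ (ℤ.<⇒≤ (raised i p))))))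
                 (b ℤ.- 1ℤ ℤ.* + i) β (lowered i b≤N) pos)))) ⟩
      sum (upTo L) (λ i → (- y) ^ i * φ (b ℤ.- 1ℤ ℤ.* + i) (x ℤ.+ + i ∷ β)) ∎
      where
      φ′ : ℕ → ℤ → Fun n
      φ′ i b v = φ b (x ℤ.+ + i ∷ v)

module PathsMain (R : CommutativeRing 0ℓ 0ℓ) (q : CommutativeRing.Carrier R) (n L : ℕ) (small : triangle n ℤ.+ + n ℤ.< + L) where
  open Ring R
  open Alt R
  open Columns R
  open Raising R L
  open Euler R q
  open Truncated R 0 using (ι; _⊛_)
  open Paths R n
  open SweepTens R
  open Inverse R L

  Φ : ℕ → State
  Φ T m β = det (cols (e T) n) β * double (pairProduct T) (m ℤ.+ triangle n ℤ.- ∣ β ∣)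

  Φ-middle : ℕ → State
  Φ-middle T m β = det (cols (e (suc T)) n) β * double (pairProduct T) (m ℤ.+ triangle n ℤ.- ∣ β ∣)

  det-repeats : ∀ T {β} → Repeats β → det (cols (e T) n) β ≈ 0#
  det-repeats T = repeats (Alt-alternating (prod (cols (e T) n)))

  cols-zero : ∀ (c : Column) k {x} → (∀ j → j ℕ.< k → c (x ℤ.- + suc j) ≈ 0#) → All (λ f → f x ≈ 0#) (cols c k)
  cols-zero c zero    z = []
  cols-zero c (suc k) z = z k ℕ.≤-refl ∷ cols-zero c k (λ j j<k → z j (ℕ.m≤n⇒m≤1+n j<k))

  module Plains = Sweep plain -1ℤ (λ _ _ → ≡.refl) Clash⁻ lower Fin._<_ (λ r<s c → Clash⁻-bump -1ℤ r<s c)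
  module Bars = Sweep bar 1ℤ (λ _ _ → ≡.refl) Clash⁺ heighten Fin._>_ (λ r>s c → Clash⁺-bump 1ℤ r>s c)

  Φ-avoids : ∀ T r → Plains.Avoids (Φ T) r
  Φ-avoids T r m β c with Clash⁻-degenerate c
  ... | inj₁ rep = trans (*-congʳ (det-repeats T rep)) (zeroˡ _)
  ... | inj₂ m′  = trans (*-congʳ (det-zero-row (cols (e T) n) β m′ (cols-zero (e T) n (λ j _ → refl)))) (zeroˡ _)

  Φ-middle-avoids : ∀ T r → Bars.Avoids (Φ-middle T) r
  Φ-middle-avoids T r m β c = trans (*-congʳ (det-repeats (suc T) (Clash⁺-repeats c))) (zeroˡ _)

  -- A step with d = -1 lowers the parameter and the total together, so a function of their
  -- difference passes through like a constant.
  Tens-balanced : ∀ {k} y (φ : Fun k) (Y : ℤ → Carrier) b β →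
    Tens (binary y -1ℤ) (λ b v → φ v * Y (b ℤ.- ∣ v ∣)) b β ≈ Tens (binary y -1ℤ) (λ _ → φ) b β * Y (b ℤ.- ∣ β ∣)
  Tens-balanced y φ Y b []      = refl
  Tens-balanced y φ Y b (x ∷ β) = begin
    Tens B (λ b v → φ v * Y (b ℤ.- ∣ v ∣)) b (x ∷ β)
      ≈⟨ Tens-binary y -1ℤ (λ b v → φ v * Y (b ℤ.- ∣ v ∣)) b x β ⟩
    Tens B (λ b v → φ (x ∷ v) * Y (b ℤ.- (x ℤ.+ ∣ v ∣))) b β + y * Tens B (λ b v → φ (x ℤ.+ -1ℤ ∷ v) * Y (b ℤ.- (x ℤ.+ -1ℤ ℤ.+ ∣ v ∣))) (b ℤ.- 1ℤ) β
      ≈⟨ +-cong (part x b) (*-congˡ (part (x ℤ.+ -1ℤ) (b ℤ.- 1ℤ))) ⟩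
    Tens B (λ _ v → φ (x ∷ v)) b β * Y (b ℤ.- (x ℤ.+ ∣ β ∣)) + y * (Tens B (λ _ v → φ (x ℤ.+ -1ℤ ∷ v)) (b ℤ.- 1ℤ) β * Y ((b ℤ.- 1ℤ) ℤ.- (x ℤ.+ -1ℤ ℤ.+ ∣ β ∣)))
      ≈⟨ +-congˡ (*-congˡ (*-congˡ (reflexive (≡.cong Y (eq₂ b x ∣ β ∣))))) ⟩
    Tens B (λ _ v → φ (x ∷ v)) b β * Y (b ℤ.- (x ℤ.+ ∣ β ∣)) + y * (Tens B (λ _ v → φ (x ℤ.+ -1ℤ ∷ v)) (b ℤ.- 1ℤ) β * Y (b ℤ.- (x ℤ.+ ∣ β ∣)))
      ≈⟨ solve 4 (λ a b y Y → a :* Y :+ y :* (b :* Y) := (a :+ y :* b) :* Y) refl _ _ y _ ⟩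
    (Tens B (λ _ v → φ (x ∷ v)) b β + y * Tens B (λ _ v → φ (x ℤ.+ -1ℤ ∷ v)) (b ℤ.- 1ℤ) β) * Y (b ℤ.- (x ℤ.+ ∣ β ∣))
      ≈⟨ *-congʳ (Tens-binary y -1ℤ (λ _ → φ) b x β) ⟨
    Tens B (λ _ → φ) b (x ∷ β) * Y (b ℤ.- ∣ x ∷ β ∣) ∎
    where
    B = binary y -1ℤ
    eq₁ : ∀ b x s → b ℤ.- (x ℤ.+ s) ≡ (b ℤ.- s) ℤ.- x
    eq₁ = solve-∀
    eq₂ : ∀ b x s → (b ℤ.- 1ℤ) ℤ.- (x ℤ.+ -1ℤ ℤ.+ s) ≡ b ℤ.- (x ℤ.+ s)
    eq₂ = solve-∀
    part : ∀ x b → Tens B (λ b v → φ (x ∷ v) * Y (b ℤ.- (x ℤ.+ ∣ v ∣))) b β ≈ Tens B (λ _ v → φ (x ∷ v)) b β * Y (b ℤ.- (x ℤ.+ ∣ β ∣))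
    part x b = trans (Tens-cong B b β (λ b v → *-congˡ (reflexive (≡.cong Y (eq₁ b x ∣ v ∣)))))
      (trans (Tens-balanced y (λ v → φ (x ∷ v)) (λ t → Y (t ℤ.- x)) b β) (*-congˡ (reflexive (≡.cong Y (≡.sym (eq₁ b x ∣ β ∣))))))

  -- Only the determinant changes: eₖ becomes eₖ + q^T eₖ₋₁ in every column, which adjoins the
  -- variable q^T.
  lower-sweep : ∀ T m β → Tens (binary (q ^ T) -1ℤ) (Φ T) m β ≈ Φ-middle T m β
  lower-sweep T m β = begin
    Tens B (Φ T) m β
      ≈⟨ Tens-cong B m β (λ b v → *-congˡ (reflexive (≡.cong (double (pairProduct T)) (eq b (triangle n) ∣ v ∣)))) ⟩
    Tens B (λ b v → det (cols (e T) n) v * Y (b ℤ.- ∣ v ∣)) m β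
      ≈⟨ Tens-balanced (q ^ T) (det (cols (e T) n)) Y m β ⟩
    Tens B (λ _ → det (cols (e T) n)) m β * Y (m ℤ.- ∣ β ∣)
      ≈⟨ *-cong (trans (Tens-det B (cols (e T) n) m β) (Alt-cong β (go n)))
           (reflexive (≡.cong (double (pairProduct T)) (≡.sym (eq m (triangle n) ∣ β ∣)))) ⟩
    Φ-middle T m β ∎
    where
    B = binary (q ^ T) -1ℤ
    Y : ℤ → Carrier
    Y t = double (pairProduct T) (t ℤ.+ triangle n)
    eq : ∀ b t s → b ℤ.+ t ℤ.- s ≡ (b ℤ.- s) ℤ.+ t
    eq = solve-∀
    eq′ : ∀ x o → (x ℤ.+ -1ℤ) ℤ.- o ≡ (x ℤ.- o) ℤ.- 1ℤ
    eq′ = solve-∀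
    go : ∀ k v → prod (Vec.map (apply B) (cols (e T) k)) v ≈ prod (cols (e (suc T)) k) v
    go zero    []      = refl
    go (suc k) (x ∷ v) = *-cong (trans
      (+-cong (trans (*-identityˡ _) (reflexive (≡.cong (λ x → e T (x ℤ.- + suc k)) (ℤ.+-identityʳ x))))
        (trans (+-identityʳ _) (*-congˡ (reflexive (≡.cong (e T) (eq′ x (+ suc k)))))))
      (sym (e-suc T (x ℤ.- + suc k)))) (go k v)

  double-support : ∀ (g : ℕ → Carrier) {m d} → m ℤ.≤ + n → triangle n ℤ.+ + n ℤ.< d → double g (m ℤ.+ triangle n ℤ.- d) ≈ 0#
  double-support g {m} m≤n lt = double-neg g (i<j⇒i-j<0 (ℤ.≤-<-trans
    (ℤ.≤-trans (ℤ.+-monoˡ-≤ (triangle n) m≤n) (ℤ.≤-reflexive (ℤ.+-comm (+ n) (triangle n)))) lt))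

  -- `raise-det` multiplies by Σ (-q^T)^k eₖ z^k = ∏_{t≤T} (1 - q^(T+t) z), and this removes from
  -- the pair product precisely the pairs containing T.
  Φ-raise : ∀ T b β → b ℤ.≤ + n → Positive β → Tens (raise (- (q ^ T)) 1ℤ) (Φ (suc T)) b β ≈ Φ-middle T b β
  Φ-raise T b β b≤n pos = trans
    (raise-det (e (suc T)) (λ _ → refl) refl (- y) 1ℤ (λ b d → double g (b ℤ.+ triangle n ℤ.- d)) b β pos small
      (λ k lt → double-support g (ℤ.≤-trans (ℤ.≤-reflexive (≡.cong (ℤ._-_ b) (ℤ.*-identityˡ (+ k)))) (ℤ.≤-trans (ℤ.i-j≤i b (+ k)) b≤n)) lt))
    (*-congˡ (trans (sum-cong (upTo L) (λ k → trans
        (solve 3 (λ a b c → (a :* b) :* c := (a :* c) :* b) refl _ _ _)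
        (*-congˡ (reflexive (≡.cong (double g) (eq b (triangle n) ∣ β ∣ (+ k)))))))
      (go (b ℤ.+ triangle n ℤ.- ∣ β ∣) ≡.refl)))
    where
    y = q ^ T
    g = pairProduct (suc T)
    eq : ∀ b t s k → (b ℤ.- 1ℤ ℤ.* k) ℤ.+ t ℤ.- (s ℤ.+ k) ≡ (b ℤ.+ t ℤ.- s) ℤ.- (k ℤ.+ k)
    eq = solve-∀
    go : ∀ z → b ℤ.+ triangle n ℤ.- ∣ β ∣ ≡ z →
      sum (upTo L) (λ k → signed y (suc T) k * double g (z ℤ.- (+ k ℤ.+ + k))) ≈ double (pairProduct T) z
    go (+ d) eq = trans (double-convolution (signed y (suc T)) g d L d<L) (double-cong (+ d) (signed-pairProduct T))
      where
      d<L : d ℕ.< L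
      d<L = ℤ.drop‿+<+ (≡.subst (ℤ._< + L) eq (ℤ.≤-<-trans
        (ℤ.≤-trans (ℤ.+-monoʳ-≤ (b ℤ.+ triangle n) (ℤ.neg-mono-≤ (positive⇒0≤∣∣ pos)))
        (ℤ.≤-trans (ℤ.≤-reflexive (ℤ.+-identityʳ (b ℤ.+ triangle n)))
        (ℤ.≤-trans (ℤ.+-monoˡ-≤ (triangle n) b≤n) (ℤ.≤-reflexive (ℤ.+-comm (+ n) (triangle n)))))) small))
    go -[1+ d ] eq = sum-zero (upTo L) (λ k → trans (*-congˡ (double-neg g (ℤ.≤-<-trans (ℤ.i-j≤i -[1+ d ] (+ k ℤ.+ + k)) ℤ.-<+))) (zeroʳ _))

  binary-cong-on : ∀ {k} y {φ φ′ : ℤ → Fun k} b β → b ℤ.≤ + n → Positive β →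
    (∀ b v → b ℤ.≤ + n → Positive v → φ b v ≈ φ′ b v) → Tens (binary y 1ℤ) φ b β ≈ Tens (binary y 1ℤ) φ′ b β
  binary-cong-on y b []      b≤n _ eq = eq b [] b≤n []
  binary-cong-on y {φ} {φ′} b (x ∷ β) b≤n (p ∷ pos) eq = trans (Tens-binary y 1ℤ φ b x β) (trans
    (+-cong (binary-cong-on y b β b≤n pos (λ b v b≤n pos → eq b (x ∷ v) b≤n (p ∷ pos)))
      (*-congˡ (binary-cong-on y (b ℤ.- 1ℤ) β (m-1≤ b≤n) pos (λ b v b≤n pos → eq b (x ℤ.+ 1ℤ ∷ v) b≤n (ℤ.<-≤-trans p (ℤ.i≤i+j x 1ℤ) ∷ pos)))))
    (sym (Tens-binary y 1ℤ φ′ b x β)))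

  -- Argued backwards: `Φ-raise` applies the inverse operator to the claimed result, and
  -- `binary-raise` undoes it.
  raise-sweep : ∀ T b β → b ℤ.≤ + n → Positive β → Tens (binary (q ^ T) 1ℤ) (Φ-middle T) b β ≈ Φ (suc T) b β
  raise-sweep T b β b≤n pos = trans
    (binary-cong-on (q ^ T) b β b≤n pos (λ b v b≤n pos → sym (Φ-raise T b v b≤n pos)))
    (binary-raise (+ n) (q ^ T) (Φ (suc T)) (λ b v b≤n pos le → trans (*-congˡ (double-support (pairProduct (suc T)) b≤n (ℤ.<-≤-trans small le))) (zeroʳ _)) b β b≤n pos)

  block : Carrier → List Step
  block y = List.map (λ r → y , plain r) (ups n) ++ List.map (λ r → y , bar r) (downs n)

  Represents-cong : ∀ Z {Ψ Ψ′} → (∀ m β → m ℤ.≤ + n → Positive β → Ψ m β ≈ Ψ′ m β) → Represents Z Ψ → Represents Z Ψ′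
  Represents-cong Z eq rep m lam m≤n part = trans (rep m lam m≤n part) (eq m _ m≤n (partition⇒positive lam part))

  represents-block : ∀ Z T → Represents Z (Φ T) → Represents (Z ++ block (q ^ T)) (Φ (suc T))
  represents-block Z T rep = ≡.subst (λ Z → Represents Z (Φ (suc T))) (List.++-assoc Z plains bars)
    (Represents-cong ((Z ++ plains) ++ bars) (λ m β m≤n pos → trans (sweep-downs (q ^ T) 1ℤ (Φ-middle T) m β) (raise-sweep T m β m≤n pos))
      (Bars.represents-sweep (Z ++ plains) (Φ-middle T) (q ^ T) (downs n) (downs-decreasing n)
        (Represents-cong (Z ++ plains) (λ m β _ _ → trans (sweep-ups (q ^ T) -1ℤ (Φ T) m β) (lower-sweep T m β))
          (Plains.represents-sweep Z (Φ T) (q ^ T) (ups n) (ups-increasing n) rep (ListAll.universal (Φ-avoids T) (ups n))))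
        (ListAll.universal (Φ-middle-avoids T) (downs n))))
    where
    plains = List.map (λ r → q ^ T , plain r) (ups n)
    bars   = List.map (λ r → q ^ T , bar r) (downs n)

  pickSum-zero-All : ∀ {k} {P : ℤ → Set} {g : ℤ → Fun k} β → All P β → (∀ z γ → P z → g z γ ≈ 0#) → pickSum g β ≈ 0#
  pickSum-zero-All {zero}  (x ∷ []) (p ∷ []) eq = eq x [] p
  pickSum-zero-All {suc k} (x ∷ β)  (p ∷ ps) eq = trans
    (+-cong (eq x β p) (-‿cong (pickSum-zero-All β ps (λ z γ → eq z (x ∷ γ))))) (-‿inverseʳ 0#)

  -- `e 0` is 1 at 0 and 0 elsewhere, so at λ = 0 the matrix (e 0 (j - i)) is the identity.
  det-ρ : ∀ k → det (cols (e 0) k) (𝟘 ⊕ ρ k) ≈ 1#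
  det-ρ zero    = refl
  det-ρ (suc k) = trans (det-∷ (λ x → e 0 (x ℤ.- + suc k)) (cols (e 0) k) (𝟘 ⊕ ρ (suc k))) (go k)
    where
    ρ-below : ∀ k → All (ℤ._< + suc k) (𝟘 ⊕ ρ k)
    ρ-below zero    = []
    ρ-below (suc k) = ℤ.≤-<-trans (ℤ.≤-reflexive (ℤ.+-identityˡ (+ suc k))) (ℤ.+<+ ℕ.≤-refl) ∷ weaken (ρ-below k)
      where
      weaken : ∀ {m} {v : Vec ℤ m} → All (ℤ._< + suc k) v → All (ℤ._< + suc (suc k)) v
      weaken []       = []
      weaken (p ∷ ps) = ℤ.<-trans p (ℤ.+<+ ℕ.≤-refl) ∷ weaken ps
    diagonal : ∀ k → e 0 ((0ℤ ℤ.+ + suc k) ℤ.- + suc k) ≈ 1#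
    diagonal k = reflexive (≡.cong (e 0) (≡.trans (≡.cong (ℤ._- + suc k) (ℤ.+-identityˡ (+ suc k))) (ℤ.+-inverseʳ (+ suc k))))
    e-below : ∀ {z o} → z ℤ.< o → e 0 (z ℤ.- o) ≈ 0#
    e-below {z} {o} lt with z ℤ.- o | i<j⇒i-j<0 lt
    ... | -[1+ _ ] | _ = refl
    ... | + _      | ℤ.+<+ ()
    go : ∀ k → pickSum (λ x γ → e 0 (x ℤ.- + suc k) * det (cols (e 0) k) γ) (𝟘 ⊕ ρ (suc k)) ≈ 1#
    go zero    = *-identityˡ _
    go (suc k) = trans (+-cong (trans (*-cong (diagonal (suc k)) (det-ρ (suc k))) (*-identityˡ _))
      (-‿cong (pickSum-zero-All {P = ℤ._< + suc (suc k)} (𝟘 ⊕ ρ (suc k)) (ρ-below (suc k))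
        (λ z γ lt → trans (*-congʳ (e-below lt)) (zeroˡ _)))))
      (trans (+-congˡ -0#≈0#) (+-identityʳ _))

  -- Only the empty path exists. On the other side, λ₁ > 0 makes the first row vanish, its entries
  -- being `e 0` at positive arguments.
  represents-[] : Represents [] (Φ 0)
  represents-[] m lam m≤n part with 𝟘 ≟ᵛ lam
  ... | yes ≡.refl = sym (trans (*-cong (det-ρ n) (reflexive (≡.cong (double (ι 1#)) (≡.trans (≡.cong (λ s → m ℤ.+ triangle n ℤ.- s) (∣𝟘⊕ρ∣ n)) (eq m (triangle n))))))
            (trans (*-identityˡ _) (double-ι m)))
    where
    eq : ∀ m t → m ℤ.+ t ℤ.- t ≡ m
    eq = solve-∀
    double-zero : ∀ d → double (λ _ → 0#) (+ d) ≈ 0#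
    double-zero 0             = refl
    double-zero 1             = refl
    double-zero (suc (suc d)) = double-zero d
    double-ι : ∀ m → double (ι 1#) m ≈ [ m ℤ.≟ 0ℤ ]∙ 1#
    double-ι (+ 0)           = refl
    double-ι (+ 1)           = refl
    double-ι (+ suc (suc d)) = double-zero d
    double-ι -[1+ d ]        = refl
  ... | no ne = trans ([]∙-zero (m ℤ.≟ 0ℤ)) (sym (trans (*-congʳ (det-nonzero lam part ne)) (zeroˡ _)))
    where
    det-nonzero : ∀ {k} (v : Vec ℤ k) → IsPartition v → ¬ (𝟘 ≡ v) → det (cols (e 0) k) (v ⊕ ρ k) ≈ 0#
    det-nonzero [] _ ne = ⊥-elim (ne ≡.refl)
    det-nonzero (+ 0 ∷ v) part ne = ⊥-elim (ne (partition-0∷ v part))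
    det-nonzero (-[1+ x ] ∷ v) (_ , () ∷ _) ne
    det-nonzero {suc k} (+ suc x ∷ v) part ne = det-zero-row (cols (e 0) (suc k)) ((+ suc x ∷ v) ⊕ ρ (suc k)) (here ≡.refl)
      (cols-zero (e 0) (suc k) (λ j j<k → reflexive (≡.cong (e 0) (above x (suc k) (suc j) j<k))))
      where
      above : ∀ x k j → j ℕ.≤ k → + suc x ℤ.+ + k ℤ.- + j ≡ + suc (x ℕ.+ (k ℕ.∸ j))
      above x k j j≤k = ≡.trans (ℤ.+-assoc (+ suc x) (+ k) (ℤ.- + j))
        (≡.cong (ℤ._+_ (+ suc x)) (≡.trans (ℤ.m-n≡m⊖n k j) (ℤ.⊖-≥ j≤k)))

-- From words and their energy to paths

_≟ᴸ_ : DecidableEquality (Letter n)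
plain i ≟ᴸ plain j = map′ (≡.cong plain) (λ { ≡.refl → ≡.refl }) (i Fin.≟ j)
plain i ≟ᴸ bar j   = no λ ()
bar i   ≟ᴸ plain j = no λ ()
bar i   ≟ᴸ bar j   = map′ (≡.cong bar) (λ { ≡.refl → ≡.refl }) (i Fin.≟ j)

≺-trans : {x y z : Letter n} → x ≺ y → y ≺ z → x ≺ z
≺-trans (plain≺plain p) (plain≺plain q) = plain≺plain (ℕ.<-trans p q)
≺-trans (plain≺plain _) plain≺bar       = plain≺bar
≺-trans plain≺bar       (bar≺bar _)     = plain≺bar
≺-trans (bar≺bar p)     (bar≺bar q)     = bar≺bar (ℕ.<-trans q p)

≺⇒≢ : {x y : Letter n} → x ≺ y → x ≢ y
≺⇒≢ (plain≺plain p) ≡.refl = ℕ.<-irrefl ≡.refl p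
≺⇒≢ (bar≺bar p)     ≡.refl = ℕ.<-irrefl ≡.refl p

ordered : ∀ n → List (Letter n)
ordered n = List.map plain (ups n) ++ List.map bar (downs n)

ordered-increasing : ∀ n → AP.AllPairs _≺_ (ordered n)
ordered-increasing n = AP.++⁺ (AP.map⁺ (AP.map plain≺plain (ups-increasing n))) (AP.map⁺ (AP.map bar≺bar (downs-decreasing n)))
  (ListAll.map⁺ (ListAll.universal (λ _ → ListAll.map⁺ (ListAll.universal (λ _ → plain≺bar) (downs n))) (ups n)))

∈-ordered : (x : Letter n) → x ∈ ordered n
∈-ordered (plain r) = ∈-++⁺ˡ (∈-map⁺ plain (∈-ups r))
  where
  ∈-ups : ∀ {n} (r : Fin n) → r ∈ ups n
  ∈-ups zero    = here ≡.refl
  ∈-ups (suc r) = there (∈-map⁺ suc (∈-ups r))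
∈-ordered {n} (bar r) = ∈-++⁺ʳ (List.map plain (ups n)) (∈-map⁺ bar (∈-downs r))
  where
  ∈-downs : ∀ {n} (r : Fin n) → r ∈ downs n
  ∈-downs {suc n} zero    = ∈-++⁺ʳ (List.map suc (downs n)) (here ≡.refl)
  ∈-downs {suc n} (suc r) = ∈-++⁺ˡ (∈-map⁺ suc (∈-downs r))

-- The letter x at time t; words are read off schedules by increasing times, and
-- by increasing letters within one time.
Marked : ℕ → Set
Marked n = ℕ × Letter n

delay : Marked n → Marked n
delay (t , x) = suc t , x

round : ∀ n → ℕ → List (Marked n)
round n t = List.map (t ,_) (ordered n)

schedule : ∀ n → ℕ → List (Marked n)
schedule n zero    = []
schedule n (suc T) = schedule n T ++ round n T

-- The self-similarity behind `occurrences-energy`: after time 0 the schedule is a delayed copy of a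
-- shorter one.
schedule-first : ∀ n T → schedule n (suc T) ≡ round n 0 ++ List.map delay (schedule n T)
schedule-first n zero    = ≡.sym (List.++-identityʳ (round n 0))
schedule-first n (suc T) = begin
  schedule n (suc T) ++ round n (suc T)
    ≡⟨ ≡.cong₂ _++_ (schedule-first n T) (List.map-∘ (ordered n)) ⟩
  (round n 0 ++ List.map delay (schedule n T)) ++ List.map delay (round n T)
    ≡⟨ List.++-assoc (round n 0) _ _ ⟩
  round n 0 ++ (List.map delay (schedule n T) ++ List.map delay (round n T))
    ≡⟨ ≡.cong (round n 0 ++_) (List.map-++ delay (schedule n T) (round n T)) ⟨
  round n 0 ++ List.map delay (schedule n (suc T)) ∎
  where open ≡.≡-Reasoning

module Words (R : CommutativeRing 0ℓ 0ℓ) (q : CommutativeRing.Carrier R) (n : ℕ) where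
  open Ring R
  open Euler R q using (pochhammer)
  open Paths R n

  weigh : Marked n → Step
  weigh (t , x) = q ^ t , x

  -- Σ over the occurrences of w as a subword of Z, weighted by q to the sum of the times.
  occurrences : List (Marked n) → Vec (Letter n) m → Carrier
  occurrences Z             []      = 1#
  occurrences []            (x ∷ w) = 0#
  occurrences ((t , z) ∷ Z) (x ∷ w) = occurrences Z (x ∷ w) + [ x ≟ᴸ z ]∙ (q ^ t * occurrences Z w)

  visits : Vec ℤ n → Vec ℤ n → Vec (Letter n) m → Carrier
  visits κ lam []      = [ κ ≟ᵛ lam ]∙ 1#
  visits κ lam (x ∷ w) = [ isPartition? (move x κ) ]∙ visits (move x κ) lam w

  sum-words : ∀ {A : Set} (as : List A) m (h : Vec A (suc m) → Carrier) →
    sum (words as (suc m)) h ≈ sum as (λ a → sum (words as m) (λ w → h (a ∷ w)))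
  sum-words as m h = sum-cartesianProductWith Vec._∷_ as (words as m) h

  sum-allFin-only : ∀ k r (h : Fin k → Carrier) → sum (allFin k) (λ i → [ i Fin.≟ r ]∙ h i) ≈ h r
  sum-allFin-only (suc k) r h = trans (+-congˡ (trans
      (reflexive (≡.cong (λ xs → sum xs (λ i → [ i Fin.≟ r ]∙ h i)) (≡.sym (List.map-tabulate (λ i → i) suc))))
      (sum-map suc (allFin k) _))) (go r)
    where
    go : ∀ r → [ zero Fin.≟ r ]∙ h zero + sum (allFin k) (λ i → [ suc i Fin.≟ r ]∙ h (suc i)) ≈ h r
    go zero    = trans (+-congˡ (sum-zero (allFin k) (λ _ → refl))) (+-identityʳ _)
    go (suc r) = trans (+-identityˡ _) (sum-allFin-only k r (λ i → h (suc i)))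

  sum-alphabet-only : ∀ x (h : Letter n → Carrier) → sum (alphabet n) (λ y → [ y ≟ᴸ x ]∙ h y) ≈ h x
  sum-alphabet-only x h = trans (sum-++ (List.map plain (allFin n)) _ _)
    (trans (+-cong (sum-map plain (allFin n) _) (sum-map bar (allFin n) _)) (go x))
    where
    go : ∀ x → sum (allFin n) (λ i → [ plain i ≟ᴸ x ]∙ h (plain i)) + sum (allFin n) (λ i → [ bar i ≟ᴸ x ]∙ h (bar i)) ≈ h x
    go (plain r) = trans (+-cong (sum-allFin-only n r (λ i → h (plain i))) (sum-zero (allFin n) (λ _ → refl))) (+-identityʳ _)
    go (bar r)   = trans (+-cong (sum-zero (allFin n) (λ _ → refl)) (sum-allFin-only n r (λ i → h (bar i)))) (+-identityˡ _)

  run-negative : ∀ Z lam k κ → run Z (point lam) -[1+ k ] κ ≈ 0#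
  run-negative []            lam k κ = refl
  run-negative ((y , x) ∷ Z) lam k κ = trans (+-cong (run-negative Z lam k κ) ([]∙-vanish (isPartition? (move x κ))
    (λ _ → trans (*-congˡ (run-negative Z lam _ _)) (zeroʳ y)))) (+-identityˡ _)

  -- A path selects a subword of Z. Grouping the selections by the word they spell separates the
  -- partition condition, in `visits`, from the times, in `occurrences`.
  run-words : ∀ Z lam m κ → run (List.map weigh Z) (point lam) (+ m) κ ≈
    sum (words (alphabet n) m) (λ w → visits κ lam w * occurrences Z w)
  run-words [] lam zero κ = sym (trans (+-identityʳ _) (*-identityʳ _))
  run-words [] lam (suc m) κ = sym (trans (sum-words (alphabet n) m _)
    (sum-zero (alphabet n) (λ x → sum-zero (words (alphabet n) m) (λ w → zeroʳ _))))
  run-words ((t , x) ∷ Z) lam zero κ = trans (+-cong (run-words Z lam zero κ)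
    ([]∙-vanish (isPartition? (move x κ)) (λ _ → trans (*-congˡ (run-negative (List.map weigh Z) lam 0 (move x κ))) (zeroʳ _)))) (+-identityʳ _)
  run-words ((t , x) ∷ Z) lam (suc m) κ = begin
    run (List.map weigh Z) (point lam) (+ suc m) κ + [ P? x ]∙ (q ^ t * run (List.map weigh Z) (point lam) (+ m) (move x κ))
      ≈⟨ +-cong (trans (run-words Z lam (suc m) κ) (sum-words (alphabet n) m _))
           (trans ([]∙-cong (P? x) (*-congˡ (run-words Z lam m (move x κ)))) (sym (sum-alphabet-only x h))) ⟩
    sum (alphabet n) (λ y → sum W (λ w → visits κ lam (y ∷ w) * occurrences Z (y ∷ w))) + sum (alphabet n) (λ y → [ y ≟ᴸ x ]∙ h y)
      ≈⟨ sum-+ (alphabet n) _ _ ⟨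
    sum (alphabet n) (λ y → sum W (λ w → visits κ lam (y ∷ w) * occurrences Z (y ∷ w)) + [ y ≟ᴸ x ]∙ h y)
      ≈⟨ sum-cong (alphabet n) (λ y → trans (+-congˡ (expand y)) (trans (sym (sum-+ W _ _)) (sum-cong W (λ w → sym (distribˡ _ _ _))))) ⟩
    sum (alphabet n) (λ y → sum W (λ w → visits κ lam (y ∷ w) * occurrences ((t , x) ∷ Z) (y ∷ w)))
      ≈⟨ sum-words (alphabet n) m _ ⟨
    sum (words (alphabet n) (suc m)) (λ w → visits κ lam w * occurrences ((t , x) ∷ Z) w) ∎
    where
    W = words (alphabet n) m
    P? = λ y → isPartition? (move y κ)
    h : Letter n → Carrier
    h y = [ P? y ]∙ (q ^ t * sum W (λ w → visits (move y κ) lam w * occurrences Z w))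
    pull : ∀ {P Q : Set} (P? : Dec P) (Q? : Dec Q) v p a → [ Q? ]∙ ([ P? ]∙ (p * (v * a))) ≈ ([ P? ]∙ v) * ([ Q? ]∙ (p * a))
    pull P? Q? v p a with does P? | does Q?
    ... | true  | true  = solve 3 (λ p v a → p :* (v :* a) := v :* (p :* a)) refl p v a
    ... | false | true  = sym (zeroˡ _)
    ... | true  | false = sym (zeroʳ _)
    ... | false | false = sym (zeroʳ _)
    expand : ∀ y → [ y ≟ᴸ x ]∙ h y ≈ sum W (λ w → visits κ lam (y ∷ w) * ([ y ≟ᴸ x ]∙ (q ^ t * occurrences Z w)))
    expand y = trans ([]∙-cong (y ≟ᴸ x) (trans ([]∙-cong (P? y) (sum-* (q ^ t) W _)) ([]∙-sum (P? y) W _)))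
      (trans ([]∙-sum (y ≟ᴸ x) W _) (sum-cong W (λ w → pull (P? y) (y ≟ᴸ x) (visits (move y κ) lam w) (q ^ t) (occurrences Z w))))

  occurrences-skip : ∀ Z {Z′ x} {w : Vec (Letter n) m} → ListAll.All (λ z → x ≢ proj₂ z) Z →
    occurrences (Z ++ Z′) (x ∷ w) ≈ occurrences Z′ (x ∷ w)
  occurrences-skip []            []       = refl
  occurrences-skip ((t , z) ∷ Z) (p ∷ ps) = trans (+-cong (occurrences-skip Z ps) ([]∙-false (_ ≟ᴸ z) _ p)) (+-identityʳ _)

  occurrences-dead : ∀ Z {Z′} (w : Vec (Letter n) m) → ListAll.All (λ z → q ^ proj₁ z ≈ 0#) Z′ → occurrences (Z ++ Z′) w ≈ occurrences Z w
  occurrences-dead Z              []      d        = refl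
  occurrences-dead []             (x ∷ w) []       = refl
  occurrences-dead [] {(t , z) ∷ Z′} (x ∷ w) (d ∷ ds) = trans (+-cong (occurrences-dead [] (x ∷ w) ds)
    ([]∙-vanish (x ≟ᴸ z) (λ _ → trans (*-congʳ d) (zeroˡ _)))) (+-identityʳ _)
  occurrences-dead ((t , z) ∷ Z)  (x ∷ w) d        = +-cong (occurrences-dead Z (x ∷ w) d)
    ([]∙-cong (x ≟ᴸ z) (*-congˡ (occurrences-dead Z w d)))

  occurrences-delay : ∀ Z (w : Vec (Letter n) m) → occurrences (List.map delay Z) w ≈ q ^ m * occurrences Z w
  occurrences-delay Z             []      = sym (*-identityˡ _)
  occurrences-delay []            (x ∷ w) = sym (zeroʳ _)
  occurrences-delay ((t , z) ∷ Z) (x ∷ w) = trans (+-cong (occurrences-delay Z (x ∷ w))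
    (trans ([]∙-cong (x ≟ᴸ z) (trans (*-congˡ (occurrences-delay Z w))
      (solve 4 (λ q t m a → (q :* t) :* (m :* a) := (q :* m) :* (t :* a)) refl q (q ^ t) _ _))) ([]∙-* (x ≟ᴸ z) _ _)))
    (sym (distribˡ _ _ _))

  at-0 : List (Letter n) → List (Marked n)
  at-0 = List.map (0 ,_)

  -- What remains of a word once its first letter x has been placed at time 0.
  afterFirst : List (Letter n) → List (Marked n) → Letter n → Vec (Letter n) m → Carrier
  afterFirst os Z x []      = 1#
  afterFirst os Z x (y ∷ w) = if does (x ≺? y) then occurrences (at-0 os ++ Z) (y ∷ w) else occurrences Z (y ∷ w)

  -- Either x is placed later, or at its only place at time 0, with weight 1. In the second case the
  -- next letter y can still be placed at time 0 exactly if x ≺ y.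
  occurrences-first : ∀ os Z x (w : Vec (Letter n) m) → AP.AllPairs _≺_ os → x ∈ os →
    occurrences (at-0 os ++ Z) (x ∷ w) ≈ occurrences Z (x ∷ w) + afterFirst os Z x w
  occurrences-first (o ∷ os) Z x w (p ∷ ps) (here ≡.refl) = +-cong
    (occurrences-skip (at-0 os) (ListAll.map⁺ (ListAll.map ≺⇒≢ p)))
    (trans ([]∙-true (x ≟ᴸ x) _ ≡.refl) (trans (*-identityˡ _) (rest w)))
    where
    rest : ∀ {m} (w : Vec (Letter n) m) → occurrences (at-0 os ++ Z) w ≈ afterFirst (x ∷ os) Z x w
    rest []      = refl
    rest (y ∷ w) with x ≺? y
    ... | yes x≺y = sym (occurrences-skip ((0 , x) ∷ []) {at-0 os ++ Z} ((λ { ≡.refl → ≺⇒≢ x≺y ≡.refl }) ∷ []))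
    ... | no x⊀y  = occurrences-skip (at-0 os) (ListAll.map⁺ (ListAll.map (λ { x≺z ≡.refl → x⊀y x≺z }) p))
  occurrences-first (o ∷ os) Z x w (p ∷ ps) (there x∈os) = trans
    (+-cong (occurrences-first os Z x w ps x∈os) ([]∙-false (x ≟ᴸ o) _ (λ { ≡.refl → ≺⇒≢ o≺x ≡.refl })))
    (trans (+-identityʳ _) (+-congˡ (same w)))
    where
    o≺x : o ≺ x
    o≺x = ListAll.lookup p x∈os
    same : ∀ {m} (w : Vec (Letter n) m) → afterFirst os Z x w ≈ afterFirst (o ∷ os) Z x w
    same []      = refl
    same (y ∷ w) with x ≺? y
    ... | yes x≺y = sym (occurrences-skip ((0 , o) ∷ []) {at-0 os ++ Z} ((λ { ≡.refl → ≺⇒≢ (≺-trans o≺x x≺y) ≡.refl }) ∷ []))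
    ... | no _    = refl

  module _ (K : ℕ) (q^K≈0 : q ^ K ≈ 0#) where
    private
      Z : List (Marked n)
      Z = schedule n (suc K)

    -- The shorter schedule lacks the round at time K, but there every weight is q^K ≈ 0.
    occurrences-stable : (w : Vec (Letter n) m) → occurrences (List.map delay (schedule n K)) w ≈ q ^ m * occurrences Z w
    occurrences-stable w = trans (occurrences-delay (schedule n K) w)
      (*-congˡ (sym (occurrences-dead (schedule n K) w (ListAll.map⁺ (ListAll.universal (λ _ → q^K≈0) (ordered n))))))

    -- Let a belong to a word of length m + 1. The occurrences without a letter at time 0 sum to
    -- q^(m+1) a, hence (1 - q^(m+1)) a sums those whose first letter is at time 0. There the other
    -- m letters may start at time 0 if x ≺ y, and otherwise at time 1, which costs q^m. That
    -- exponent is the first summand of the energy.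
    occurrences-energy : (w : Vec (Letter n) m) → pochhammer m * occurrences Z w ≈ q ^ energy w
    occurrences-energy []              = *-identityˡ _
    occurrences-energy {suc m} (x ∷ w) = begin
      (pochhammer m * (1# - q ^ suc m)) * a
        ≈⟨ solve 3 (λ p s a → (p :* (:1 :- s)) :* a := p :* (a :- s :* a)) refl _ _ a ⟩
      pochhammer m * (a - q ^ suc m * a)
        ≈⟨ *-congˡ (+-congʳ (trans (reflexive (≡.cong (λ Z → occurrences Z (x ∷ w)) (schedule-first n K)))
             (trans (occurrences-first (ordered n) Z′ x w (ordered-increasing n) (∈-ordered x)) (+-congʳ (occurrences-stable (x ∷ w)))))) ⟩
      pochhammer m * ((q ^ suc m * a + afterFirst (ordered n) Z′ x w) - q ^ suc m * a)
        ≈⟨ *-congˡ (solve 2 (λ s e → (s :+ e) :- s := e) refl _ _) ⟩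
      pochhammer m * afterFirst (ordered n) Z′ x w
        ≈⟨ rest w (occurrences-energy w) ⟩
      q ^ energy (x ∷ w) ∎
      where
      a = occurrences Z (x ∷ w)
      Z′ = List.map delay (schedule n K)
      rest : ∀ {m} (w : Vec (Letter n) m) → pochhammer m * occurrences Z w ≈ q ^ energy w →
        pochhammer m * afterFirst (ordered n) Z′ x w ≈ q ^ energy (x ∷ w)
      rest []                  _ = *-identityˡ _
      rest {suc m} (y ∷ w) IH with x ≺? y
      ... | yes _ = trans (*-congˡ (reflexive (≡.cong (λ Z → occurrences Z (y ∷ w)) (≡.sym (schedule-first n K)))))
                      (trans IH
                        (reflexive (≡.cong (λ k → q ^ (k ℕ.+ energy (y ∷ w))) (≡.sym (ℕ.*-zeroʳ (Vec.length w))))))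
      ... | no _  = trans (*-congˡ (occurrences-stable (y ∷ w)))
                      (trans (solve 3 (λ p s a → p :* (s :* a) := s :* (p :* a)) refl _ _ _)
                      (trans (*-congˡ IH) (trans (sym (^-homo-* q (suc m) (energy (y ∷ w))))
                        (reflexive (≡.cong (λ k → q ^ (k ℕ.+ energy (y ∷ w))) (≡.sym (ℕ.*-identityʳ (suc m))))))))

    module _ (L : ℕ) (small : triangle n ℤ.+ + n ℤ.< + L) where
      open PathsMain R q n L small using (Φ; represents-[]; represents-block; block)

      represents-schedule : ∀ T → Represents (List.map weigh (schedule n T)) (Φ T)
      represents-schedule zero    = represents-[]
      represents-schedule (suc T) = ≡.subst (λ Z → Represents Z (Φ (suc T)))
        (≡.trans (≡.cong (List.map weigh (schedule n T) ++_) round≡block) (≡.sym (List.map-++ weigh (schedule n T) (round n T))))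
        (represents-block (List.map weigh (schedule n T)) T (represents-schedule T))
        where
        round≡block : block (q ^ T) ≡ List.map weigh (round n T)
        round≡block = ≡.sym (≡.trans (≡.sym (List.map-∘ (ordered n))) (≡.trans (List.map-++ (λ x → q ^ T , x) (List.map plain (ups n)) (List.map bar (downs n)))
          (≡.cong₂ _++_ (≡.sym (List.map-∘ (ups n))) (≡.sym (List.map-∘ (downs n))))))

      energy-sum : ∀ lam → IsPartition lam →
        sum (words (alphabet n) n) (λ w → visits 𝟘 lam w * q ^ energy w) ≈ pochhammer n * Φ (suc K) (+ n) (lam ⊕ ρ n)
      energy-sum lam part = begin
        sum W (λ w → visits 𝟘 lam w * q ^ energy w)
          ≈⟨ sum-cong W (λ w → trans (*-congˡ (sym (occurrences-energy w))) (solve 3 (λ v p a → v :* (p :* a) := p :* (v :* a)) refl _ _ _)) ⟩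
        sum W (λ w → pochhammer n * (visits 𝟘 lam w * occurrences Z w))
          ≈⟨ sum-* (pochhammer n) W _ ⟨
        pochhammer n * sum W (λ w → visits 𝟘 lam w * occurrences Z w)
          ≈⟨ *-congˡ (trans (sym (run-words Z lam n 𝟘)) (represents-schedule (suc K) (+ n) lam ℤ.≤-refl part)) ⟩
        pochhammer n * Φ (suc K) (+ n) (lam ⊕ ρ n) ∎
        where W = words (alphabet n) n

-- The generating function

allFin-suc : ∀ n → allFin (suc n) ≡ zero ∷ List.map suc (allFin n)
allFin-suc n = ≡.cong (zero ∷_) (≡.sym (List.map-tabulate (λ i → i) suc))

suc² : ∀ {n} → Fin n × Fin n → Fin (suc n) × Fin (suc n)
suc² (i , j) = suc i , suc j

pairs<-suc : ∀ n → pairs< (suc n) ≡ List.map (λ j → zero , suc j) (allFin n) ++ List.map suc² (pairs< n)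
pairs<-suc n = begin
  filter lt (cartesianProduct (allFin (suc n)) (allFin (suc n)))
    ≡⟨ ≡.cong₂ (λ is js → filter lt (cartesianProduct is js)) (allFin-suc n) (allFin-suc n) ⟩
  filter lt (List.map (zero ,_) (List.map suc (allFin n)) ++ cartesianProduct (List.map suc (allFin n)) (zero ∷ List.map suc (allFin n)))
    ≡⟨ List.filter-++ lt (List.map (zero ,_) (List.map suc (allFin n))) _ ⟩
  filter lt (List.map (zero ,_) (List.map suc (allFin n))) ++ filter lt (cartesianProduct (List.map suc (allFin n)) (zero ∷ List.map suc (allFin n)))
    ≡⟨ ≡.cong₂ _++_ (first (allFin n)) (rest (allFin n)) ⟩
  List.map (λ j → zero , suc j) (allFin n) ++ List.map suc² (pairs< n) ∎
  where
  open ≡.≡-Reasoning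
  lt : ∀ {n} → Decidable (uncurry (Fin._<_ {n} {n}))
  lt = uncurry Fin._<?_
  first : ∀ js → filter lt (List.map (zero {n} ,_) (List.map suc js)) ≡ List.map (λ j → zero , suc j) js
  first []       = ≡.refl
  first (j ∷ js) = ≡.cong (_ ∷_) (first js)
  row : ∀ i js → filter lt (List.map (suc {n} i ,_) (List.map suc js)) ≡ List.map suc² (filter lt (List.map (i ,_) js))
  row i [] = ≡.refl
  row i (j ∷ js) with Fin.toℕ i ℕ.<ᵇ Fin.toℕ j
  ... | true  = ≡.cong (_ ∷_) (row i js)
  ... | false = row i js
  rest : ∀ is → filter lt (cartesianProduct (List.map suc is) (zero ∷ List.map suc (allFin n))) ≡
    List.map suc² (filter lt (cartesianProduct is (allFin n)))
  rest []       = ≡.refl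
  rest (i ∷ is) = begin
    filter lt (List.map (suc i ,_) (List.map suc (allFin n)) ++ cartesianProduct (List.map suc is) (zero ∷ List.map suc (allFin n)))
      ≡⟨ List.filter-++ lt (List.map (suc i ,_) (List.map suc (allFin n))) _ ⟩
    filter lt (List.map (suc i ,_) (List.map suc (allFin n))) ++ filter lt (cartesianProduct (List.map suc is) (zero ∷ List.map suc (allFin n)))
      ≡⟨ ≡.cong₂ _++_ (row i (allFin n)) (rest is) ⟩
    List.map suc² (filter lt (List.map (i ,_) (allFin n))) ++ List.map suc² (filter lt (cartesianProduct is (allFin n)))
      ≡⟨ List.map-++ suc² (filter lt (List.map (i ,_) (allFin n))) _ ⟨
    List.map suc² (filter lt (List.map (i ,_) (allFin n)) ++ filter lt (cartesianProduct is (allFin n)))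
      ≡⟨ ≡.cong (List.map suc²) (List.filter-++ lt (List.map (i ,_) (allFin n)) _) ⟨
    List.map suc² (filter lt (cartesianProduct (i ∷ is) (allFin n))) ∎

𝟘-⊕ : (v : Vec ℤ n) → 𝟘 ⊕ v ≡ v
𝟘-⊕ []      = ≡.refl
𝟘-⊕ (x ∷ v) = ≡.cong₂ _∷_ (ℤ.+-identityˡ x) (𝟘-⊕ v)

⊕-𝟘 : (v : Vec ℤ n) → v ⊕ 𝟘 ≡ v
⊕-𝟘 []      = ≡.refl
⊕-𝟘 (x ∷ v) = ≡.cong₂ _∷_ (ℤ.+-identityʳ x) (⊕-𝟘 v)

⊕-assoc : (u v w : Vec ℤ n) → (u ⊕ v) ⊕ w ≡ u ⊕ (v ⊕ w)
⊕-assoc []      []      []      = ≡.refl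
⊕-assoc (x ∷ u) (y ∷ v) (z ∷ w) = ≡.cong₂ _∷_ (ℤ.+-assoc x y z) (⊕-assoc u v w)

·-𝟘⊖𝟘 : ∀ k n → k · (𝟘 {n} ⊖ 𝟘) ≡ 𝟘
·-𝟘⊖𝟘 k zero    = ≡.refl
·-𝟘⊖𝟘 k (suc n) = ≡.cong₂ _∷_ (ℤ.*-zeroʳ (+ k)) (·-𝟘⊖𝟘 k n)

⊖⊖⊕ : (s t w : Vec ℤ n) → (((s ⊕ t) ⊕ w) ⊖ s) ⊖ t ≡ w
⊖⊖⊕ []      []      []      = ≡.refl
⊖⊖⊕ (x ∷ s) (y ∷ t) (z ∷ w) = ≡.cong₂ _∷_ (eq x y z) (⊖⊖⊕ s t w)
  where
  eq : ∀ x y z → (((x ℤ.+ y) ℤ.+ z) ℤ.- x) ℤ.- y ≡ z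
  eq = solve-∀

⊕⊖⊖ : (s t w : Vec ℤ n) → (s ⊕ t) ⊕ ((w ⊖ s) ⊖ t) ≡ w
⊕⊖⊖ []      []      []      = ≡.refl
⊕⊖⊖ (x ∷ s) (y ∷ t) (z ∷ w) = ≡.cong₂ _∷_ (eq x y z) (⊕⊖⊖ s t w)
  where
  eq : ∀ x y z → (x ℤ.+ y) ℤ.+ ((z ℤ.- x) ℤ.- y) ≡ z
  eq = solve-∀

⊕-interchange : (s p t r : Vec ℤ n) → (s ⊕ p) ⊕ (t ⊕ r) ≡ (s ⊕ t) ⊕ (p ⊕ r)
⊕-interchange []      []      []      []      = ≡.refl
⊕-interchange (x ∷ s) (y ∷ p) (z ∷ t) (w ∷ r) = ≡.cong₂ _∷_ (eq x y z w) (⊕-interchange s p t r)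
  where
  eq : ∀ x y z w → (x ℤ.+ y) ℤ.+ (z ℤ.+ w) ≡ (x ℤ.+ z) ℤ.+ (y ℤ.+ w)
  eq = solve-∀

ascending descending : Fin n × Fin n → Vec ℤ n
ascending (i , j)  = ε i ⊖ ε j
descending (r , s) = 𝟘 ⊖ (ε r ⊕ ε s)

-- The exponents of the factors that contain x₁: x₁/xⱼ for δ = 1 and 1/(x₁xⱼ) for δ = -1.
spoke : ℤ → Fin n → Vec ℤ (suc n)
spoke δ j = δ ∷ (𝟘 ⊖ ε j)

ascending-suc : ∀ n → List.map ascending (pairs< (suc n)) ≡
  List.map (spoke 1ℤ) (allFin n) ++ List.map (0ℤ ∷_) (List.map ascending (pairs< n))
ascending-suc n = ≡.trans (≡.cong (List.map ascending) (pairs<-suc n)) (≡.trans (List.map-++ ascending (List.map (λ j → zero , suc j) (allFin n)) _)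
  (≡.cong₂ _++_ (≡.sym (List.map-∘ (allFin n))) (≡.trans (≡.sym (List.map-∘ (pairs< n))) (List.map-∘ (pairs< n)))))

descending-suc : ∀ n → List.map descending (pairs< (suc n)) ≡
  List.map (spoke -1ℤ) (allFin n) ++ List.map (0ℤ ∷_) (List.map descending (pairs< n))
descending-suc n = ≡.trans (≡.cong (List.map descending) (pairs<-suc n)) (≡.trans (List.map-++ descending (List.map (λ j → zero , suc j) (allFin n)) _)
  (≡.cong₂ _++_ (≡.trans (≡.sym (List.map-∘ (allFin n))) (List.map-cong (λ j → ≡.cong (λ w → -1ℤ ∷ (𝟘 ⊖ w)) (𝟘-⊕ (ε j))) (allFin n)))
    (≡.trans (≡.sym (List.map-∘ (pairs< n))) (List.map-∘ (pairs< n)))))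

record IntegerHomomorphism (R : CommutativeRing 0ℓ 0ℓ) : Set where
  open Ring R
  field
    ι   : ℤ → Carrier
    ι-0 : ι 0ℤ ≈ 0#
    ι-1 : ι 1ℤ ≈ 1#
    ι-+ : ∀ x y → ι (x ℤ.+ y) ≈ ι x + ι y
    ι-* : ∀ x y → ι (x ℤ.* y) ≈ ι x * ι y

module Generating (R : CommutativeRing 0ℓ 0ℓ) (q : CommutativeRing.Carrier R) (K : ℕ)
  (q^K≈0 : Nilpotent R q K) (0<K : 0 ℕ.< K)
  (integers : IntegerHomomorphism R) where
  open Ring R
  open IntegerHomomorphism integers
  open Alt R
  open Raising R K using (raise)
  open Jing R q K K q^K≈0 ℕ.≤-refl using (F; δ₀)

  -- P paired with the linear functional x^γ ↦ g γ.
  pair : XSeries n → (Vec ℤ n → Carrier) → Carrier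
  pair P g = sum (upTo K) (λ k → q ^ k * sum (P k) (λ (c , γ) → ι c * g γ))

  q^-big : ∀ k → K ℕ.≤ k → q ^ k ≈ 0#
  q^-big k K≤k = trans (reflexive (≡.cong (q ^_) (≡.sym (ℕ.m+[n∸m]≡n K≤k))))
    (trans (^-homo-* q K (k ℕ.∸ K)) (trans (*-congʳ q^K≈0) (zeroˡ _)))

  pair-1ˢ : ∀ (g : Vec ℤ n → Carrier) → pair 1ˢ g ≈ g 𝟘
  pair-1ˢ g = begin
    sum (upTo K) (λ k → q ^ k * sum (1ˢ k) (λ (c , γ) → ι c * g γ))
      ≈⟨ sum-upTo-extend 1 K _ 0<K (λ { (suc k) _ → zeroʳ _ }) ⟩
    1# * (ι 1ℤ * g 𝟘 + 0#) + 0#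
      ≈⟨ trans (+-identityʳ _) (trans (*-identityˡ _) (trans (+-identityʳ _) (trans (*-congʳ ι-1) (*-identityˡ _)))) ⟩
    g 𝟘 ∎

  pair-geometric : ∀ (α : Vec ℤ n) g → pair (1/1-qx^ α) g ≈ sum (upTo K) (λ k → q ^ k * g (k · α))
  pair-geometric α g = sum-cong (upTo K) λ k → *-congˡ (trans (+-identityʳ _) (trans (*-congʳ ι-1) (*-identityˡ _)))

  -- Terms with i + j ≥ K carry q^(i+j) ≈ 0, so the triangle of the Cauchy product may be completed
  -- to a square, which factors.
  pair-*ˢ : ∀ (P Q : XSeries n) g → pair (P *ˢ Q) g ≈ pair P (λ γ → pair Q (λ γ′ → g (γ ⊕ γ′)))
  pair-*ˢ P Q g = begin
    sum (upTo K) (λ k → q ^ k * sum ((P *ˢ Q) k) (λ (c , γ) → ι c * g γ))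
      ≈⟨ sum-cong (upTo K) (λ k → trans (*-congˡ (trans (sum-concatMap (λ i → P i *ᴸ Q (k ℕ.∸ i)) (upTo (suc k)) _)
           (sum-cong (upTo (suc k)) (λ i → sum-cartesianProductWith _ (P i) (Q (k ℕ.∸ i)) _))))
           (trans (sum-* _ (upTo (suc k)) _) (sum-upTo-cong (suc k) (λ i i<k → *-congʳ
             (reflexive (≡.cong (q ^_) (≡.sym (ℕ.m+[n∸m]≡n (ℕ.≤-pred i<k))))))))) ⟩
    sum (upTo K) (λ k → sum (upTo (suc k)) (λ i → W i (k ℕ.∸ i)))
      ≈⟨ sum-diagonal K W ⟩
    sum (upTo K) (λ i → sum (upTo (K ℕ.∸ i)) (W i))
      ≈⟨ sum-cong (upTo K) (λ i → sum-upTo-extend (K ℕ.∸ i) K (W i) (ℕ.m∸n≤m K i)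
           (λ j K∸i≤j → trans (*-congʳ (q^-big (i ℕ.+ j) (ℕ.≤-trans (ℕ.m≤n+m∸n K i) (ℕ.+-monoʳ-≤ i K∸i≤j)))) (zeroˡ _))) ⟨
    sum (upTo K) (λ i → sum (upTo K) (W i))
      ≈⟨ sum-cong (upTo K) (λ i → trans (sum-cong (upTo K) (λ j → split i j)) (sym (sum-* _ (upTo K) _))) ⟩
    sum (upTo K) (λ i → q ^ i * sum (upTo K) (λ j → q ^ j * V i j))
      ≈⟨ sum-cong (upTo K) (λ i → *-congˡ (exchange i)) ⟩
    sum (upTo K) (λ i → q ^ i * sum (P i) (λ (c , γ) → ι c * pair Q (λ γ′ → g (γ ⊕ γ′)))) ∎
    where
    V W : ℕ → ℕ → Carrier
    V i j = sum (P i) (λ (c , γ) → sum (Q j) (λ (d , γ′) → ι (c ℤ.* d) * g (γ ⊕ γ′)))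
    W i j = q ^ (i ℕ.+ j) * V i j
    split : ∀ i j → W i j ≈ q ^ i * (q ^ j * V i j)
    split i j = trans (*-congʳ (^-homo-* q i j)) (*-assoc _ _ _)
    exchange : ∀ i → sum (upTo K) (λ j → q ^ j * V i j) ≈ sum (P i) (λ (c , γ) → ι c * pair Q (λ γ′ → g (γ ⊕ γ′)))
    exchange i = trans (sum-cong (upTo K) (λ j → sum-* (q ^ j) (P i) _)) (trans (sum-swap (upTo K) (P i) _)
      (sum-cong (P i) (λ (c , γ) → trans (sum-cong (upTo K) (λ j → trans
        (*-congˡ (trans (sum-cong (Q j) (λ (d , γ′) → trans (*-congʳ (ι-* c d)) (*-assoc _ _ _))) (sym (sum-* (ι c) (Q j) _))))
        (solve 3 (λ a b c → a :* (b :* c) := b :* (a :* c)) refl _ _ _))) (sym (sum-* (ι c) (upTo K) _)))))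

  -- The functional `pair` for the product of the series 1/(1 - q x^α), factor by factor (`pair-∏`).
  iterate : List (Vec ℤ n) → (Vec ℤ n → Carrier) → Carrier
  iterate []       g = g 𝟘
  iterate (α ∷ αs) g = sum (upTo K) (λ k → q ^ k * iterate αs (λ γ → g (k · α ⊕ γ)))

  pair-∏ : ∀ {A : Set} (xs : List A) (a : A → Vec ℤ n) g → pair (∏ xs (λ x → 1/1-qx^ (a x))) g ≈ iterate (List.map a xs) g
  pair-∏ []       a g = pair-1ˢ g
  pair-∏ (x ∷ xs) a g = trans (pair-*ˢ (1/1-qx^ (a x)) (∏ xs (λ x → 1/1-qx^ (a x))) g)
    (trans (pair-geometric (a x) (λ γ → pair (∏ xs (λ x → 1/1-qx^ (a x))) (λ γ′ → g (γ ⊕ γ′))))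
      (sum-cong (upTo K) (λ k → *-congˡ (pair-∏ xs a (λ γ′ → g (k · a x ⊕ γ′))))))

  iterate-cong : ∀ (αs : List (Vec ℤ n)) {g h} → (∀ γ → g γ ≈ h γ) → iterate αs g ≈ iterate αs h
  iterate-cong []       eq = eq 𝟘
  iterate-cong (α ∷ αs) eq = sum-cong (upTo K) (λ k → *-congˡ (iterate-cong αs (λ γ → eq _)))

  iterate-* : ∀ (αs : List (Vec ℤ n)) c g → iterate αs (λ γ → c * g γ) ≈ c * iterate αs g
  iterate-* []       c g = refl
  iterate-* (α ∷ αs) c g = trans (sum-cong (upTo K) (λ k → trans (*-congˡ (iterate-* αs c _))
    (solve 3 (λ a b c → a :* (b :* c) := b :* (a :* c)) refl _ _ _))) (sym (sum-* c (upTo K) _))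

  iterate-sum : ∀ {X : Set} (αs : List (Vec ℤ n)) (xs : List X) (g : X → Vec ℤ n → Carrier) →
    iterate αs (λ γ → sum xs (λ x → g x γ)) ≈ sum xs (λ x → iterate αs (g x))
  iterate-sum []       xs g = refl
  iterate-sum (α ∷ αs) xs g = trans (sum-cong (upTo K) (λ k → trans (*-congˡ (iterate-sum αs xs _)) (sum-* _ xs _)))
    (sum-swap (upTo K) xs _)

  iterate-swap : ∀ {m} (αs : List (Vec ℤ n)) (βs : List (Vec ℤ m)) (h : Vec ℤ n → Vec ℤ m → Carrier) →
    iterate αs (λ γ → iterate βs (h γ)) ≈ iterate βs (λ γ′ → iterate αs (λ γ → h γ γ′))
  iterate-swap []       βs h = refl
  iterate-swap (α ∷ αs) βs h = trans
    (sum-cong (upTo K) (λ k → trans (*-congˡ (iterate-swap αs βs _)) (sym (iterate-* βs _ _))))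
    (sym (iterate-sum βs (upTo K) _))

  iterate-++ : ∀ (αs βs : List (Vec ℤ n)) g → iterate (αs ++ βs) g ≈ iterate αs (λ γ → iterate βs (λ γ′ → g (γ ⊕ γ′)))
  iterate-++ []       βs g = iterate-cong βs (λ γ → reflexive (≡.cong g (≡.sym (𝟘-⊕ γ))))
  iterate-++ (α ∷ αs) βs g = sum-cong (upTo K) (λ k → *-congˡ (trans (iterate-++ αs βs _)
    (iterate-cong αs (λ γ → iterate-cong βs (λ γ′ → reflexive (≡.cong g (≡.sym (⊕-assoc (k · α) γ γ′))))))))

  iterate-map : ∀ {m} (φ : Vec ℤ n → Vec ℤ m) → φ 𝟘 ≡ 𝟘 → (∀ k α γ → k · φ α ⊕ φ γ ≡ φ (k · α ⊕ γ)) →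
    ∀ αs g → iterate (List.map φ αs) g ≈ iterate αs (λ γ → g (φ γ))
  iterate-map φ φ-𝟘 φ-⊕ []       g = reflexive (≡.cong g (≡.sym φ-𝟘))
  iterate-map φ φ-𝟘 φ-⊕ (α ∷ αs) g = sum-cong (upTo K) (λ k → *-congˡ (trans (iterate-map φ φ-𝟘 φ-⊕ αs _)
    (iterate-cong αs (λ γ → reflexive (≡.cong g (φ-⊕ k α γ))))))

  iterate-0∷ : ∀ αs (g : Vec ℤ (suc n) → Carrier) → iterate (List.map (0ℤ ∷_) αs) g ≈ iterate αs (λ γ → g (0ℤ ∷ γ))
  iterate-0∷ = iterate-map (0ℤ ∷_) ≡.refl (λ k α γ → ≡.cong (_∷ (k · α ⊕ γ)) (≡.cong (ℤ._+ 0ℤ) (ℤ.*-zeroʳ (+ k))))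

  -- Subtracting k times the j-th spoke from the target exponent lowers the exponent of x₁ by δ k
  -- and raises that of xⱼ by k. With one spoke per coordinate this is the product operator of
  -- `raise`.
  iterate-spokes : ∀ δ (φ : ℤ → Fun n) b v →
    iterate (List.map (spoke δ) (allFin n)) (λ γ → φ (b ℤ.- head γ) (v ⊖ tail γ)) ≈ Tens (raise q δ) φ b v
  iterate-spokes {zero}  δ φ b [] = reflexive (≡.cong (λ b → φ b []) (ℤ.+-identityʳ b))
  iterate-spokes {suc n} δ φ b (x ∷ v) = begin
    iterate (List.map (spoke δ) (allFin (suc n))) (λ γ → φ (b ℤ.- head γ) ((x ∷ v) ⊖ tail γ))
      ≡⟨ ≡.cong (λ αs → iterate αs (λ γ → φ (b ℤ.- head γ) ((x ∷ v) ⊖ tail γ))) spokes ⟩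
    sum (upTo K) (λ k → q ^ k * iterate (List.map widen (List.map (spoke δ) (allFin n))) (λ γ → φ (b ℤ.- head (k · α ⊕ γ)) ((x ∷ v) ⊖ tail (k · α ⊕ γ))))
      ≈⟨ sum-cong (upTo K) (λ k → *-congˡ (trans
           (iterate-map widen ≡.refl widen-⊕ (List.map (spoke δ) (allFin n)) _)
           (trans (iterate-cong (List.map (spoke δ) (allFin n)) (λ γ → reflexive (step k γ)))
             (iterate-spokes δ (λ b v → φ b (x ℤ.+ + k ∷ v)) (b ℤ.- δ ℤ.* + k) v)))) ⟩
    sum (upTo K) (λ k → q ^ k * Tens (raise q δ) (λ b v → φ b (x ℤ.+ + k ∷ v)) (b ℤ.- δ ℤ.* + k) v)
      ≈⟨ sum-map _ (upTo K) _ ⟨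
    Tens (raise q δ) φ b (x ∷ v) ∎
    where
    α : Vec ℤ (suc (suc n))
    α = δ ∷ -1ℤ ∷ (𝟘 ⊖ 𝟘)
    widen : Vec ℤ (suc n) → Vec ℤ (suc (suc n))
    widen (a ∷ γ) = a ∷ 0ℤ ∷ γ
    widen-⊕ : ∀ k α γ → k · widen α ⊕ widen γ ≡ widen (k · α ⊕ γ)
    widen-⊕ k (a ∷ α) (c ∷ γ) = ≡.cong (λ z → + k ℤ.* a ℤ.+ c ∷ z ∷ (k · α ⊕ γ)) (≡.cong (ℤ._+ 0ℤ) (ℤ.*-zeroʳ (+ k)))
    spokes : List.map (spoke δ) (allFin (suc n)) ≡ α ∷ List.map widen (List.map (spoke δ) (allFin n))
    spokes = ≡.trans (≡.cong (List.map (spoke δ)) (allFin-suc n)) (≡.cong (α ∷_)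
      (≡.trans (≡.sym (List.map-∘ (allFin n))) (List.map-∘ (allFin n))))
    step : ∀ k (γ : Vec ℤ (suc n)) → φ (b ℤ.- head (k · α ⊕ widen γ)) ((x ∷ v) ⊖ tail (k · α ⊕ widen γ)) ≡
      φ ((b ℤ.- δ ℤ.* + k) ℤ.- head γ) (x ℤ.+ + k ∷ (v ⊖ tail γ))
    step k (a ∷ γ) = ≡.cong₂ φ (eq₁ b (+ k) δ a) (≡.cong₂ _∷_ (eq₂ x (+ k))
      (≡.cong (v ⊖_) (≡.trans (≡.cong (_⊕ γ) (·-𝟘⊖𝟘 k n)) (𝟘-⊕ γ))))
      where
      eq₁ : ∀ b k δ a → b ℤ.- (k ℤ.* δ ℤ.+ a) ≡ (b ℤ.- δ ℤ.* k) ℤ.- a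
      eq₁ = solve-∀
      eq₂ : ∀ x k → x ℤ.- (k ℤ.* -1ℤ ℤ.+ 0ℤ) ≡ x ℤ.+ k
      eq₂ = solve-∀

  G : ∀ n → Fun n
  G n v = iterate (List.map ascending (pairs< n)) (λ γ → iterate (List.map descending (pairs< n)) (λ γ′ → [ γ ⊕ γ′ ≟ᵛ v ]∙ 1#))

  ι-coeff : ∀ (β : Vec ℤ n) xs → ι (coeff β xs) ≈ sum xs (λ (c , γ) → ι c * ([ γ ≟ᵛ β ]∙ 1#))
  ι-coeff β []             = ι-0
  ι-coeff β ((c , γ) ∷ xs) = trans (ι-+ _ _) (+-cong term (ι-coeff β xs))
    where
    term : ι (if does (γ ≟ᵛ β) then c else 0ℤ) ≈ ι c * ([ γ ≟ᵛ β ]∙ 1#)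
    term with does (γ ≟ᵛ β)
    ... | true  = sym (*-identityʳ _)
    ... | false = trans ι-0 (sym (zeroʳ _))

  sum-coeff≈G : (β : Vec ℤ n) → sum (upTo K) (λ k → q ^ k * ι (coeff β (generating n k))) ≈ G n β
  sum-coeff≈G {n} β = begin
    sum (upTo K) (λ k → q ^ k * ι (coeff β (generating n k)))
      ≈⟨ sum-cong (upTo K) (λ k → *-congˡ (ι-coeff β (generating n k))) ⟩
    pair (generating n) (λ γ → [ γ ≟ᵛ β ]∙ 1#)
      ≈⟨ trans (pair-*ˢ (∏ (pairs< n) (λ p → 1/1-qx^ (ascending p))) (∏ (pairs< n) (λ p → 1/1-qx^ (descending p))) _)
           (trans (pair-∏ (pairs< n) ascending _) (iterate-cong (List.map ascending (pairs< n)) (λ γ → pair-∏ (pairs< n) descending _))) ⟩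
    G n β ∎

  δ₀-indicator : ∀ z → [ z ℤ.≟ 0ℤ ]∙ 1# ≈ δ₀ z
  δ₀-indicator (+ 0)     = refl
  δ₀-indicator (+ suc _) = refl
  δ₀-indicator -[1+ _ ]  = refl

  -- p and r stem from factors free of x₁, so the first coordinate is a condition on γ and γ′ alone;
  -- the others are the problem in n variables at a shifted target.
  indicator : ∀ b (v : Vec ℤ n) γ γ′ p r → [ (γ ⊕ (0ℤ ∷ p)) ⊕ (γ′ ⊕ (0ℤ ∷ r)) ≟ᵛ b ∷ v ]∙ 1# ≈
    δ₀ ((b ℤ.- head γ) ℤ.- head γ′) * ([ p ⊕ r ≟ᵛ (v ⊖ tail γ) ⊖ tail γ′ ]∙ 1#)
  indicator b v (h ∷ t) (h′ ∷ t′) p r = trans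
    ([]∙-⇔ (((h ∷ t) ⊕ (0ℤ ∷ p)) ⊕ ((h′ ∷ t′) ⊕ (0ℤ ∷ r)) ≟ᵛ b ∷ v) (b? ×-dec v?) to from)
    (trans product (*-congʳ (δ₀-indicator ((b ℤ.- h) ℤ.- h′))))
    where
    b? = ((b ℤ.- h) ℤ.- h′) ℤ.≟ 0ℤ
    v? = p ⊕ r ≟ᵛ (v ⊖ t) ⊖ t′
    product : [ b? ×-dec v? ]∙ 1# ≈ ([ b? ]∙ 1#) * ([ v? ]∙ 1#)
    product with does b? | does v?
    ... | true  | true  = sym (*-identityˡ _)
    ... | true  | false = sym (zeroʳ _)
    ... | false | _     = sym (zeroˡ _)
    to : ((h ∷ t) ⊕ (0ℤ ∷ p)) ⊕ ((h′ ∷ t′) ⊕ (0ℤ ∷ r)) ≡ b ∷ v → (b ℤ.- h) ℤ.- h′ ≡ 0ℤ × p ⊕ r ≡ (v ⊖ t) ⊖ t′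
    to ≡.refl = eq h h′ , ≡.sym (≡.trans (≡.cong (λ w → (w ⊖ t) ⊖ t′) (⊕-interchange t p t′ r)) (⊖⊖⊕ t t′ (p ⊕ r)))
      where
      eq : ∀ h h′ → (((h ℤ.+ 0ℤ) ℤ.+ (h′ ℤ.+ 0ℤ)) ℤ.- h) ℤ.- h′ ≡ 0ℤ
      eq = solve-∀
    from : (b ℤ.- h) ℤ.- h′ ≡ 0ℤ × p ⊕ r ≡ (v ⊖ t) ⊖ t′ → ((h ∷ t) ⊕ (0ℤ ∷ p)) ⊕ ((h′ ∷ t′) ⊕ (0ℤ ∷ r)) ≡ b ∷ v
    from (e , e′) = ≡.cong₂ _∷_ (≡.trans (eq h h′) (≡.trans (≡.cong (ℤ._+_ (h ℤ.+ h′)) (≡.sym e)) (eq′ b h h′)))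
      (≡.trans (⊕-interchange t p t′ r) (≡.trans (≡.cong ((t ⊕ t′) ⊕_) e′) (⊕⊖⊖ t t′ v)))
      where
      eq : ∀ h h′ → (h ℤ.+ 0ℤ) ℤ.+ (h′ ℤ.+ 0ℤ) ≡ (h ℤ.+ h′) ℤ.+ 0ℤ
      eq = solve-∀
      eq′ : ∀ b h h′ → (h ℤ.+ h′) ℤ.+ ((b ℤ.- h) ℤ.- h′) ≡ b
      eq′ = solve-∀

  -- `iterate-swap` brings the two families of factors with x₁ to the outside, where they are the
  -- two raisings; the factors inside form the case n.
  G≈F : ∀ n v → G n v ≈ F n v
  G≈F zero    [] = refl
  G≈F (suc n) (b ∷ v) = begin
    G (suc n) (b ∷ v)
      ≡⟨ ≡.cong₂ (λ as ds → iterate as (λ γ → iterate ds (λ γ′ → I (γ ⊕ γ′)))) (ascending-suc n) (descending-suc n) ⟩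
    iterate (↑ ++ List.map (0ℤ ∷_) as) (λ γ → iterate (↓ ++ List.map (0ℤ ∷_) ds) (λ γ′ → I (γ ⊕ γ′)))
      ≈⟨ trans (iterate-++ ↑ (List.map (0ℤ ∷_) as) _) (iterate-cong ↑ (λ γ → trans (iterate-0∷ as _) (iterate-cong as (λ p →
           trans (iterate-++ ↓ (List.map (0ℤ ∷_) ds) _) (iterate-cong ↓ (λ γ′ → iterate-0∷ ds _)))))) ⟩
    iterate ↑ (λ γ → iterate as (λ p → iterate ↓ (λ γ′ → iterate ds (λ r → I ((γ ⊕ (0ℤ ∷ p)) ⊕ (γ′ ⊕ (0ℤ ∷ r)))))))
      ≈⟨ iterate-cong ↑ (λ γ → trans (iterate-swap as ↓ _) (iterate-cong ↓ (λ γ′ → trans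
           (iterate-cong as (λ p → trans (iterate-cong ds (λ r → indicator b v γ γ′ p r)) (iterate-* ds _ _)))
           (trans (iterate-* as _ _) (*-congˡ (G≈F n ((v ⊖ tail γ) ⊖ tail γ′))))))) ⟩
    iterate ↑ (λ γ → iterate ↓ (λ γ′ → δ₀ ((b ℤ.- head γ) ℤ.- head γ′) * F n ((v ⊖ tail γ) ⊖ tail γ′)))
      ≈⟨ iterate-cong ↑ (λ γ → iterate-spokes -1ℤ (λ b v → δ₀ b * F n v) (b ℤ.- head γ) (v ⊖ tail γ)) ⟩
    iterate ↑ (λ γ → Tens (raise q -1ℤ) (λ b v → δ₀ b * F n v) (b ℤ.- head γ) (v ⊖ tail γ))
      ≈⟨ iterate-spokes 1ℤ (Tens (raise q -1ℤ) (λ b v → δ₀ b * F n v)) b v ⟩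
    F (suc n) (b ∷ v) ∎
    where
    ↑ = List.map (spoke 1ℤ) (allFin n)
    ↓ = List.map (spoke -1ℤ) (allFin n)
    as = List.map ascending (pairs< n)
    ds = List.map descending (pairs< n)
    I : Vec ℤ (suc n) → Carrier
    I w = [ w ≟ᵛ b ∷ v ]∙ 1#

-- Sums over permutations

-- One-line notations of permutations, built by choosing the first value.
data Arrangement : Vec (Fin n) n → Set where
  []  : Arrangement []
  _∷_ : ∀ i {τ : Vec (Fin n) n} → Arrangement τ → Arrangement (i ∷ Vec.map (punchIn i) τ)

punchIn-<ᵇ : ∀ (i : Fin (suc n)) x y → (toℕ (punchIn i x) <ᵇ toℕ (punchIn i y)) ≡ (toℕ x <ᵇ toℕ y)
punchIn-<ᵇ zero    x       y       = ≡.refl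
punchIn-<ᵇ (suc i) zero    zero    = ≡.refl
punchIn-<ᵇ (suc i) zero    (suc y) = ≡.refl
punchIn-<ᵇ (suc i) (suc x) zero    = ≡.refl
punchIn-<ᵇ (suc i) (suc x) (suc y) = punchIn-<ᵇ i x y

punchIn-<ᵇ-above : ∀ (i : Fin (suc n)) y c → c ℕ.≤ toℕ i → (toℕ (punchIn i y) <ᵇ c) ≡ (toℕ y <ᵇ c)
punchIn-<ᵇ-above i       y       zero    _         = ≡.refl
punchIn-<ᵇ-above (suc i) zero    (suc c) _         = ≡.refl
punchIn-<ᵇ-above (suc i) (suc y) (suc c) (s≤s c≤i) = punchIn-<ᵇ-above i y c c≤i

punchIn-<ᵇ-below : ∀ (i : Fin (suc n)) y c → toℕ i ℕ.≤ c → (toℕ (punchIn i y) <ᵇ suc c) ≡ (toℕ y <ᵇ c)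
punchIn-<ᵇ-below zero    y       c       _         = ≡.refl
punchIn-<ᵇ-below (suc i) zero    (suc c) _         = ≡.refl
punchIn-<ᵇ-below (suc i) (suc y) (suc c) (s≤s i≤c) = punchIn-<ᵇ-below i y c i≤c

below : ∀ {k} → ℕ → Vec (Fin k) m → ℕ
below c []      = 0
below c (y ∷ v) = (if toℕ y <ᵇ c then 1 else 0) ℕ.+ below c v

below-map : ∀ {k l} c d (φ : Fin k → Fin l) → (∀ y → (toℕ (φ y) <ᵇ c) ≡ (toℕ y <ᵇ d)) →
  (v : Vec (Fin k) m) → below c (Vec.map φ v) ≡ below d v
below-map c d φ eq []      = ≡.refl
below-map c d φ eq (y ∷ v) = ≡.cong₂ (λ b s → (if b then 1 else 0) ℕ.+ s) (eq y) (below-map c d φ eq v)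

-- If the first value i is below c it counts 1, and undoing `punchIn i` lowers the bound for the
-- other values by that 1. Otherwise neither happens.
below-arrangement : ∀ {τ : Vec (Fin n) n} c → c ℕ.≤ n → Arrangement τ → below c τ ≡ c
below-arrangement zero _ [] = ≡.refl
below-arrangement c c≤n (_∷_ {n} i {τ} arr) with toℕ i ℕ.<? c
... | no i≮c = ≡.cong₂ ℕ._+_ (≡.cong (if_then 1 else 0) (<ᵇ-false i≮c))
      (≡.trans (below-map c c (punchIn i) (λ y → punchIn-<ᵇ-above i y c (ℕ.≮⇒≥ i≮c)) τ)
        (below-arrangement c (ℕ.≤-trans (ℕ.≮⇒≥ i≮c) (ℕ.≤-pred (Fin.toℕ<n i))) arr))
  where
  <ᵇ-false : ∀ {a b} → ¬ (a ℕ.< b) → (a <ᵇ b) ≡ false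
  <ᵇ-false {a} {zero} ¬p = ≡.refl
  <ᵇ-false {zero} {suc b} ¬p with () ← ¬p (s≤s z≤n)
  <ᵇ-false {suc a} {suc b} ¬p = <ᵇ-false {a} {b} (λ p → ¬p (s≤s p))
below-arrangement (suc c) (s≤s c≤n) (_∷_ {n} i {τ} arr) | yes (s≤s i≤c) = ≡.cong₂ ℕ._+_ (≡.cong (if_then 1 else 0) (<ᵇ-true i≤c))
      (≡.trans (below-map (suc c) c (punchIn i) (λ y → punchIn-<ᵇ-below i y c i≤c) τ) (below-arrangement c c≤n arr))
  where
  <ᵇ-true : ∀ {a b} → a ℕ.≤ b → (a <ᵇ suc b) ≡ true
  <ᵇ-true z≤n     = ≡.refl
  <ᵇ-true (s≤s p) = <ᵇ-true p

length-filter-map : ∀ {A B : Set} {P : B → Set} {Q : A → Set} (P? : ∀ b → Dec (P b)) (Q? : ∀ a → Dec (Q a)) (φ : A → B) →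
  (∀ a → does (P? (φ a)) ≡ does (Q? a)) → ∀ xs → length (filter P? (List.map φ xs)) ≡ length (filter Q? xs)
length-filter-map P? Q? φ eq []       = ≡.refl
length-filter-map P? Q? φ eq (x ∷ xs) with does (P? (φ x)) | does (Q? x) | eq x
... | true  | _ | ≡.refl = ≡.cong suc (length-filter-map P? Q? φ eq xs)
... | false | _ | ≡.refl = length-filter-map P? Q? φ eq xs

below-lookup : ∀ {k} c (v : Vec (Fin k) m) → length (filter (λ j → toℕ (lookup v j) ℕ.<? c) (allFin m)) ≡ below c v
below-lookup c []              = ≡.refl
below-lookup {suc m} c (y ∷ v) = ≡.trans (≡.cong (λ js → length (filter small? js)) (allFin-suc m)) go
  where
  small? : ∀ j → Dec (toℕ (lookup (y ∷ v) j) ℕ.< c)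
  small? j = toℕ (lookup (y ∷ v) j) ℕ.<? c
  tail-count : length (filter small? (List.map suc (allFin m))) ≡ below c v
  tail-count = ≡.trans (length-filter-map small? (λ j → toℕ (lookup v j) ℕ.<? c) suc (λ _ → ≡.refl) (allFin m)) (below-lookup c v)
  go : length (filter small? (zero ∷ List.map suc (allFin m))) ≡ (if toℕ y <ᵇ c then 1 else 0) ℕ.+ below c v
  go with toℕ y <ᵇ c
  ... | true  = ≡.cong suc tail-count
  ... | false = tail-count

-- The first value i exceeds exactly i later ones by `below-arrangement`, and `punchIn i` preserves
-- the order among these.
inversions-∷ : ∀ i {τ : Vec (Fin n) n} → Arrangement τ → inversions (i ∷ Vec.map (punchIn i) τ) ≡ toℕ i ℕ.+ inversions τ
inversions-∷ {n} i {τ} arr = begin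
  length (filter P (pairs< (suc n)))
    ≡⟨ ≡.cong (length ∘ filter P) (pairs<-suc n) ⟩
  length (filter P (List.map (λ j → zero , suc j) (allFin n) ++ List.map suc² (pairs< n)))
    ≡⟨ ≡.trans (≡.cong length (List.filter-++ P (List.map (λ j → zero , suc j) (allFin n)) _)) (List.length-++ (filter P (List.map (λ j → zero , suc j) (allFin n)))) ⟩
  length (filter P (List.map (λ j → zero , suc j) (allFin n))) ℕ.+ length (filter P (List.map suc² (pairs< n)))
    ≡⟨ ≡.cong₂ ℕ._+_ first rest ⟩
  toℕ i ℕ.+ inversions τ ∎
  where
  open ≡.≡-Reasoning
  σ = i ∷ Vec.map (punchIn i) τ
  P : (p : Fin (suc n) × Fin (suc n)) → Dec (lookup σ (proj₂ p) Fin.< lookup σ (proj₁ p))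
  P (a , b) = lookup σ b Fin.<? lookup σ a
  first : length (filter P (List.map (λ j → zero , suc j) (allFin n))) ≡ toℕ i
  first = ≡.trans (length-filter-map P (λ j → toℕ (lookup τ j) ℕ.<? toℕ i) (λ j → zero , suc j)
      (λ j → ≡.trans (≡.cong (λ y → toℕ y <ᵇ toℕ i) (Vec.lookup-map j (punchIn i) τ)) (punchIn-<ᵇ-above i (lookup τ j) (toℕ i) ℕ.≤-refl)) (allFin n))
    (≡.trans (below-lookup (toℕ i) τ) (below-arrangement (toℕ i) (ℕ.≤-pred (Fin.toℕ<n i)) arr))
  rest : length (filter P (List.map suc² (pairs< n))) ≡ inversions τ
  rest = length-filter-map P (λ (a , b) → lookup τ b Fin.<? lookup τ a) suc²
    (λ (a , b) → ≡.trans (≡.cong₂ (λ x y → toℕ x <ᵇ toℕ y) (Vec.lookup-map b (punchIn i) τ) (Vec.lookup-map a (punchIn i) τ))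
      (punchIn-<ᵇ i (lookup τ b) (lookup τ a))) (pairs< n)

without : ∀ {A : Set} → Fin (suc n) → Vec A (suc n) → Vec A n
without zero            (x ∷ v) = v
without {suc n} (suc i) (x ∷ v) = x ∷ without i v

lookup-without : ∀ {A : Set} (i : Fin (suc n)) (v : Vec A (suc n)) j → lookup (without i v) j ≡ lookup v (punchIn i j)
lookup-without zero    (x ∷ v) j       = ≡.refl
lookup-without (suc i) (x ∷ v) zero    = ≡.refl
lookup-without (suc i) (x ∷ v) (suc j) = lookup-without i v j

permute-∷ : ∀ i (τ : Vec (Fin n) n) β → permute (i ∷ Vec.map (punchIn i) τ) β ≡ lookup β i ∷ permute τ (without i β)
permute-∷ i τ β = ≡.cong (lookup β i ∷_) (≡.trans (≡.sym (Vec.map-∘ (lookup β) (punchIn i) τ))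
  (Vec.map-cong (λ j → ≡.sym (lookup-without i β j)) τ))

Distinct : Vec (Fin n) m → Set
Distinct = AllPairs (λ i j → ¬ i ≡ j)

distinct? : (w : Vec (Fin n) m) → Dec (Distinct w)
distinct? = allPairs? (λ i j → ¬? (i Fin.≟ j))

apart? : ∀ i (w : Vec (Fin n) m) → Dec (All (λ j → ¬ i ≡ j) w)
apart? i = all? (λ j → ¬? (i Fin.≟ j))

distinct-punchIn : ∀ (i : Fin (suc n)) {w : Vec (Fin n) m} → Distinct w → Distinct (Vec.map (punchIn i) w)
distinct-punchIn i d = VecAP.map⁺ (VecAP.map (λ ne eq → ne (Fin.punchIn-injective i _ _ eq)) d)

distinct-punchIn⁻ : ∀ (i : Fin (suc n)) (w : Vec (Fin n) m) → Distinct (Vec.map (punchIn i) w) → Distinct w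
distinct-punchIn⁻ i []      []       = []
distinct-punchIn⁻ i (j ∷ w) (p ∷ ps) = All.map (λ ne eq → ne (≡.cong (punchIn i) eq)) (All.map⁻ p) ∷ distinct-punchIn⁻ i w ps

module Permutations (R : CommutativeRing 0ℓ 0ℓ) where
  open Ring R
  open Alt R

  arrange : ∀ n → (Vec (Fin n) n → Carrier) → Carrier
  arrange zero    h = h []
  arrange (suc n) h = sum (allFin (suc n)) (λ i → arrange n (λ τ → h (i ∷ Vec.map (punchIn i) τ)))

  arrange-cong : ∀ n {h h′} → (∀ τ → Arrangement τ → h τ ≈ h′ τ) → arrange n h ≈ arrange n h′
  arrange-cong zero    eq = eq [] []
  arrange-cong (suc n) eq = sum-cong (allFin (suc n)) (λ i → arrange-cong n (λ τ arr → eq _ (i ∷ arr)))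

  arrange-* : ∀ n c h → arrange n (λ τ → c * h τ) ≈ c * arrange n h
  arrange-* zero    c h = refl
  arrange-* (suc n) c h = trans (sum-cong (allFin (suc n)) (λ i → arrange-* n c _)) (sym (sum-* c (allFin (suc n)) _))

  sum-allFin-suc : ∀ n h → sum (allFin (suc n)) h ≈ h zero + sum (allFin n) (λ j → h (suc j))
  sum-allFin-suc n h = trans (reflexive (≡.cong (λ is → sum is h) (allFin-suc n))) (+-congˡ (sum-map suc (allFin n) h))

  sum-allFin-punchIn : ∀ (i : Fin (suc n)) h → sum (allFin (suc n)) (λ j → [ ¬? (i Fin.≟ j) ]∙ h j) ≈ sum (allFin n) (λ j → h (punchIn i j))
  sum-allFin-punchIn {n} zero    h = trans (sum-allFin-suc n (λ j → [ ¬? (zero Fin.≟ j) ]∙ h j)) (+-identityˡ _)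
  sum-allFin-punchIn {suc n} (suc i) h = trans (sum-allFin-suc (suc n) (λ j → [ ¬? (suc i Fin.≟ j) ]∙ h j))
    (trans (+-congˡ (sum-allFin-punchIn i (λ j → h (suc j)))) (sym (sum-allFin-suc n (λ j → h (punchIn (suc i) j)))))

  []∙-× : ∀ {P Q S : Set} (P? : Dec P) (Q? : Dec Q) (S? : Dec S) {a} → (S → P × Q) → (P → Q → S) → [ S? ]∙ a ≈ [ P? ]∙ ([ Q? ]∙ a)
  []∙-× (yes p) Q? S? to from = []∙-⇔ S? Q? (λ s → proj₂ (to s)) (from p)
  []∙-× (no ¬p) Q? S? to from = []∙-false S? _ (λ s → ¬p (proj₁ (to s)))

  -- `punchIn i` enumerates the letters other than i, hence letterwise the words that avoid i.
  sum-words-punchIn : ∀ (i : Fin (suc n)) m (h : Vec (Fin (suc n)) m → Carrier) →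
    sum (words (allFin (suc n)) m) (λ w → [ apart? i w ]∙ h w) ≈ sum (words (allFin n) m) (λ w → h (Vec.map (punchIn i) w))
  sum-words-punchIn i zero h = refl
  sum-words-punchIn {n} i (suc m) h = begin
    sum (words (allFin (suc n)) (suc m)) (λ w → [ apart? i w ]∙ h w)
      ≈⟨ sum-cartesianProductWith Vec._∷_ (allFin (suc n)) (words (allFin (suc n)) m) _ ⟩
    sum (allFin (suc n)) (λ j → sum (words (allFin (suc n)) m) (λ w → [ apart? i (j ∷ w) ]∙ h (j ∷ w)))
      ≈⟨ sum-cong (allFin (suc n)) (λ j → trans (sum-cong (words (allFin (suc n)) m) (λ w →
           []∙-× (¬? (i Fin.≟ j)) (apart? i w) (apart? i (j ∷ w)) (λ { (p ∷ ps) → p , ps }) _∷_))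
           (trans (sym ([]∙-sum (¬? (i Fin.≟ j)) (words (allFin (suc n)) m) _))
             ([]∙-cong (¬? (i Fin.≟ j)) (sum-words-punchIn i m (λ w → h (j ∷ w)))))) ⟩
    sum (allFin (suc n)) (λ j → [ ¬? (i Fin.≟ j) ]∙ sum (words (allFin n) m) (λ w → h (j ∷ Vec.map (punchIn i) w)))
      ≈⟨ sum-allFin-punchIn i _ ⟩
    sum (allFin n) (λ j → sum (words (allFin n) m) (λ w → h (punchIn i j ∷ Vec.map (punchIn i) w)))
      ≈⟨ sum-cartesianProductWith Vec._∷_ (allFin n) (words (allFin n) m) _ ⟨
    sum (words (allFin n) (suc m)) (λ w → h (Vec.map (punchIn i) w)) ∎

  sum-permutations : ∀ n (h : Vec (Fin n) n → Carrier) → sum (permutations n) h ≈ arrange n h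
  sum-permutations n h = trans (sum-filter distinct? (words (allFin n) n) h) (go n h)
    where
    go : ∀ n h → sum (words (allFin n) n) (λ w → [ distinct? w ]∙ h w) ≈ arrange n h
    go zero    h = +-identityʳ _
    go (suc n) h = trans (sum-cartesianProductWith Vec._∷_ (allFin (suc n)) (words (allFin (suc n)) n) _)
      (sum-cong (allFin (suc n)) (λ i → trans
        (sum-cong (words (allFin (suc n)) n) (λ w → []∙-× (apart? i w) (distinct? w) (distinct? (i ∷ w)) (λ { (p ∷ ps) → p , ps }) _∷_))
        (trans (sum-words-punchIn i n (λ w → [ distinct? w ]∙ h (i ∷ w)))
        (trans (sum-cong (words (allFin n) n) (λ w → []∙-⇔ (distinct? (Vec.map (punchIn i) w)) (distinct? w) (distinct-punchIn⁻ i w) (distinct-punchIn i)))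
          (go n (λ τ → h (i ∷ Vec.map (punchIn i) τ)))))))

  pickSum-expand : ∀ (g : ℤ → Fun n) β →
    pickSum g β ≈ sum (allFin (suc n)) (λ i → (- 1#) ^ toℕ i * g (lookup β i) (without i β))
  pickSum-expand {zero}  g (x ∷ []) = sym (trans (+-identityʳ _) (*-identityˡ _))
  pickSum-expand {suc n} g (x ∷ β)  = begin
    g x β - pickSum (λ z γ → g z (x ∷ γ)) β
      ≈⟨ +-cong (sym (*-identityˡ _)) (trans (-‿cong (pickSum-expand (λ z γ → g z (x ∷ γ)) β)) (sum-neg (allFin (suc n)) _)) ⟩
    1# * g x β + sum (allFin (suc n)) (λ i → - ((- 1#) ^ toℕ i * g (lookup β i) (x ∷ without i β)))
      ≈⟨ +-congˡ (sum-cong (allFin (suc n)) (λ i → solve 2 (λ p y → :- (p :* y) := ((:- :1) :* p) :* y) refl _ _)) ⟩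
    1# * g x β + sum (allFin (suc n)) (λ i → (- 1#) ^ toℕ (Fin.suc i) * g (lookup β i) (x ∷ without i β))
      ≈⟨ sum-allFin-suc (suc n) (λ i → (- 1#) ^ toℕ i * g (lookup (x ∷ β) i) (without i (x ∷ β))) ⟨
    sum (allFin (suc (suc n))) (λ i → (- 1#) ^ toℕ i * g (lookup (x ∷ β) i) (without i (x ∷ β))) ∎

  -- The position of the picked entry is its number of inversions as first value, so the signs of
  -- `pickSum` multiply up to the sign by inversions.
  Alt-arrange : ∀ n (φ : Fun n) β → Alt φ β ≈ arrange n (λ τ → (- 1#) ^ inversions τ * φ (permute τ β))
  Alt-arrange zero    φ [] = sym (*-identityˡ _)
  Alt-arrange (suc n) φ β  = trans (pickSum-expand (λ x → Alt (λ v → φ (x ∷ v))) β)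
    (sum-cong (allFin (suc n)) (λ i → trans (*-congˡ (Alt-arrange n (λ v → φ (lookup β i ∷ v)) (without i β)))
      (trans (sym (arrange-* n _ _)) (arrange-cong n (λ τ arr → trans (sym (*-assoc _ _ _)) (*-cong
        (trans (sym (^-homo-* (- 1#) (toℕ i) (inversions τ))) (reflexive (≡.cong ((- 1#) ^_) (≡.sym (inversions-∷ i arr)))))
        (reflexive (≡.cong φ (≡.sym (permute-∷ i τ β))))))))))

  Alt-permutations : ∀ (φ : Fun n) β → Alt φ β ≈ sum (permutations n) (λ σ → (- 1#) ^ inversions σ * φ (permute σ β))
  Alt-permutations {n} φ β = trans (Alt-arrange n φ β) (sym (sum-permutations n _))

-- The theorem

⊕-wt : ∀ x (κ : Vec ℤ n) → κ ⊕ wt x ≡ move x κ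
⊕-wt (plain zero)    (k ∷ κ) = ≡.cong (k ℤ.+ 1ℤ ∷_) (⊕-𝟘 κ)
⊕-wt (plain (suc r)) (k ∷ κ) = ≡.cong₂ _∷_ (ℤ.+-identityʳ k) (⊕-wt (plain r) κ)
⊕-wt (bar zero)      (k ∷ κ) = ≡.cong (k ℤ.+ -1ℤ ∷_) (⊕-𝟘⊖𝟘 κ)
  where
  ⊕-𝟘⊖𝟘 : ∀ {n} (v : Vec ℤ n) → v ⊕ (𝟘 ⊖ 𝟘) ≡ v
  ⊕-𝟘⊖𝟘 []      = ≡.refl
  ⊕-𝟘⊖𝟘 (x ∷ v) = ≡.cong₂ _∷_ (ℤ.+-identityʳ x) (⊕-𝟘⊖𝟘 v)
⊕-wt (bar (suc r))   (k ∷ κ) = ≡.cong₂ _∷_ (ℤ.+-identityʳ k) (⊕-wt (bar r) κ)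

move-⊕ : ∀ x (κ p : Vec ℤ n) → κ ⊕ (wt x ⊕ p) ≡ move x κ ⊕ p
move-⊕ x κ p = ≡.trans (≡.sym (⊕-assoc κ (wt x) p)) (≡.cong (_⊕ p) (⊕-wt x κ))

HighestFrom : Vec ℤ n → Vec ℤ n → Vec (Letter n) m → Set
HighestFrom {m = m} κ lam w = ((i : Fin m) → IsPartition (κ ⊕ prefixWeight (suc (toℕ i)) w)) × κ ⊕ prefixWeight m w ≡ lam

highest-∷ : ∀ {κ lam : Vec ℤ n} {x} {w : Vec (Letter n) m} → HighestFrom κ lam (x ∷ w) → IsPartition (move x κ) × HighestFrom (move x κ) lam w
highest-∷ {κ = κ} {x = x} {w} (parts , end) =
  ≡.subst IsPartition (≡.trans (move-⊕ x κ 𝟘) (⊕-𝟘 (move x κ))) (parts zero) ,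
  (λ i → ≡.subst IsPartition (move-⊕ x κ _) (parts (suc i))) ,
  ≡.trans (≡.sym (move-⊕ x κ _)) end

highest-∷⁻ : ∀ {κ lam : Vec ℤ n} {x} {w : Vec (Letter n) m} → IsPartition (move x κ) → HighestFrom (move x κ) lam w → HighestFrom κ lam (x ∷ w)
highest-∷⁻ {κ = κ} {x = x} {w} part (parts , end) =
  (λ { zero → ≡.subst IsPartition (≡.sym (≡.trans (move-⊕ x κ 𝟘) (⊕-𝟘 (move x κ)))) part
     ; (suc i) → ≡.subst IsPartition (≡.sym (move-⊕ x κ _)) (parts i) }) ,
  ≡.trans (move-⊕ x κ _) end

module HighestWeights (R : CommutativeRing 0ℓ 0ℓ) (q : CommutativeRing.Carrier R) (n : ℕ) where
  open Ring R
  open Words R q n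

  visits-highest : ∀ {κ lam} (w : Vec (Letter n) m) → HighestFrom κ lam w → visits κ lam w ≈ 1#
  visits-highest {κ = κ} {lam} []      (_ , end) = []∙-true (κ ≟ᵛ lam) 1# (≡.trans (≡.sym (⊕-𝟘 κ)) end)
  visits-highest {κ = κ}       (x ∷ w) hw with highest-∷ {x = x} {w = w} hw
  ... | part , hw′ = trans ([]∙-true (isPartition? (move x κ)) _ part) (visits-highest w hw′)

  visits-other : ∀ {κ lam} (w : Vec (Letter n) m) → ¬ HighestFrom κ lam w → visits κ lam w ≈ 0#
  visits-other {κ = κ} {lam} []      ¬hw = []∙-false (κ ≟ᵛ lam) 1# (λ { ≡.refl → ¬hw ((λ ()) , ⊕-𝟘 κ) })
  visits-other {κ = κ}       (x ∷ w) ¬hw = []∙-vanish (isPartition? (move x κ))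
    (λ part → visits-other w (λ hw → ¬hw (highest-∷⁻ {x = x} {w = w} part hw)))

  visits-indicator : ∀ lam (w : Vec (Letter n) n) → [ isHighestWeight? lam w ]∙ 1# ≈ visits 𝟘 lam w
  visits-indicator lam w = decide (isHighestWeight? lam w)
    where
    decide : (P? : Dec (IsHighestWeight lam w)) → [ P? ]∙ 1# ≈ visits 𝟘 lam w
    decide (yes (parts , end)) = sym (visits-highest w ((λ i → ≡.subst IsPartition (≡.sym (𝟘-⊕ _)) (parts i)) , ≡.trans (𝟘-⊕ _) end))
    decide (no ¬hw) = sym (visits-other w (λ (parts , end) →
      ¬hw ((λ i → ≡.subst IsPartition (𝟘-⊕ _) (parts i)) , ≡.trans (≡.sym (𝟘-⊕ _)) end)))

  sum-E : ∀ lam → sum (E lam) (λ w → q ^ energy w) ≈ sum (words (alphabet n) n) (λ w → visits 𝟘 lam w * q ^ energy w)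
  sum-E lam = trans (sum-filter (isHighestWeight? lam) (words (alphabet n) n) _) (sum-cong (words (alphabet n) n) (λ w → trans
    (trans ([]∙-cong (isHighestWeight? lam w) (sym (*-identityʳ _))) (trans ([]∙-* (isHighestWeight? lam w) _ _) (*-comm _ _)))
    (*-congʳ (visits-indicator lam w))))

unshift-⊖ : (v : Vec ℤ n) → v ⊖ 1ⁿ n ⊖ ρ n ≡ unshift v
unshift-⊖ []              = ≡.refl
unshift-⊖ {suc n} (x ∷ v) = ≡.cong₂ _∷_ (eq x (+ n)) (unshift-⊖ v)
  where
  eq : ∀ x n → (x ℤ.- 1ℤ) ℤ.- (1ℤ ℤ.+ n) ≡ x ℤ.- (1ℤ ℤ.+ (1ℤ ℤ.+ n))
  eq = solve-∀

∣⊕ρ∣ : (v : Vec ℤ n) → ∣ v ⊕ ρ n ∣ ≡ ∣ v ∣ ℤ.+ triangle n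
∣⊕ρ∣ []              = ≡.refl
∣⊕ρ∣ {suc n} (x ∷ v) = ≡.trans (≡.cong (ℤ._+_ (x ℤ.+ + suc n)) (∣⊕ρ∣ v)) (eq x (+ suc n) ∣ v ∣ (triangle n))
  where
  eq : ∀ x k s t → (x ℤ.+ k) ℤ.+ (s ℤ.+ t) ≡ (x ℤ.+ s) ℤ.+ (k ℤ.+ t)
  eq = solve-∀

-- Both sides of the theorem modulo q^K

module Truncation (n K : ℕ) (small : triangle n ℤ.+ + n ℤ.< + K) (0<K : 0 ℕ.< K) where
  open Truncated ℤ.+-*-commutativeRing K
  open Ring seriesRing
  open Alt seriesRing using (Alt; Alt-cong; det)
  open Columns seriesRing using (cols)
  open Jing seriesRing var K K var^L≋0 ℕ.≤-refl using (F; U; D; g; closedU)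
  open Euler seriesRing var using (double; twist; pochhammer)
  open JingMain seriesRing var K K var^L≋0 ℕ.≤-refl using (U≈closedU)
  open HighestWeights seriesRing var n using (sum-E)
  open Words seriesRing var n using (energy-sum)
  open Permutations seriesRing using (Alt-permutations)

  ∑≋sum : ∀ {A : Set} (xs : List A) a → ∑ xs a ≈ sum xs a
  ∑≋sum xs a = mk≋ λ k _ → go xs k
    where
    go : ∀ xs k → ∑ xs a k ≡ sum xs a k
    go []       k = ≡.refl
    go (x ∷ xs) k = ≡.cong (ℤ._+_ (a x k)) (go xs k)

  q^≋var^ : ∀ d → q^ d ≈ var ^ d
  q^≋var^ d = mk≋ λ k _ → go d k
    where
    go : ∀ d k → q^ d k ≡ (var ^ d) k
    go zero    zero    = ≡.refl
    go zero    (suc k) = ≡.refl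
    go (suc d) zero    = ≡.sym (var-⊛-zero (var ^ d))
    go (suc d) (suc k) = ≡.trans (go d k) (≡.sym (var-⊛-suc (var ^ d) k))

  scale≋ : ∀ d a → scale (-1ℤ ℤ.^ d) a ≈ (- 1#) ^ d * a
  scale≋ zero    a = trans (mk≋ λ k _ → ℤ.*-identityˡ (a k)) (sym (*-identityˡ a))
  scale≋ (suc d) a = trans (mk≋ λ k _ → ≡.trans (ℤ.*-assoc -1ℤ (-1ℤ ℤ.^ d) (a k)) (ℤ.-1*i≡-i _))
    (trans (-‿cong (scale≋ d a)) (solve 2 (λ p a → :- (p :* a) := ((:- :1) :* p) :* a) refl ((- 1#) ^ d) a))

  f≋F : (β : Vec ℤ n) → f β ≈ F n β
  f≋F β = trans (sym (mk≋ (λ k k<K → Raising.expand ℤ.+-*-commutativeRing K K (f β) k k<K ℕ.≤-refl)))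
    (trans (sum-coeff≈G β) (G≈F n β))
    where
    constants : IntegerHomomorphism seriesRing
    constants = record { ι = ι ; ι-0 = ι-0 ; ι-1 = refl ; ι-+ = ι-+ ; ι-* = ι-* }
    open Generating seriesRing var K var^L≋0 0<K constants using (sum-coeff≈G; G≈F)

  module _ (lam : Vec ℤ n) (part : IsPartition lam) where
    private
      -- The factor common to both closed forms; u and X differ only in `twist`.
      C : Carrier
      C = pochhammer n * D (lam ⊕ ρ n)
      d : ℤ
      d = + n ℤ.- ∣ lam ∣

      excess-d : + n ℤ.+ triangle n ℤ.- ∣ lam ⊕ ρ n ∣ ≡ d
      excess-d = ≡.trans (≡.cong (λ s → + n ℤ.+ triangle n ℤ.- s) (∣⊕ρ∣ lam)) (eq (+ n) (triangle n) ∣ lam ∣)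
        where
        eq : ∀ n t s → n ℤ.+ t ℤ.- (s ℤ.+ t) ≡ n ℤ.- s
        eq = solve-∀

    u≋ : u lam (1ⁿ n) ≈ C * double (twist g) d
    u≋ = begin
      u lam (1ⁿ n)
        ≈⟨ ∑≋sum (permutations n) _ ⟩
      sum (permutations n) (λ σ → scale (-1ℤ ℤ.^ inversions σ) (f (permute σ (lam ⊕ ρ n) ⊖ 1ⁿ n ⊖ ρ n)))
        ≈⟨ sum-cong (permutations n) (λ σ → trans (scale≋ (inversions σ) _) (*-congˡ (trans (f≋F _)
             (reflexive (≡.cong (F n) (unshift-⊖ (permute σ (lam ⊕ ρ n)))))))) ⟩
      sum (permutations n) (λ σ → (- 1#) ^ inversions σ * F n (unshift (permute σ (lam ⊕ ρ n))))
        ≈⟨ Alt-permutations (λ v → F n (unshift v)) (lam ⊕ ρ n) ⟨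
      U n (lam ⊕ ρ n)
        ≈⟨ U≈closedU n small (lam ⊕ ρ n) (partition⇒positive lam part) ⟩
      closedU n (lam ⊕ ρ n)
        ≈⟨ trans (solve 3 (λ a b c → a :* (b :* c) := (b :* a) :* c) refl _ _ _) (*-congˡ (reflexive (≡.cong (double (twist g)) excess-d))) ⟩
      C * double (twist g) d ∎

    X≋ : X lam ≈ C * double g d
    X≋ = begin
      X lam
        ≈⟨ ∑≋sum (E lam) _ ⟩
      sum (E lam) (λ w → q^ (energy w))
        ≈⟨ trans (sum-cong (E lam) (λ w → q^≋var^ (energy w))) (sum-E lam) ⟩
      sum (words (alphabet n) n) (λ w → _)
        ≈⟨ energy-sum K var^L≋0 K small lam part ⟩
      pochhammer n * (D (lam ⊕ ρ n) * double g (+ n ℤ.+ triangle n ℤ.- ∣ lam ⊕ ρ n ∣))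
        ≈⟨ trans (sym (*-assoc _ _ _)) (*-congˡ (reflexive (≡.cong (double g) excess-d))) ⟩
      C * double g d ∎

    double-even : ∀ h M → double h (+ (M ℕ.+ M)) ≡ h M
    double-even h zero    = ≡.refl
    double-even h (suc M) = ≡.trans (≡.cong (λ j → double h (+ suc j)) (ℕ.+-suc M M)) (double-even (h ∘ suc) M)

    double-odd : ∀ h M → double h (+ suc (M ℕ.+ M)) ≡ 0#
    double-odd h zero    = ≡.refl
    double-odd h (suc M) = ≡.trans (≡.cong (λ j → double h (+ suc (suc j))) (ℕ.+-suc M M)) (double-odd (h ∘ suc) M)

    vanishing : (∀ h → double h d ≡ 0#) → ∀ k → k ℕ.< K → u lam (1ⁿ n) k ≡ 0ℤ × X lam k ≡ 0ℤ
    vanishing z k k<K = at (trans u≋ (trans (*-congˡ (reflexive (z (twist g)))) (zeroʳ C))) k k<K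
                      , at (trans X≋ (trans (*-congˡ (reflexive (z g))) (zeroʳ C))) k k<K

    shifted : ∀ M → d ≡ + (M ℕ.+ M) → u lam (1ⁿ n) ≈ var ^ M * X lam
    shifted M eq = begin
      u lam (1ⁿ n)                ≈⟨ trans u≋ (*-congˡ (reflexive (≡.trans (≡.cong (double (twist g)) eq) (double-even (twist g) M)))) ⟩
      C * (var ^ M * g M)         ≈⟨ solve 3 (λ a b c → a :* (b :* c) := b :* (a :* c)) refl _ _ _ ⟩
      var ^ M * (C * g M)         ≈⟨ *-congˡ (trans X≋ (*-congˡ (reflexive (≡.trans (≡.cong (double g) eq) (double-even g M))))) ⟨
      var ^ M * X lam             ∎

    u-below : ∀ M → d ≡ + (M ℕ.+ M) → ∀ k → k ℕ.< K → k ℕ.< M → u lam (1ⁿ n) k ≡ 0ℤ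
    u-below M eq k k<K k<M = ≡.trans (at (shifted M eq) k k<K) (var^-⊛-< M (X lam) k k<M)

    u-above : ∀ M → d ≡ + (M ℕ.+ M) → ∀ k → M ℕ.+ k ℕ.< K → u lam (1ⁿ n) (M ℕ.+ k) ≡ X lam k
    u-above M eq k lt = ≡.trans (at (shifted M eq) (M ℕ.+ k) lt) (var^-⊛-+ M (X lam) k)

-- Series in t and parities of exponents

at-t²-even : ∀ a k → at-t² a (+ (k ℕ.+ k)) ≡ a k
at-t²-even a k with 2 ∣? (k ℕ.+ k)
... | yes (divides k′ eq) = ≡.cong a (≡.sym (ℕ.*-cancelʳ-≡ k k′ 2 (≡.trans (twice k) eq)))
  where
  twice : ∀ k → k ℕ.* 2 ≡ k ℕ.+ k
  twice k = ≡.trans (ℕ.*-comm k 2) (≡.cong (k ℕ.+_) (ℕ.+-identityʳ k))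
... | no ¬even = ⊥-elim (¬even (divides k (≡.sym (≡.trans (ℕ.*-comm k 2) (≡.cong (k ℕ.+_) (ℕ.+-identityʳ k))))))

at-t²-odd : ∀ a k → at-t² a (+ suc (k ℕ.+ k)) ≡ 0ℤ
at-t²-odd a k with 2 ∣? suc (k ℕ.+ k)
... | yes (divides k′ eq) = ⊥-elim (odd≢even k k′ eq)
  where
  odd≢even : ∀ k k′ → suc (k ℕ.+ k) ≡ k′ ℕ.* 2 → _
  odd≢even zero    (suc zero)    ()
  odd≢even (suc k) (suc k′) eq = odd≢even k k′ (ℕ.suc-injective (≡.trans (≡.cong suc (≡.sym (ℕ.+-suc k k))) (ℕ.suc-injective eq)))
... | no _ = ≡.refl

at-t²-zero : ∀ a → (∀ k → a k ≡ 0ℤ) → ∀ m → at-t² a m ≡ 0ℤ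
at-t²-zero a z -[1+ m ] = ≡.refl
at-t²-zero a z (+ m) with 2 ∣? m
... | yes (divides k _) = z k
... | no _              = ≡.refl

at-t²-neg : ∀ a {z} → z ℤ.< 0ℤ → at-t² a z ≡ 0ℤ
at-t²-neg a { -[1+ _ ]} _ = ≡.refl
at-t²-neg a {+ _} (ℤ.+<+ ())

difference : ∀ {k M} → M ℕ.≤ k → + ((k ℕ.∸ M) ℕ.+ (k ℕ.∸ M)) ≡ + (k ℕ.+ k) ℤ.- + (M ℕ.+ M)
difference {k} {M} M≤k = ≡.trans (≡.cong₂ ℤ._+_ half half) (rearrange (+ k) (+ M))
  where
  half : + (k ℕ.∸ M) ≡ + k ℤ.- + M
  half = ≡.sym (≡.trans (ℤ.m-n≡m⊖n k M) (ℤ.⊖-≥ M≤k))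
  rearrange : ∀ k M → (k ℤ.- M) ℤ.+ (k ℤ.- M) ≡ (k ℤ.+ k) ℤ.- (M ℤ.+ M)
  rearrange = solve-∀

at-t²-odd-even : ∀ a k M → at-t² a (+ suc (k ℕ.+ k) ℤ.- + (M ℕ.+ M)) ≡ 0ℤ
at-t²-odd-even a k M with M ℕ.≤? k
... | yes M≤k = ≡.trans (≡.cong (at-t² a) (≡.trans (ℤ.+-assoc 1ℤ (+ (k ℕ.+ k)) (ℤ.- + (M ℕ.+ M))) (≡.cong (ℤ._+_ 1ℤ) (≡.sym (difference M≤k)))))
                  (at-t²-odd a (k ℕ.∸ M))
... | no M≰k  = at-t²-neg a (i<j⇒i-j<0 (ℤ.+<+ (ℕ.≤-trans (ℕ.≤-reflexive (≡.cong suc (≡.sym (ℕ.+-suc k k)))) (ℕ.+-mono-≤ (ℕ.≰⇒> M≰k) (ℕ.≰⇒> M≰k)))))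

data Parity : ℤ → Set where
  even     : ∀ k → Parity (+ (k ℕ.+ k))
  odd      : ∀ k → Parity (+ suc (k ℕ.+ k))
  negative : ∀ k → Parity -[1+ k ]

parity : ∀ z → Parity z
parity -[1+ k ] = negative k
parity (+ m)    = go m
  where
  go : ∀ m → Parity (+ m)
  go zero          = even 0
  go (suc zero)    = odd 0
  go (suc (suc m)) = two-more (go m)
    where
    two-more : ∀ {z} → Parity z → Parity (+ 2 ℤ.+ z)
    two-more (even k)           = ≡.subst (λ j → Parity (+ suc j)) (ℕ.+-suc k k) (even (suc k))
    two-more (odd k)            = ≡.subst (λ j → Parity (+ suc (suc j))) (ℕ.+-suc k k) (odd (suc k))
    two-more (negative zero)    = odd 0
    two-more (negative (suc k)) = parity-⊖ k
      where
      parity-⊖ : ∀ k → Parity (+ 2 ℤ.+ -[1+ suc k ])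
      parity-⊖ zero    = even 0
      parity-⊖ (suc k) = negative k

open import Data.Nat.Base using (_≤_)
open import Data.Integer.Base using (_-_)

mainTheorem9 : (n : ℕ) → 1 ≤ n → (λ′ : Vec ℤ n) → IsPartition λ′ →
    at-t² (u λ′ (1ⁿ n)) ≗ (t^ (+ n - ∣ λ′ ∣) · at-t² (X λ′))
mainTheorem9 n _ lam part m = go (+ n ℤ.- ∣ lam ∣) ≡.refl (parity (+ n ℤ.- ∣ lam ∣))
  where
  -- Coefficients are compared one at a time. For degree k the truncation has to exceed k, and also
  -- the total triangle n + n as demanded by `small`.
  bound : ℕ → ℕ
  bound k = suc (ℤ.∣ triangle n ℤ.+ + n ∣ ℕ.+ k)
  k<bound : ∀ k → k ℕ.< bound k
  k<bound k = s≤s (ℕ.m≤n+m k _)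
  i≤+∣i∣ : ∀ i → i ℤ.≤ + ℤ.∣ i ∣
  i≤+∣i∣ (+ i)    = ℤ.≤-refl
  i≤+∣i∣ -[1+ i ] = ℤ.-≤+
  small : ∀ k → triangle n ℤ.+ + n ℤ.< + bound k
  small k = ℤ.≤-<-trans (i≤+∣i∣ _) (ℤ.+<+ (s≤s (ℕ.m≤m+n _ k)))
  module Tr k = Truncation n (bound k) (small k) (s≤s z≤n)

  both-zero : ∀ d′ → (∀ k → u lam (1ⁿ n) k ≡ 0ℤ × X lam k ≡ 0ℤ) → at-t² (u lam (1ⁿ n)) m ≡ at-t² (X lam) (m ℤ.- d′)
  both-zero d′ z = ≡.trans (at-t²-zero _ (λ k → proj₁ (z k)) m) (≡.sym (at-t²-zero _ (λ k → proj₂ (z k)) (m ℤ.- d′)))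

  even-case : ∀ M → + n ℤ.- ∣ lam ∣ ≡ + (M ℕ.+ M) → ∀ {z} → Parity z → at-t² (u lam (1ⁿ n)) z ≡ at-t² (X lam) (z ℤ.- + (M ℕ.+ M))
  -- The case distinction on M lets the shifted exponent compute to a negative integer, where
  -- `at-t²` is 0.
  even-case zero    eq (negative k) = ≡.refl
  even-case (suc M) eq (negative k) = ≡.refl
  even-case M eq (even k) with M ℕ.≤? k
  ... | yes M≤k = ≡.trans (at-t²-even _ k) (≡.trans (≡.cong (u lam (1ⁿ n)) (≡.sym (ℕ.m+[n∸m]≡n M≤k)))
          (≡.trans (Tr.u-above (M ℕ.+ (k ℕ.∸ M)) lam part M eq (k ℕ.∸ M) (k<bound _))
          (≡.trans (≡.sym (at-t²-even (X lam) (k ℕ.∸ M))) (≡.cong (at-t² (X lam)) (difference M≤k)))))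
  ... | no M≰k = ≡.trans (at-t²-even _ k) (≡.trans (Tr.u-below k lam part M eq k (k<bound k) (ℕ.≰⇒> M≰k))
          (≡.sym (at-t²-neg (X lam) (i<j⇒i-j<0 (ℤ.+<+ (ℕ.+-mono-< (ℕ.≰⇒> M≰k) (ℕ.≰⇒> M≰k)))))))
  even-case M eq (odd k) = ≡.trans (at-t²-odd _ k) (≡.sym (at-t²-odd-even (X lam) k M))

  go : ∀ d → + n ℤ.- ∣ lam ∣ ≡ d → Parity d → at-t² (u lam (1ⁿ n)) m ≡ at-t² (X lam) (m ℤ.- (+ n ℤ.- ∣ lam ∣))
  go _ eq (even M) = ≡.trans (even-case M eq (parity m)) (≡.cong (λ d → at-t² (X lam) (m ℤ.- d)) (≡.sym eq))
  go _ eq (odd M) = both-zero _ (λ k → Tr.vanishing k lam part (λ h → ≡.trans (≡.cong (Euler.double _ _ h) eq) (Tr.double-odd k lam part h M)) k (k<bound k))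
  go _ eq (negative M) = both-zero _ (λ k → Tr.vanishing k lam part (λ h → ≡.cong (Euler.double _ _ h) eq) k (k<bound k))
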